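{- Let $d\ge1$ be a fixed integer and let $\mathcal{H}_d(n)$ be the set of normalized histograms $H$ with $N(H)\le n$. Then for $n\ge1$, $$|\mathcal{H}_d(n)|=\sum_{m=0}^{n}[x^m]\prod_{a\ge1}(1-x^a)^{ -d}\le\exp\left(\pi\sqrt{\frac{2dn}{3}}\right).$$
   Context: A normalized histogram is a finitely supported array $H=(H_{a,r})_{a\ge1,\,1\le r\le d}$ of nonnegative integers, and $N(H)=\sum_{a\ge1}\sum_{r=1}^{d}a\,H_{a,r}$. $[x^m]$ denotes extraction of the coefficient of $x^m$ in a formal power series. -}

module Defs where

open import Level using (0ℓ)
open import Data.Bool.Base using (true; false; if_then_else_)
open import Data.Empty using (⊥; ⊥-elim)
open import Data.Fin.Base using (Fin)
open import Data.Integer.Base as ℤ using (ℤ; +_; 0ℤ; 1ℤ)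
import Data.Integer.Properties as ℤ
open import Data.Nat.Base as ℕ using (ℕ; zero; suc; NonZero; _!)
import Data.Nat.Properties as ℕ
open import Data.Nat.Properties using (_!≢0)
open import Data.Product.Base using (∃; _×_; _,_; proj₁; proj₂)
open import Data.Rational.Base as ℚ using (ℚ; 0ℚ; 1ℚ; ½; ∣_∣; _/_; _≤_; _<_; _+_; _*_; _-_; -_)
open import Data.Rational.Properties as ℚ using (_≤?_)
open import Data.Rational.Solver using (module +-*-Solver)
open import Data.Rational.Unnormalised.Base as ℚᵘ using (mkℚᵘ; *≡*; *≤*)
import Data.Rational.Unnormalised.Properties as ℚᵘ
open import Data.Sum.Base using (_⊎_; inj₁; inj₂; [_,_]′)
open import Data.Vec.Base using (Vec; []; _∷_; head)
open import Function.Bundles using (Inverse)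
open import Function.Base using (_∘_)
open import Relation.Binary.Bundles using (Setoid)
open import Relation.Binary.PropositionalEquality
open import Relation.Nullary.Decidable using (Dec; yes; no)
open import Relation.Nullary.Negation using (¬_)
import Algebra.Properties.CommutativeMonoid.Sum ℕ.+-0-commutativeMonoid as ℕSum
open import Algebra.Definitions.RawSemiring ℚ.+-*-rawSemiring using (_^_)

open +-*-Solver using (solve; _:=_; _:+_; _:*_; _:-_; :-_; con)

-- ⨀ _∙_ ε n f  is  ((ε ∙ f 0) ∙ f 1) ∙ … ∙ f (n - 1).
⨀ : ∀ {A : Set} → (A → A → A) → A → ℕ → (ℕ → A) → A
⨀ _∙_ ε zero    f = ε
⨀ _∙_ ε (suc n) f = ⨀ _∙_ ε n f ∙ f n

∑ℕ : ℕ → (ℕ → ℕ) → ℕ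
∑ℕ = ⨀ ℕ._+_ 0

∑ℤ : ℕ → (ℕ → ℤ) → ℤ
∑ℤ = ⨀ ℤ._+_ 0ℤ

∑ℚ : ℕ → (ℕ → ℚ) → ℚ
∑ℚ = ⨀ _+_ 0ℚ

------------------------------------------------------------------------

⌜_⌝ : ℕ → ℚ
⌜ n ⌝ = + n / 1

1/1+ : ℕ → ℚ
1/1+ n = + 1 / suc n

toℚᵘ-/ : ∀ i n → ℚ.toℚᵘ (i / suc n) ℚᵘ.≃ mkℚᵘ i n
toℚᵘ-/ i n = ℚ.toℚᵘ-fromℚᵘ (mkℚᵘ i n)

toℚᵘ-/*/ : ∀ i m j n →
           ℚ.toℚᵘ ((i / suc m) * (j / suc n)) ℚᵘ.≃ (mkℚᵘ i m) ℚᵘ.* (mkℚᵘ j n)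
toℚᵘ-/*/ i m j n = ℚᵘ.≃-trans (ℚ.toℚᵘ-homo-* (i / suc m) (j / suc n))
                              (ℚᵘ.*-cong (toℚᵘ-/ i m) (toℚᵘ-/ j n))

/-split : ∀ i n → i / suc n ≡ (i / 1) * 1/1+ n
/-split i n = ℚ.toℚᵘ-injective
  (ℚᵘ.≃-trans (toℚᵘ-/ i n)
  (ℚᵘ.≃-trans (*≡* (trans (cong (λ k → i ℤ.* + suc k) (ℕ.+-identityʳ n)) (cong (ℤ._* + suc n) (sym (ℤ.*-identityʳ i)))))
              (ℚᵘ.≃-sym (toℚᵘ-/*/ i 0 (+ 1) n))))

1/-* : ∀ m n .{{_ : NonZero m}} .{{_ : NonZero n}} .{{_ : NonZero (m ℕ.* n)}} →
       + 1 / (m ℕ.* n) ≡ (+ 1 / m) * (+ 1 / n)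
1/-* (suc m) (suc n) = ℚ.toℚᵘ-injective
  (ℚᵘ.≃-trans (toℚᵘ-/ (+ 1) _) (ℚᵘ.≃-sym (toℚᵘ-/*/ (+ 1) m (+ 1) n)))

⌜⌝*1/ : ∀ n → ⌜ suc n ⌝ * 1/1+ n ≡ 1ℚ
⌜⌝*1/ n = ℚ.toℚᵘ-injective
  (ℚᵘ.≃-trans (toℚᵘ-/*/ (+ suc n) 0 (+ 1) n)
    (*≡* (trans (ℤ.*-identityʳ _) (trans (ℤ.*-identityʳ (+ suc n)) (sym (trans (ℤ.*-identityˡ _) (cong (+_ ∘ suc) (ℕ.+-identityʳ n))))))))

⌜⌝-+ : ∀ m n → ⌜ m ℕ.+ n ⌝ ≡ ⌜ m ⌝ + ⌜ n ⌝
⌜⌝-+ m n = ℚ.toℚᵘ-injective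
  (ℚᵘ.≃-trans (toℚᵘ-/ (+ (m ℕ.+ n)) 0)
  (ℚᵘ.≃-trans (*≡* (cong (ℤ._* + 1) (trans (ℤ.pos-+ m n) (sym (cong₂ ℤ._+_ (ℤ.*-identityʳ (+ m)) (ℤ.*-identityʳ (+ n)))))))
  (ℚᵘ.≃-sym (ℚᵘ.≃-trans (ℚ.toℚᵘ-homo-+ ⌜ m ⌝ ⌜ n ⌝) (ℚᵘ.+-cong (toℚᵘ-/ (+ m) 0) (toℚᵘ-/ (+ n) 0))))))

⌜⌝-* : ∀ m n → ⌜ m ℕ.* n ⌝ ≡ ⌜ m ⌝ * ⌜ n ⌝
⌜⌝-* m n = ℚ.toℚᵘ-injective
  (ℚᵘ.≃-trans (toℚᵘ-/ (+ (m ℕ.* n)) 0)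
  (ℚᵘ.≃-trans (*≡* (cong (ℤ._* + 1) (ℤ.pos-* m n)))
  (ℚᵘ.≃-sym (toℚᵘ-/*/ (+ m) 0 (+ n) 0))))

0≤⌜⌝ : ∀ n → 0ℚ ≤ ⌜ n ⌝
0≤⌜⌝ n = ℚ.nonNegative⁻¹ ⌜ n ⌝ {{ℚ.normalize-nonNeg n 1}}

0<1/1+ : ∀ n → 0ℚ < 1/1+ n
0<1/1+ n = ℚ.positive⁻¹ (1/1+ n) {{ℚ.normalize-pos 1 (suc n)}}

0≤1/1+ : ∀ n → 0ℚ ≤ 1/1+ n
0≤1/1+ n = ℚ.<⇒≤ (0<1/1+ n)

⌜⌝-mono : ∀ {m n} → m ℕ.≤ n → ⌜ m ⌝ ≤ ⌜ n ⌝
⌜⌝-mono {m} {n} m≤n = subst₂ _≤_ (ℚ.+-identityʳ ⌜ m ⌝)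
  (trans (sym (⌜⌝-+ m (n ℕ.∸ m))) (cong ⌜_⌝ (ℕ.m+[n∸m]≡n m≤n)))
  (ℚ.+-monoʳ-≤ ⌜ m ⌝ (0≤⌜⌝ (n ℕ.∸ m)))

≤⌜∣↥∣⌝ : ∀ q → q ≤ ⌜ ℤ.∣ ℚ.↥ q ∣ ⌝
≤⌜∣↥∣⌝ q = ℚ.toℚᵘ-cancel-≤ (ℚᵘ.≤-trans (h q) (ℚᵘ.≤-reflexive (ℚᵘ.≃-sym (toℚᵘ-/ (+ ℤ.∣ ℚ.↥ q ∣) 0))))
  where
  h : ∀ q → ℚ.toℚᵘ q ℚᵘ.≤ mkℚᵘ (+ ℤ.∣ ℚ.↥ q ∣) 0
  h (ℚ.mkℚ (+ n) d _) = *≤* (subst₂ ℤ._≤_ (ℤ.pos-* n 1) (ℤ.pos-* n (suc d)) (ℤ.+≤+ (ℕ.*-monoʳ-≤ n (ℕ.s≤s ℕ.z≤n))))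
  h (ℚ.mkℚ (ℤ.-[1+ n ]) d _) = *≤* ℤ.-≤+

*-mono : ∀ {p q r s} → 0ℚ ≤ q → 0ℚ ≤ r → p ≤ q → r ≤ s → p * r ≤ q * s
*-mono {p} {q} {r} {s} 0≤q 0≤r p≤q r≤s = ℚ.≤-trans
  (ℚ.*-monoʳ-≤-nonNeg r {{ℚ.nonNegative 0≤r}} p≤q)
  (ℚ.*-monoˡ-≤-nonNeg q {{ℚ.nonNegative 0≤q}} r≤s)

0≤* : ∀ {p q} → 0ℚ ≤ p → 0ℚ ≤ q → 0ℚ ≤ p * q
0≤* {p} {q} 0≤p 0≤q = subst (_≤ p * q) (ℚ.*-zeroʳ p) (ℚ.*-monoˡ-≤-nonNeg p {{ℚ.nonNegative 0≤p}} 0≤q)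

0≤+ : ∀ {p q} → 0ℚ ≤ p → 0ℚ ≤ q → 0ℚ ≤ p + q
0≤+ = ℚ.+-mono-≤

0<* : ∀ {p q} → 0ℚ < p → 0ℚ < q → 0ℚ < p * q
0<* {p} {q} 0<p 0<q = subst (_< p * q) (ℚ.*-zeroʳ p) (ℚ.*-monoʳ-<-pos p {{ℚ.positive 0<p}} 0<q)

0<½ : 0ℚ < ½
0<½ = 0<1/1+ 1

½+½ : ∀ ε → ε * ½ + ε * ½ ≡ ε
½+½ ε = trans (sym (ℚ.*-distribˡ-+ ε ½ ½)) (ℚ.*-identityʳ ε)

p≤∣p∣ : ∀ p → p ≤ ∣ p ∣
p≤∣p∣ p with ℚ.≤-total 0ℚ p
... | inj₁ 0≤p = ℚ.≤-reflexive (sym (ℚ.0≤p⇒∣p∣≡p 0≤p))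
... | inj₂ p≤0 = ℚ.≤-trans p≤0 (ℚ.0≤∣p∣ p)

∣p∣≤ : ∀ {p ε} → p ≤ ε → - p ≤ ε → ∣ p ∣ ≤ ε
∣p∣≤ {p} p≤ε -p≤ε with ℚ.∣p∣≡p∨∣p∣≡-p p
... | inj₁ eq = subst (_≤ _) (sym eq) p≤ε
... | inj₂ eq = subst (_≤ _) (sym eq) -p≤ε

∣p-q∣≡∣q-p∣ : ∀ p q → ∣ p - q ∣ ≡ ∣ q - p ∣
∣p-q∣≡∣q-p∣ p q = trans (sym (ℚ.∣-p∣≡∣p∣ (p - q)))
  (cong ∣_∣ (solve 2 (λ p q → :- (p :- q) := q :- p) refl p q))

≤+⇒-≤ : ∀ {p q r} → p ≤ q + r → p - q ≤ r
≤+⇒-≤ {p} {q} {r} h = subst (p - q ≤_) (solve 2 (λ q r → (q :+ r) :- q := r) refl q r) (ℚ.+-monoˡ-≤ (- q) h)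

-≤⇒≤+ : ∀ {p q r} → p - q ≤ r → p ≤ q + r
-≤⇒≤+ {p} {q} {r} h = subst (_≤ q + r) (solve 2 (λ p q → q :+ (p :- q) := p) refl p q) (ℚ.+-monoʳ-≤ q h)

∣p-q∣≤ : ∀ {p q ε} → p ≤ q + ε → q ≤ p + ε → ∣ p - q ∣ ≤ ε
∣p-q∣≤ {p} {q} {ε} h k = ∣p∣≤ (≤+⇒-≤ h)
  (subst (_≤ ε) (solve 2 (λ p q → q :- p := :- (p :- q)) refl p q) (≤+⇒-≤ k))

1/1+-small : ∀ {ε} → 0ℚ < ε → ∃ λ N → ∀ n → N ℕ.≤ n → 1/1+ n ≤ ε
1/1+-small {ε} 0<ε = N , small
  where
  instance
    _ = ℚ.positive 0<ε
    _ = ℚ.pos⇒nonZero ε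
  N = ℤ.∣ ℚ.↥ (ℚ.1/ ε) ∣
  small : ∀ n → N ℕ.≤ n → 1/1+ n ≤ ε
  small n N≤n = subst₂ _≤_ lhs (ℚ.*-identityʳ ε)
    (ℚ.*-monoˡ-≤-nonNeg ε {{ℚ.pos⇒nonNeg ε}}
      (subst (ℚ.1/ ε * 1/1+ n ≤_) (⌜⌝*1/ n)
        (ℚ.*-monoʳ-≤-nonNeg (1/1+ n) {{ℚ.nonNegative (0≤1/1+ n)}}
          (ℚ.≤-trans (≤⌜∣↥∣⌝ (ℚ.1/ ε)) (⌜⌝-mono (ℕ.m≤n⇒m≤1+n N≤n))))))
    where
    lhs : ε * (ℚ.1/ ε * 1/1+ n) ≡ 1/1+ n
    lhs = trans (sym (ℚ.*-assoc ε (ℚ.1/ ε) (1/1+ n)))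
      (trans (cong (_* 1/1+ n) (ℚ.*-inverseʳ ε)) (ℚ.*-identityˡ (1/1+ n)))

------------------------------------------------------------------------
-- Real numbers as Cauchy sequences of rationals; the existential quantifier in
-- IsCauchy carries the modulus of convergence.  _≤ᴿ_ depends only on the limits.

IsCauchy : (ℕ → ℚ) → Set
IsCauchy x = ∀ ε → 0ℚ < ε → ∃ λ N → ∀ m n → N ℕ.≤ m → N ℕ.≤ n → ∣ x m - x n ∣ ≤ ε

record ℝ : Set where
  constructor mkℝ
  field
    seq    : ℕ → ℚ
    cauchy : IsCauchy seq

open ℝ public

infix 4 _≤ᴿ_
infixl 7 _*ᴿ_

_≤ᴿ_ : ℝ → ℝ → Set
x ≤ᴿ y = ∀ ε → 0ℚ < ε → ∃ λ N → ∀ n → N ℕ.≤ n → seq x n ≤ seq y n + ε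

EventuallyBounded : (ℕ → ℚ) → Set
EventuallyBounded x = ∃ λ b → ∃ λ N → ∀ n → N ℕ.≤ n → ∣ x n ∣ ≤ ⌜ suc b ⌝

cauchy⇒bounded : ∀ {x} → IsCauchy x → EventuallyBounded x
cauchy⇒bounded {x} c with c 1ℚ (0<1/1+ 0)
... | N , close = b , N , bound
  where
  b = ℤ.∣ ℚ.↥ ∣ x N ∣ ∣
  bound : ∀ n → N ℕ.≤ n → ∣ x n ∣ ≤ ⌜ suc b ⌝
  bound n N≤n = begin
    ∣ x n ∣                  ≡⟨ cong ∣_∣ (solve 2 (λ p q → p := (p :- q) :+ q) refl (x n) (x N)) ⟩
    ∣ (x n - x N) + x N ∣    ≤⟨ ℚ.∣p+q∣≤∣p∣+∣q∣ (x n - x N) (x N) ⟩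
    ∣ x n - x N ∣ + ∣ x N ∣  ≤⟨ ℚ.+-mono-≤ (close n N N≤n ℕ.≤-refl) (≤⌜∣↥∣⌝ ∣ x N ∣) ⟩
    1ℚ + ⌜ b ⌝               ≡⟨ sym (⌜⌝-+ 1 b) ⟩
    ⌜ suc b ⌝                ∎
    where open ℚ.≤-Reasoning

shrink : ∀ b ε → 0ℚ < ε → ∃ λ δ → 0ℚ < δ × ⌜ suc b ⌝ * δ ≡ ε
shrink b ε 0<ε = 1/1+ b * ε , 0<* (0<1/1+ b) 0<ε ,
  trans (sym (ℚ.*-assoc ⌜ suc b ⌝ (1/1+ b) ε)) (trans (cong (_* ε) (⌜⌝*1/ b)) (ℚ.*-identityˡ ε))

-- It suffices to compare later terms with earlier ones.
cauchy-ordered : ∀ {x} →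
  (∀ ε → 0ℚ < ε → ∃ λ N → ∀ m n → N ℕ.≤ n → n ℕ.≤ m → ∣ x m - x n ∣ ≤ ε) → IsCauchy x
cauchy-ordered {x} c ε 0<ε with c ε 0<ε
... | N , close = N , both
  where
  both : ∀ m n → N ℕ.≤ m → N ℕ.≤ n → ∣ x m - x n ∣ ≤ ε
  both m n N≤m N≤n with ℕ.≤-total n m
  ... | inj₁ n≤m = close m n N≤n n≤m
  ... | inj₂ m≤n = subst (_≤ ε) (∣p-q∣≡∣q-p∣ (x n) (x m)) (close n m N≤m m≤n)

fromℚ : ℚ → ℝ
fromℚ q = mkℝ (λ _ → q) λ ε 0<ε → 0 , λ _ _ _ _ →
  ∣p-q∣≤ (q≤q+ε 0<ε) (q≤q+ε 0<ε)
  where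
  q≤q+ε : ∀ {ε} → 0ℚ < ε → q ≤ q + ε
  q≤q+ε {ε} 0<ε = subst (_≤ q + ε) (ℚ.+-identityʳ q) (ℚ.+-monoʳ-≤ q (ℚ.<⇒≤ 0<ε))

*-close : ∀ {a b δ η ε} xm xn ym yn → 0ℚ ≤ a → 0ℚ ≤ b →
          ∣ xm ∣ ≤ a → ∣ ym - yn ∣ ≤ δ → ∣ yn ∣ ≤ b → ∣ xm - xn ∣ ≤ η →
          a * δ ≡ ε * ½ → b * η ≡ ε * ½ → ∣ xm * ym - xn * yn ∣ ≤ ε
*-close {a} {b} {δ} {η} {ε} xm xn ym yn 0≤a 0≤b x≤a y≤δ y≤b x≤η aδ bη = begin
  ∣ xm * ym - xn * yn ∣
    ≡⟨ cong ∣_∣ (solve 4 (λ a b c d → a :* b :- c :* d := a :* (b :- d) :+ d :* (a :- c)) refl xm ym xn yn) ⟩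
  ∣ xm * (ym - yn) + yn * (xm - xn) ∣
    ≤⟨ ℚ.∣p+q∣≤∣p∣+∣q∣ (xm * (ym - yn)) (yn * (xm - xn)) ⟩
  ∣ xm * (ym - yn) ∣ + ∣ yn * (xm - xn) ∣
    ≡⟨ cong₂ _+_ (ℚ.∣p*q∣≡∣p∣*∣q∣ xm (ym - yn)) (ℚ.∣p*q∣≡∣p∣*∣q∣ yn (xm - xn)) ⟩
  ∣ xm ∣ * ∣ ym - yn ∣ + ∣ yn ∣ * ∣ xm - xn ∣
    ≤⟨ ℚ.+-mono-≤ (*-mono 0≤a (ℚ.0≤∣p∣ (ym - yn)) x≤a y≤δ) (*-mono 0≤b (ℚ.0≤∣p∣ (xm - xn)) y≤b x≤η) ⟩
  a * δ + b * η
    ≡⟨ cong₂ _+_ aδ bη ⟩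
  ε * ½ + ε * ½
    ≡⟨ ½+½ ε ⟩
  ε ∎
  where open ℚ.≤-Reasoning

_*ᴿ_ : ℝ → ℝ → ℝ
x *ᴿ y = mkℝ (λ n → seq x n * seq y n) *-cauchy
  where
  *-cauchy : IsCauchy (λ n → seq x n * seq y n)
  *-cauchy ε 0<ε = N , λ m n N≤m N≤n →
    *-close (seq x m) (seq x n) (seq y m) (seq y n) (0≤⌜⌝ (suc a)) (0≤⌜⌝ (suc b))
      (∣x∣≤a m (ℕ.≤-trans (ℕ.≤-trans (ℕ.m≤m⊔n A B) (ℕ.m≤m⊔n (A ℕ.⊔ B) (K ℕ.⊔ L))) N≤m))
      (closeʸ m n (below-K N≤m) (below-K N≤n))
      (∣y∣≤b n (ℕ.≤-trans (ℕ.≤-trans (ℕ.m≤n⊔m A B) (ℕ.m≤m⊔n (A ℕ.⊔ B) (K ℕ.⊔ L))) N≤n))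
      (closeˣ m n (below-L N≤m) (below-L N≤n))
      aδ bη
    where
    bx = cauchy⇒bounded (cauchy x)
    by = cauchy⇒bounded (cauchy y)
    a = proj₁ bx
    A = proj₁ (proj₂ bx)
    ∣x∣≤a = proj₂ (proj₂ bx)
    b = proj₁ by
    B = proj₁ (proj₂ by)
    ∣y∣≤b = proj₂ (proj₂ by)
    sδ = shrink a (ε * ½) (0<* 0<ε 0<½)
    sη = shrink b (ε * ½) (0<* 0<ε 0<½)
    aδ = proj₂ (proj₂ sδ)
    bη = proj₂ (proj₂ sη)
    cy = cauchy y (proj₁ sδ) (proj₁ (proj₂ sδ))
    cx = cauchy x (proj₁ sη) (proj₁ (proj₂ sη))
    K = proj₁ cy
    closeʸ = proj₂ cy
    L = proj₁ cx
    closeˣ = proj₂ cx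
    N = (A ℕ.⊔ B) ℕ.⊔ (K ℕ.⊔ L)
    below-K : ∀ {k} → N ℕ.≤ k → K ℕ.≤ k
    below-K = ℕ.≤-trans (ℕ.≤-trans (ℕ.m≤m⊔n K L) (ℕ.m≤n⊔m (A ℕ.⊔ B) (K ℕ.⊔ L)))
    below-L : ∀ {k} → N ℕ.≤ k → L ℕ.≤ k
    below-L = ℕ.≤-trans (ℕ.≤-trans (ℕ.m≤n⊔m K L) (ℕ.m≤n⊔m (A ℕ.⊔ B) (K ℕ.⊔ L)))

------------------------------------------------------------------------
-- π = 4 arctan 1, with arctan 1 given by its Taylor series

leibniz : ℕ → ℚ
leibniz n = ∑ℚ n (λ k → (- 1ℚ) ^ k * 1/1+ (2 ℕ.* k))

-- The remainder after n terms has the sign of the n-th term and is at most as large.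
leibniz-bound : ∀ j n → ∣ leibniz (n ℕ.+ j) - leibniz n ∣ ≤ 1/1+ (2 ℕ.* n)
leibniz-bound j n = subst (_≤ 1/1+ (2 ℕ.* n)) (unsign (sgn n) (rem j n) (∣sgn∣ n))
  (∣p∣≤ (proj₂ (signed j n))
    (ℚ.≤-trans (ℚ.neg-antimono-≤ (proj₁ (signed j n))) (0≤1/1+ (2 ℕ.* n))))
  where
  sgn : ℕ → ℚ
  sgn n = (- 1ℚ) ^ n

  rem : ℕ → ℕ → ℚ
  rem j n = leibniz (n ℕ.+ j) - leibniz n

  ∣sgn∣ : ∀ n → ∣ sgn n ∣ ≡ 1ℚ
  ∣sgn∣ zero    = refl
  ∣sgn∣ (suc n) = trans (ℚ.∣p*q∣≡∣p∣*∣q∣ (- 1ℚ) (sgn n)) (trans (ℚ.*-identityˡ ∣ sgn n ∣) (∣sgn∣ n))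

  sgn² : ∀ n → sgn n * sgn n ≡ 1ℚ
  sgn² zero    = refl
  sgn² (suc n) = trans (lemma (sgn n)) (sgn² n)
    where
    lemma : ∀ s → (- 1ℚ * s) * (- 1ℚ * s) ≡ s * s
    lemma s = solve 1 (λ s → (con (- 1ℚ) :* s) :* (con (- 1ℚ) :* s) := s :* s) refl s

  unsign : ∀ s p → ∣ s ∣ ≡ 1ℚ → ∣ s * p ∣ ≡ ∣ p ∣
  unsign s p h = trans (ℚ.∣p*q∣≡∣p∣*∣q∣ s p) (trans (cong (_* ∣ p ∣) h) (ℚ.*-identityˡ ∣ p ∣))

  cancel : ∀ p q r → p * q ≡ 1ℚ → p * (q * r) ≡ r
  cancel p q r h = trans (sym (ℚ.*-assoc p q r)) (trans (cong (_* r) h) (ℚ.*-identityˡ r))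

  1/1+-anti : ∀ {m n} → m ℕ.≤ n → 1/1+ n ≤ 1/1+ m
  1/1+-anti {m} {n} m≤n = subst₂ _≤_
    (cancel ⌜ suc m ⌝ (1/1+ m) (1/1+ n) (⌜⌝*1/ m))
    (trans (cong (⌜ suc n ⌝ *_) (ℚ.*-comm (1/1+ m) (1/1+ n))) (cancel ⌜ suc n ⌝ (1/1+ n) (1/1+ m) (⌜⌝*1/ n)))
    (ℚ.*-monoʳ-≤-nonNeg (1/1+ m * 1/1+ n) {{ℚ.nonNegative (0≤* (0≤1/1+ m) (0≤1/1+ n))}} (⌜⌝-mono (ℕ.s≤s m≤n)))

  step : ∀ s r l l″ → s * s ≡ 1ℚ → s * (l″ - l) ≡ r - (- 1ℚ * s) * (l″ - (l + s * r))
  step s r l l″ h = trans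
    (solve 4 (λ s r l m → s :* (m :- l) := (s :* s) :* r :- (con (- 1ℚ) :* s) :* (m :- (l :+ s :* r))) refl s r l l″)
    (cong (_- (- 1ℚ * s) * (l″ - (l + s * r))) (trans (cong (_* r) h) (ℚ.*-identityˡ r)))

  between : ∀ {v r rest} → v ≡ r - rest → 0ℚ ≤ rest → rest ≤ r → 0ℚ ≤ v × v ≤ r
  between {v} {r} {rest} eq 0≤rest rest≤r =
    subst (0ℚ ≤_) (sym eq) (subst (_≤ r - rest) (ℚ.+-inverseʳ r) (ℚ.+-monoʳ-≤ r (ℚ.neg-antimono-≤ rest≤r))) ,
    subst (_≤ r) (sym eq) (subst (r - rest ≤_) (ℚ.+-identityʳ r) (ℚ.+-monoʳ-≤ r (ℚ.neg-antimono-≤ 0≤rest)))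

  vanish : ∀ {l l′} s → l ≡ l′ → s * (l - l′) ≡ 0ℚ
  vanish {l} s refl = trans (cong (s *_) (ℚ.+-inverseʳ l)) (ℚ.*-zeroʳ s)

  atZero : ∀ {v r} → v ≡ 0ℚ → 0ℚ ≤ r → 0ℚ ≤ v × v ≤ r
  atZero refl 0≤r = ℚ.≤-refl , 0≤r

  signed : ∀ j n → 0ℚ ≤ sgn n * rem j n × sgn n * rem j n ≤ 1/1+ (2 ℕ.* n)
  signed zero    n = atZero (vanish (sgn n) (cong leibniz (ℕ.+-identityʳ n))) (0≤1/1+ (2 ℕ.* n))
  signed (suc j) n = between
    (trans (cong (λ k → sgn n * (leibniz k - leibniz n)) (ℕ.+-suc n j))
           (step (sgn n) (1/1+ (2 ℕ.* n)) (leibniz n) (leibniz (suc n ℕ.+ j)) (sgn² n)))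
    (proj₁ (signed j (suc n)))
    (ℚ.≤-trans (proj₂ (signed j (suc n))) (1/1+-anti (ℕ.*-monoʳ-≤ 2 (ℕ.n≤1+n n))))

π : ℝ
π = fromℚ ⌜ 4 ⌝ *ᴿ mkℝ leibniz (cauchy-ordered {leibniz} leibniz-cauchy)
  where
  leibniz-cauchy : ∀ ε → 0ℚ < ε → ∃ λ N → ∀ m n → N ℕ.≤ n → n ℕ.≤ m → ∣ leibniz m - leibniz n ∣ ≤ ε
  leibniz-cauchy ε 0<ε = proj₁ (1/1+-small 0<ε) , λ m n N≤n n≤m → ℚ.≤-trans
    (subst (λ k → ∣ leibniz k - leibniz n ∣ ≤ 1/1+ (2 ℕ.* n)) (ℕ.m+[n∸m]≡n n≤m) (leibniz-bound (m ℕ.∸ n) n))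
    (proj₂ (1/1+-small 0<ε) (2 ℕ.* n) (ℕ.≤-trans N≤n (ℕ.m≤m+n n (n ℕ.+ 0))))

------------------------------------------------------------------------
-- Square root, with √ x = 0 for x ≤ 0.  The n-th approximation is the largest
-- multiple of 1/(n + 1) whose square does not exceed the n-th term of x.

largest : ∀ {P : ℕ → Set} → (∀ k → Dec (P k)) → ℕ → ℕ
largest P? zero = zero
largest P? (suc b) with P? (suc b)
... | yes _ = suc b
... | no  _ = largest P? b

largest-spec : ∀ {P : ℕ → Set} (P? : ∀ k → Dec (P k)) b → ¬ P (suc b) →
               (P (largest P? b) ⊎ largest P? b ≡ 0) × ¬ P (suc (largest P? b))
largest-spec P? zero    ¬P = inj₂ refl , ¬P
largest-spec P? (suc b) ¬P with P? (suc b)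
... | yes p  = inj₁ p , ¬P
... | no  ¬p = largest-spec P? b ¬p

_² : ℚ → ℚ
q ² = q * q

√-grid : ℚ → ℕ → ℕ
√-grid q n = largest (λ k → (+ k / suc n) ² ≤? q) (suc ℤ.∣ ℚ.↥ q ∣ ℕ.* suc n)

√-approx : ℚ → ℕ → ℚ
√-approx q n = + √-grid q n / suc n

grid-suc : ∀ k n → + suc k / suc n ≡ + k / suc n + 1/1+ n
grid-suc k n = begin
  + suc k / suc n                  ≡⟨ /-split (+ suc k) n ⟩
  ⌜ suc k ⌝ * 1/1+ n               ≡⟨ cong (λ j → ⌜ j ⌝ * 1/1+ n) (ℕ.+-comm 1 k) ⟩
  ⌜ k ℕ.+ 1 ⌝ * 1/1+ n             ≡⟨ cong (_* 1/1+ n) (⌜⌝-+ k 1) ⟩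
  (⌜ k ⌝ + 1ℚ) * 1/1+ n            ≡⟨ ℚ.*-distribʳ-+ (1/1+ n) ⌜ k ⌝ 1ℚ ⟩
  ⌜ k ⌝ * 1/1+ n + 1ℚ * 1/1+ n     ≡⟨ cong₂ _+_ (sym (/-split (+ k) n)) (ℚ.*-identityˡ (1/1+ n)) ⟩
  + k / suc n + 1/1+ n             ∎
  where open ≡-Reasoning

0≤grid : ∀ k n → 0ℚ ≤ + k / suc n
0≤grid k n = ℚ.nonNegative⁻¹ (+ k / suc n) {{ℚ.normalize-nonNeg k (suc n)}}

²-mono : ∀ {p q} → 0ℚ ≤ p → p ≤ q → p ² ≤ q ²
²-mono {p} {q} 0≤p p≤q = *-mono {p} {q} {p} {q} (ℚ.≤-trans 0≤p p≤q) 0≤p p≤q p≤q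

above-grid : ∀ q n → ¬ ((+ suc (suc ℤ.∣ ℚ.↥ q ∣ ℕ.* suc n) / suc n) ² ≤ q)
above-grid q n h = ℚ.<-irrefl refl (begin-strict
  q                                       ≤⟨ ≤⌜∣↥∣⌝ q ⟩
  ⌜ c ⌝                                   ≡⟨ sym (ℚ.+-identityʳ ⌜ c ⌝) ⟩
  ⌜ c ⌝ + 0ℚ                              <⟨ ℚ.+-monoʳ-< ⌜ c ⌝ (0<1/1+ 0) ⟩
  ⌜ c ⌝ + 1ℚ                              ≡⟨ sym (⌜⌝-+ c 1) ⟩
  ⌜ c ℕ.+ 1 ⌝                             ≡⟨ cong ⌜_⌝ (ℕ.+-comm c 1) ⟩
  ⌜ suc c ⌝                               ≤⟨ ⌜⌝-mono (ℕ.m≤m*n (suc c) (suc c)) ⟩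
  ⌜ suc c ℕ.* suc c ⌝                     ≡⟨ ⌜⌝-* (suc c) (suc c) ⟩
  ⌜ suc c ⌝ ²                             ≤⟨ ²-mono (0≤⌜⌝ (suc c)) c≤ ⟩
  (+ suc (suc c ℕ.* suc n) / suc n) ²     ≤⟨ h ⟩
  q                                       ∎)
  where
  open ℚ.≤-Reasoning
  c = ℤ.∣ ℚ.↥ q ∣
  eq : ∀ c → + (suc c ℕ.* suc n) / suc n ≡ ⌜ suc c ⌝
  eq c = trans (/-split (+ (suc c ℕ.* suc n)) n)
    (trans (cong (_* 1/1+ n) (⌜⌝-* (suc c) (suc n)))
    (trans (ℚ.*-assoc ⌜ suc c ⌝ ⌜ suc n ⌝ (1/1+ n))
    (trans (cong (⌜ suc c ⌝ *_) (⌜⌝*1/ n)) (ℚ.*-identityʳ ⌜ suc c ⌝))))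
  c≤ : ⌜ suc c ⌝ ≤ + suc (suc c ℕ.* suc n) / suc n
  c≤ = subst₂ _≤_ (trans (ℚ.+-identityʳ _) (eq c)) (sym (grid-suc (suc c ℕ.* suc n) n))
    (ℚ.+-monoʳ-≤ (+ (suc c ℕ.* suc n) / suc n) (0≤1/1+ n))

√-approx-lower : ∀ q n → √-approx q n ² ≤ q ⊎ √-approx q n ≡ 0ℚ
√-approx-lower q n = [ inj₁ , (λ eq → inj₂ (trans (cong (λ k → + k / suc n) eq) (ℚ.0/n≡0 (suc n)))) ]′
  (proj₁ (largest-spec (λ k → (+ k / suc n) ² ≤? q) (suc ℤ.∣ ℚ.↥ q ∣ ℕ.* suc n) (above-grid q n)))

√-approx-upper : ∀ q n → q < (√-approx q n + 1/1+ n) ²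
√-approx-upper q n = subst (λ s → q < s ²) (grid-suc (√-grid q n) n)
  (ℚ.≰⇒> (proj₂ (largest-spec (λ k → (+ k / suc n) ² ≤? q) (suc ℤ.∣ ℚ.↥ q ∣ ℕ.* suc n) (above-grid q n))))

√-close : ∀ p q s t h δ → (s ² ≤ p ⊎ s ≡ 0ℚ) → 0ℚ ≤ t → 0ℚ ≤ h → 0ℚ < δ →
          q < (t + h) ² → p ≤ q + δ ² → h ≤ δ → s ≤ t + (δ + δ)
√-close p q s t h δ (inj₂ refl) 0≤t 0≤h 0<δ _ _ _ = 0≤+ 0≤t (0≤+ (ℚ.<⇒≤ 0<δ) (ℚ.<⇒≤ 0<δ))
√-close p q s t h δ (inj₁ s²≤p) 0≤t 0≤h 0<δ q<² p≤ h≤δ = [ bounded , ⊥-elim ∘ absurd ]′ (ℚ.≤-total s (t + h + δ))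
  where
  open ℚ.≤-Reasoning
  0≤δ = ℚ.<⇒≤ 0<δ
  0≤t+h = 0≤+ 0≤t 0≤h
  bounded : s ≤ t + h + δ → s ≤ t + (δ + δ)
  bounded s≤ = begin
    s              ≤⟨ s≤ ⟩
    t + h + δ      ≡⟨ ℚ.+-assoc t h δ ⟩
    t + (h + δ)    ≤⟨ ℚ.+-monoʳ-≤ t (ℚ.+-monoˡ-≤ δ h≤δ) ⟩
    t + (δ + δ)    ∎
  absurd : t + h + δ ≤ s → ⊥
  absurd ≤s = ℚ.<-irrefl refl (begin-strict
    s ²                                        ≤⟨ s²≤p ⟩
    p                                          ≤⟨ p≤ ⟩
    q + δ ²                                    <⟨ ℚ.+-monoˡ-< (δ ²) q<² ⟩
    (t + h) ² + δ ²                            ≡⟨ sym (ℚ.+-identityʳ _) ⟩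
    (t + h) ² + δ ² + 0ℚ                       ≤⟨ ℚ.+-monoʳ-≤ ((t + h) ² + δ ²) (0≤+ (0≤* 0≤t+h 0≤δ) (0≤* 0≤t+h 0≤δ)) ⟩
    (t + h) ² + δ ² + ((t + h) * δ + (t + h) * δ)  ≡⟨ solve 2 (λ a d → a :* a :+ d :* d :+ (a :* d :+ a :* d) := (a :+ d) :* (a :+ d)) refl (t + h) δ ⟩
    (t + h + δ) ²                              ≤⟨ ²-mono (0≤+ 0≤t+h 0≤δ) ≤s ⟩
    s ²                                        ∎)

√ : ℝ → ℝ
√ x = mkℝ s √-cauchy
  where
  s : ℕ → ℚ
  s n = √-approx (seq x n) n

  √-cauchy : IsCauchy s
  √-cauchy ε 0<ε = N , λ m n N≤m N≤n → ∣p-q∣≤ {s m} {s n} {ε} (oneSided m n N≤m N≤n) (oneSided n m N≤n N≤m)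
    where
    δ = ε * ½
    0<δ = 0<* 0<ε 0<½
    cx = cauchy x (δ ²) (0<* 0<δ 0<δ)
    sm = 1/1+-small 0<δ
    N = proj₁ cx ℕ.⊔ proj₁ sm
    oneSided : ∀ m n → N ℕ.≤ m → N ℕ.≤ n → s m ≤ s n + ε
    oneSided m n N≤m N≤n = subst (λ e → s m ≤ s n + e) (½+½ ε)
      (√-close (seq x m) (seq x n) (s m) (s n) (1/1+ n) δ
        (√-approx-lower (seq x m) m) (0≤grid (√-grid (seq x n) n) n) (0≤1/1+ n) 0<δ (√-approx-upper (seq x n) n)
        (-≤⇒≤+ (ℚ.≤-trans (p≤∣p∣ (seq x m - seq x n)) (proj₂ cx m n (below N≤m) (below N≤n))))
        (proj₂ sm n (ℕ.≤-trans (ℕ.m≤n⊔m (proj₁ cx) (proj₁ sm)) N≤n)))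
      where
      below : ∀ {k} → N ℕ.≤ k → proj₁ cx ℕ.≤ k
      below = ℕ.≤-trans (ℕ.m≤m⊔n (proj₁ cx) (proj₁ sm))


------------------------------------------------------------------------
-- Exponential function.  The n-th approximation is the n-th partial sum of the
-- power series at the n-th term of x.

expTerm : ℕ → ℚ → ℚ
expTerm k q = q ^ k * (+ 1 / k !) {{k !≢0}}

expSum : ℕ → ℚ → ℚ
expSum n q = ∑ℚ n (λ k → expTerm k q)

expTerm-suc : ∀ k q → expTerm (suc k) q ≡ (q * expTerm k q) * 1/1+ k
expTerm-suc k q = trans
  (cong (q ^ suc k *_) (1/-* (suc k) (k !) {{_}} {{k !≢0}} {{suc k !≢0}}))
  (lemma q (q ^ k) (1/1+ k) ((+ 1 / k !) {{k !≢0}}))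
  where
  lemma : ∀ a b c d → (a * b) * (c * d) ≡ (a * (b * d)) * c
  lemma = solve 4 (λ a b c d → (a :* b) :* (c :* d) := (a :* (b :* d)) :* c) refl

∣expTerm∣ : ∀ {q B} k → ∣ q ∣ ≤ B → ∣ expTerm k q ∣ ≤ expTerm k B
0≤expTerm : ∀ {B} k → 0ℚ ≤ B → 0ℚ ≤ expTerm k B

0≤expTerm zero    0≤B = 0≤* (0≤1/1+ 0) (0≤1/1+ 0)
0≤expTerm {B} (suc k) 0≤B = subst (0ℚ ≤_) (sym (expTerm-suc k B)) (0≤* (0≤* 0≤B (0≤expTerm k 0≤B)) (0≤1/1+ k))

∣expTerm∣ zero    q≤B = ℚ.≤-refl
∣expTerm∣ {q} {B} (suc k) q≤B = subst₂ _≤_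
  (sym (trans (cong ∣_∣ (expTerm-suc k q)) (abs q (expTerm k q) (1/1+ k) (0≤1/1+ k))))
  (sym (expTerm-suc k B))
  (ℚ.*-monoʳ-≤-nonNeg (1/1+ k) {{ℚ.nonNegative (0≤1/1+ k)}}
    (*-mono {∣ q ∣} {B} {∣ expTerm k q ∣} {expTerm k B} (ℚ.≤-trans (ℚ.0≤∣p∣ q) q≤B) (ℚ.0≤∣p∣ (expTerm k q)) q≤B (∣expTerm∣ k q≤B)))
  where
  abs : ∀ a b c → 0ℚ ≤ c → ∣ a * b * c ∣ ≡ ∣ a ∣ * ∣ b ∣ * c
  abs a b c 0≤c = trans (ℚ.∣p*q∣≡∣p∣*∣q∣ (a * b) c) (cong₂ _*_ (ℚ.∣p*q∣≡∣p∣*∣q∣ a b) (ℚ.0≤p⇒∣p∣≡p 0≤c))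

-- expDiff k B = k B^(k-1) / k!, a Lipschitz constant of the k-th term on [-B, B].
expDiff : ℕ → ℚ → ℚ
expDiff zero    B = 0ℚ
expDiff (suc k) B = expTerm k B

*-expDiff : ∀ k B → B * expDiff k B ≡ ⌜ k ⌝ * expTerm k B
*-expDiff zero    B = trans (ℚ.*-zeroʳ B) (sym (ℚ.*-zeroˡ (expTerm 0 B)))
*-expDiff (suc k) B = sym (trans (cong (⌜ suc k ⌝ *_) (expTerm-suc k B)) (lemma ⌜ suc k ⌝ (B * expTerm k B) (1/1+ k) (⌜⌝*1/ k)))
  where
  lemma : ∀ a b c → a * c ≡ 1ℚ → a * (b * c) ≡ b
  lemma a b c h = trans (solve 3 (λ a b c → a :* (b :* c) := (a :* c) :* b) refl a b c) (trans (cong (_* b) h) (ℚ.*-identityˡ b))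

expTerm-lipschitz : ∀ {p q B} k → ∣ p ∣ ≤ B → ∣ q ∣ ≤ B →
                    ∣ expTerm k p - expTerm k q ∣ ≤ ∣ p - q ∣ * expDiff k B
expTerm-lipschitz {p} {q} zero _ _ = ℚ.≤-reflexive (sym (ℚ.*-zeroʳ ∣ p - q ∣))
expTerm-lipschitz {p} {q} {B} (suc k) p≤B q≤B =
  subst (_≤ ∣ p - q ∣ * expTerm k B)
    (sym (cong₂ (λ u v → ∣ u - v ∣) (expTerm-suc k p) (expTerm-suc k q)))
    (lemma p q B (expTerm k p) (expTerm k q) (1/1+ k) (expDiff k B) ⌜ k ⌝ (expTerm k B)
      (ℚ.≤-trans (ℚ.0≤∣p∣ p) p≤B) (0≤1/1+ k) p≤B
      (expTerm-lipschitz k p≤B q≤B) (∣expTerm∣ k q≤B) (*-expDiff k B)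
      (trans (cong (_* 1/1+ k) (trans (sym (⌜⌝-+ k 1)) (cong ⌜_⌝ (ℕ.+-comm k 1)))) (⌜⌝*1/ k)))
  where
  lemma : ∀ p q B u v r D K t → 0ℚ ≤ B → 0ℚ ≤ r → ∣ p ∣ ≤ B → ∣ u - v ∣ ≤ ∣ p - q ∣ * D →
          ∣ v ∣ ≤ t → B * D ≡ K * t → (K + 1ℚ) * r ≡ 1ℚ →
          ∣ (p * u) * r - (q * v) * r ∣ ≤ ∣ p - q ∣ * t
  lemma p q B u v r D K t 0≤B 0≤r p≤B uv≤ v≤t BD Kr = begin
    ∣ (p * u) * r - (q * v) * r ∣
      ≡⟨ cong ∣_∣ (solve 5 (λ p q u v r → (p :* u) :* r :- (q :* v) :* r := (p :* (u :- v) :+ (p :- q) :* v) :* r) refl p q u v r) ⟩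
    ∣ (p * (u - v) + (p - q) * v) * r ∣
      ≡⟨ trans (ℚ.∣p*q∣≡∣p∣*∣q∣ (p * (u - v) + (p - q) * v) r) (cong (∣ p * (u - v) + (p - q) * v ∣ *_) (ℚ.0≤p⇒∣p∣≡p 0≤r)) ⟩
    ∣ p * (u - v) + (p - q) * v ∣ * r
      ≤⟨ *r (ℚ.∣p+q∣≤∣p∣+∣q∣ (p * (u - v)) ((p - q) * v)) ⟩
    (∣ p * (u - v) ∣ + ∣ (p - q) * v ∣) * r
      ≡⟨ cong (_* r) (cong₂ _+_ (ℚ.∣p*q∣≡∣p∣*∣q∣ p (u - v)) (ℚ.∣p*q∣≡∣p∣*∣q∣ (p - q) v)) ⟩
    (∣ p ∣ * ∣ u - v ∣ + ∣ p - q ∣ * ∣ v ∣) * r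
      ≤⟨ *r (ℚ.+-mono-≤ (*-mono 0≤B (ℚ.0≤∣p∣ (u - v)) p≤B uv≤)
                        (ℚ.*-monoˡ-≤-nonNeg ∣ p - q ∣ {{ℚ.nonNegative (ℚ.0≤∣p∣ (p - q))}} v≤t)) ⟩
    (B * (∣ p - q ∣ * D) + ∣ p - q ∣ * t) * r
      ≡⟨ solve 5 (λ B e D t r → (B :* (e :* D) :+ e :* t) :* r := (B :* D :+ t) :* (e :* r)) refl B ∣ p - q ∣ D t r ⟩
    (B * D + t) * (∣ p - q ∣ * r)
      ≡⟨ cong (λ z → (z + t) * (∣ p - q ∣ * r)) BD ⟩
    (K * t + t) * (∣ p - q ∣ * r)
      ≡⟨ solve 4 (λ K t e r → (K :* t :+ t) :* (e :* r) := ((K :+ con 1ℚ) :* r) :* (e :* t)) refl K t ∣ p - q ∣ r ⟩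
    ((K + 1ℚ) * r) * (∣ p - q ∣ * t)
      ≡⟨ trans (cong (_* (∣ p - q ∣ * t)) Kr) (ℚ.*-identityˡ _) ⟩
    ∣ p - q ∣ * t ∎
    where
    open ℚ.≤-Reasoning
    *r : ∀ {a b} → a ≤ b → a * r ≤ b * r
    *r = ℚ.*-monoʳ-≤-nonNeg r {{ℚ.nonNegative 0≤r}}

∑-expDiff : ∀ n B → ∑ℚ (suc n) (λ k → expDiff k B) ≡ expSum n B
∑-expDiff zero    B = refl
∑-expDiff (suc n) B = cong (_+ expTerm n B) (∑-expDiff n B)

expSum-lipschitz : ∀ {p q B} n → ∣ p ∣ ≤ B → ∣ q ∣ ≤ B →
                   ∣ expSum n p - expSum n q ∣ ≤ ∣ p - q ∣ * expSum n B
expSum-lipschitz {p} {q} {B} n p≤B q≤B = ℚ.≤-trans (go n)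
  (ℚ.*-monoˡ-≤-nonNeg ∣ p - q ∣ {{ℚ.nonNegative (ℚ.0≤∣p∣ (p - q))}} (∑-expDiff≤ n))
  where
  lemma : ∀ a b c d e x y → ∣ a - b ∣ ≤ e * x → ∣ c - d ∣ ≤ e * y → ∣ (a + c) - (b + d) ∣ ≤ e * (x + y)
  lemma a b c d e x y h k = begin
    ∣ (a + c) - (b + d) ∣    ≡⟨ cong ∣_∣ (solve 4 (λ a b c d → (a :+ c) :- (b :+ d) := (a :- b) :+ (c :- d)) refl a b c d) ⟩
    ∣ (a - b) + (c - d) ∣    ≤⟨ ℚ.∣p+q∣≤∣p∣+∣q∣ (a - b) (c - d) ⟩
    ∣ a - b ∣ + ∣ c - d ∣    ≤⟨ ℚ.+-mono-≤ h k ⟩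
    e * x + e * y            ≡⟨ sym (ℚ.*-distribˡ-+ e x y) ⟩
    e * (x + y)              ∎
    where open ℚ.≤-Reasoning

  go : ∀ n → ∣ expSum n p - expSum n q ∣ ≤ ∣ p - q ∣ * ∑ℚ n (λ k → expDiff k B)
  go zero    = ℚ.≤-reflexive (sym (ℚ.*-zeroʳ ∣ p - q ∣))
  go (suc n) = lemma (expSum n p) (expSum n q) (expTerm n p) (expTerm n q) ∣ p - q ∣
    (∑ℚ n (λ k → expDiff k B)) (expDiff n B) (go n) (expTerm-lipschitz n p≤B q≤B)

  grow : ∀ a b → 0ℚ ≤ b → a ≤ a + b
  grow a b 0≤b = subst (_≤ a + b) (ℚ.+-identityʳ a) (ℚ.+-monoʳ-≤ a 0≤b)

  ∑-expDiff≤ : ∀ n → ∑ℚ n (λ k → expDiff k B) ≤ expSum n B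
  ∑-expDiff≤ zero    = ℚ.≤-refl
  ∑-expDiff≤ (suc n) = subst (_≤ expSum (suc n) B) (sym (∑-expDiff n B))
    (grow (expSum n B) (expTerm n B) (0≤expTerm n (ℚ.≤-trans (ℚ.0≤∣p∣ p) p≤B)))

expSum-tail : ∀ {q B} n j → ∣ q ∣ ≤ B →
              ∣ expSum (j ℕ.+ n) q - expSum n q ∣ ≤ expSum (j ℕ.+ n) B - expSum n B
expSum-tail {q} {B} n zero    q≤B = ℚ.≤-reflexive
  (trans (cong ∣_∣ (ℚ.+-inverseʳ (expSum n q))) (sym (ℚ.+-inverseʳ (expSum n B))))
expSum-tail {q} {B} n (suc j) q≤B =
  lemma (expSum (j ℕ.+ n) q) (expSum n q) (expTerm (j ℕ.+ n) q) (expSum (j ℕ.+ n) B) (expSum n B) (expTerm (j ℕ.+ n) B)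
    (expSum-tail n j q≤B) (∣expTerm∣ (j ℕ.+ n) q≤B)
  where
  lemma : ∀ a b c x y z → ∣ a - b ∣ ≤ x - y → ∣ c ∣ ≤ z → ∣ (a + c) - b ∣ ≤ (x + z) - y
  lemma a b c x y z h k = begin
    ∣ (a + c) - b ∣      ≡⟨ cong ∣_∣ (solve 3 (λ a b c → (a :+ c) :- b := (a :- b) :+ c) refl a b c) ⟩
    ∣ (a - b) + c ∣      ≤⟨ ℚ.∣p+q∣≤∣p∣+∣q∣ (a - b) c ⟩
    ∣ a - b ∣ + ∣ c ∣    ≤⟨ ℚ.+-mono-≤ h k ⟩
    (x - y) + z          ≡⟨ solve 3 (λ x y z → (x :- y) :+ z := (x :+ z) :- y) refl x y z ⟩
    (x + z) - y          ∎
    where open ℚ.≤-Reasoning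

-- From index 2B on, each term is at most half of the previous one.
module _ (b : ℕ) where
  private
    B = ⌜ suc b ⌝
    K = suc b ℕ.+ suc b
    t = λ k → expTerm k B

    0≤t : ∀ k → 0ℚ ≤ t k
    0≤t k = 0≤expTerm k (0≤⌜⌝ (suc b))

    halve : ∀ k → K ℕ.≤ k → t (suc k) + t (suc k) ≤ t k
    halve k K≤k = subst (λ z → z + z ≤ t k) (sym (expTerm-suc k B))
      (lemma B (t k) (1/1+ k) ⌜ suc k ⌝ (0≤t k) (0≤1/1+ k) (⌜⌝*1/ k)
        (subst (_≤ ⌜ suc k ⌝) (⌜⌝-+ (suc b) (suc b)) (⌜⌝-mono (ℕ.m≤n⇒m≤1+n K≤k))))
      where
      lemma : ∀ B t r s → 0ℚ ≤ t → 0ℚ ≤ r → s * r ≡ 1ℚ → B + B ≤ s → B * t * r + B * t * r ≤ t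
      lemma B t r s 0≤t 0≤r sr BB≤s = begin
        B * t * r + B * t * r    ≡⟨ solve 3 (λ B t r → B :* t :* r :+ B :* t :* r := (B :+ B) :* (t :* r)) refl B t r ⟩
        (B + B) * (t * r)        ≤⟨ ℚ.*-monoʳ-≤-nonNeg (t * r) {{ℚ.nonNegative (0≤* 0≤t 0≤r)}} BB≤s ⟩
        s * (t * r)              ≡⟨ solve 3 (λ s t r → s :* (t :* r) := (s :* r) :* t) refl s t r ⟩
        (s * r) * t              ≡⟨ trans (cong (_* t) sr) (ℚ.*-identityˡ t) ⟩
        t                        ∎
        where open ℚ.≤-Reasoning

    ≤double : ∀ p → 0ℚ ≤ p → p ≤ p + p
    ≤double p 0≤p = subst (_≤ p + p) (ℚ.+-identityʳ p) (ℚ.+-monoʳ-≤ p 0≤p)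

    decreasing : ∀ j → t (j ℕ.+ K) ≤ t K
    decreasing zero    = ℚ.≤-refl
    decreasing (suc j) = ℚ.≤-trans (≤double _ (0≤t (suc j ℕ.+ K)))
      (ℚ.≤-trans (halve (j ℕ.+ K) (ℕ.m≤n+m K j)) (decreasing j))

    tail : ∀ n j → K ℕ.≤ n → expSum (j ℕ.+ n) B + (t (j ℕ.+ n) + t (j ℕ.+ n)) ≤ expSum n B + (t n + t n)
    tail n zero    K≤n = ℚ.≤-refl
    tail n (suc j) K≤n = ℚ.≤-trans
      (lemma (expSum (j ℕ.+ n) B) (t (j ℕ.+ n)) (t (suc j ℕ.+ n) + t (suc j ℕ.+ n)) (halve (j ℕ.+ n) (ℕ.≤-trans K≤n (ℕ.m≤n+m n j))))
      (tail n j K≤n)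
      where
      lemma : ∀ E t u → u ≤ t → (E + t) + u ≤ E + (t + t)
      lemma E t u u≤t = subst ((E + t) + u ≤_) (ℚ.+-assoc E t t) (ℚ.+-monoʳ-≤ (E + t) u≤t)

    C = ℤ.∣ ℚ.↥ (B * t K) ∣

    t-bound : ∀ j → t (suc (j ℕ.+ K)) ≤ ⌜ C ⌝ * 1/1+ (j ℕ.+ K)
    t-bound j = subst (_≤ ⌜ C ⌝ * 1/1+ (j ℕ.+ K)) (sym (expTerm-suc (j ℕ.+ K) B))
      (ℚ.*-monoʳ-≤-nonNeg (1/1+ (j ℕ.+ K)) {{ℚ.nonNegative (0≤1/1+ (j ℕ.+ K))}}
        (ℚ.≤-trans (ℚ.*-monoˡ-≤-nonNeg B {{ℚ.nonNegative (0≤⌜⌝ (suc b))}} (decreasing j)) (≤⌜∣↥∣⌝ (B * t K))))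

  expSum-tail-small : ∀ ε → 0ℚ < ε → ∃ λ N → ∀ n j → N ℕ.≤ n → expSum (j ℕ.+ n) B ≤ expSum n B + ε
  expSum-tail-small ε 0<ε = suc (K ℕ.+ M) , λ
    { (suc n) j (ℕ.s≤s K+M≤n) → small j n (ℕ.≤-trans (ℕ.m≤m+n K M) K+M≤n) (ℕ.≤-trans (ℕ.m≤n+m M K) K+M≤n) }
    where
    sh = shrink C (ε * ½) (0<* 0<ε 0<½)
    δ = proj₁ sh
    M = proj₁ (1/1+-small (proj₁ (proj₂ sh)))

    t-small : ∀ n → K ℕ.≤ n → M ℕ.≤ n → t (suc n) ≤ ε * ½
    t-small n K≤n M≤n = ℚ.≤-trans
      (subst (λ k → t (suc k) ≤ ⌜ C ⌝ * 1/1+ k) (ℕ.m∸n+n≡m K≤n) (t-bound (n ℕ.∸ K)))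
      (subst (⌜ C ⌝ * 1/1+ n ≤_) (proj₂ (proj₂ sh))
        (*-mono {⌜ C ⌝} {⌜ suc C ⌝} {1/1+ n} {δ} (0≤⌜⌝ (suc C)) (0≤1/1+ n) (⌜⌝-mono (ℕ.n≤1+n C))
          (proj₂ (1/1+-small (proj₁ (proj₂ sh))) n M≤n)))

    combine : ∀ E F u v → 0ℚ ≤ v → E + (v + v) ≤ F + (u + u) → u ≤ ε * ½ → E ≤ F + ε
    combine E F u v 0≤v h u≤ = begin
      E                        ≡⟨ sym (ℚ.+-identityʳ E) ⟩
      E + 0ℚ                   ≤⟨ ℚ.+-monoʳ-≤ E (0≤+ 0≤v 0≤v) ⟩
      E + (v + v)              ≤⟨ h ⟩
      F + (u + u)              ≤⟨ ℚ.+-monoʳ-≤ F (ℚ.+-mono-≤ u≤ u≤) ⟩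
      F + (ε * ½ + ε * ½)      ≡⟨ cong (λ z → F + z) (½+½ ε) ⟩
      F + ε                    ∎
      where open ℚ.≤-Reasoning

    small : ∀ j n → K ℕ.≤ n → M ℕ.≤ n → expSum (j ℕ.+ suc n) B ≤ expSum (suc n) B + ε
    small j n K≤n M≤n = combine (expSum (j ℕ.+ suc n) B) (expSum (suc n) B) (t (suc n)) (t (j ℕ.+ suc n))
      (0≤t (j ℕ.+ suc n)) (tail (suc n) j (ℕ.m≤n⇒m≤1+n K≤n)) (t-small n K≤n M≤n)

  expSum-bounded : ∃ λ c → ∃ λ N → ∀ n → N ℕ.≤ n → expSum n B ≤ ⌜ suc c ⌝
  expSum-bounded = c , N , λ n N≤n → ℚ.≤-trans
    (subst (λ k → expSum k B ≤ expSum N B + 1ℚ) (ℕ.m∸n+n≡m N≤n) (proj₂ small₁ N (n ℕ.∸ N) ℕ.≤-refl))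
    (subst (expSum N B + 1ℚ ≤_) (trans (sym (⌜⌝-+ c 1)) (cong ⌜_⌝ (ℕ.+-comm c 1)))
      (ℚ.+-monoˡ-≤ 1ℚ (≤⌜∣↥∣⌝ (expSum N B))))
    where
    small₁ = expSum-tail-small 1ℚ (0<1/1+ 0)
    N = proj₁ small₁
    c = ℤ.∣ ℚ.↥ (expSum N B) ∣

exp : ℝ → ℝ
exp x = mkℝ E (cauchy-ordered {E} exp-cauchy)
  where
  E : ℕ → ℚ
  E n = expSum n (seq x n)

  exp-cauchy : ∀ ε → 0ℚ < ε → ∃ λ N → ∀ m n → N ℕ.≤ n → n ℕ.≤ m → ∣ E m - E n ∣ ≤ ε
  exp-cauchy ε 0<ε = N , λ m n N≤n n≤m → close m n n≤m
      (proj₂ (proj₂ bx) m (ℕ.≤-trans (A≤ N≤n) n≤m)) (proj₂ (proj₂ bx) n (A≤ N≤n))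
      (tail m n n≤m (T≤ N≤n))
      (proj₂ (proj₂ bE) n (G≤ N≤n))
      (proj₂ cx m n (ℕ.≤-trans (D≤ N≤n) n≤m) (D≤ N≤n))
    where
    bx = cauchy⇒bounded (cauchy x)
    b = proj₁ bx
    B = ⌜ suc b ⌝
    ts = expSum-tail-small b (ε * ½) (0<* 0<ε 0<½)
    bE = expSum-bounded b
    c = proj₁ bE
    sh = shrink c (ε * ½) (0<* 0<ε 0<½)
    δ = proj₁ sh
    cx = cauchy x δ (proj₁ (proj₂ sh))
    A = proj₁ (proj₂ bx)
    T = proj₁ ts
    G = proj₁ (proj₂ bE)
    D = proj₁ cx
    N = (A ℕ.+ T) ℕ.+ (G ℕ.+ D)
    A≤ : ∀ {k} → N ℕ.≤ k → A ℕ.≤ k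
    A≤ h = ℕ.m+n≤o⇒m≤o A (ℕ.m+n≤o⇒m≤o (A ℕ.+ T) h)
    T≤ : ∀ {k} → N ℕ.≤ k → T ℕ.≤ k
    T≤ h = ℕ.m+n≤o⇒n≤o A (ℕ.m+n≤o⇒m≤o (A ℕ.+ T) h)
    G≤ : ∀ {k} → N ℕ.≤ k → G ℕ.≤ k
    G≤ h = ℕ.m+n≤o⇒m≤o G (ℕ.m+n≤o⇒n≤o (A ℕ.+ T) h)
    D≤ : ∀ {k} → N ℕ.≤ k → D ℕ.≤ k
    D≤ h = ℕ.m+n≤o⇒n≤o G (ℕ.m+n≤o⇒n≤o (A ℕ.+ T) h)

    tail : ∀ m n → n ℕ.≤ m → T ℕ.≤ n → expSum m B ≤ expSum n B + ε * ½
    tail m n n≤m T≤n = subst (λ k → expSum k B ≤ expSum n B + ε * ½) (ℕ.m∸n+n≡m n≤m) (proj₂ ts n (m ℕ.∸ n) T≤n)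

    lemma : ∀ u v w F H e S → ∣ u - v ∣ ≤ F - H → F ≤ H + ε * ½ → ∣ v - w ∣ ≤ e * H → e ≤ δ → H ≤ S →
            0ℚ ≤ e → 0ℚ ≤ S → S * δ ≡ ε * ½ → ∣ u - w ∣ ≤ ε
    lemma u v w F H e S h₁ h₂ h₃ h₄ h₅ 0≤e 0≤S h₆ = begin
      ∣ u - w ∣                  ≡⟨ cong ∣_∣ (solve 3 (λ u v w → u :- w := (u :- v) :+ (v :- w)) refl u v w) ⟩
      ∣ (u - v) + (v - w) ∣      ≤⟨ ℚ.∣p+q∣≤∣p∣+∣q∣ (u - v) (v - w) ⟩
      ∣ u - v ∣ + ∣ v - w ∣      ≤⟨ ℚ.+-mono-≤ (ℚ.≤-trans h₁ (≤+⇒-≤ {F} {H} h₂)) h₃ ⟩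
      ε * ½ + e * H              ≤⟨ ℚ.+-monoʳ-≤ (ε * ½) (ℚ.*-monoˡ-≤-nonNeg e {{ℚ.nonNegative 0≤e}} h₅) ⟩
      ε * ½ + e * S              ≤⟨ ℚ.+-monoʳ-≤ (ε * ½) (ℚ.*-monoʳ-≤-nonNeg S {{ℚ.nonNegative 0≤S}} h₄) ⟩
      ε * ½ + δ * S              ≡⟨ cong (λ z → ε * ½ + z) (trans (ℚ.*-comm δ S) h₆) ⟩
      ε * ½ + ε * ½              ≡⟨ ½+½ ε ⟩
      ε                          ∎
      where open ℚ.≤-Reasoning

    close : ∀ m n → n ℕ.≤ m → ∣ seq x m ∣ ≤ B → ∣ seq x n ∣ ≤ B → expSum m B ≤ expSum n B + ε * ½ →
            expSum n B ≤ ⌜ suc c ⌝ → ∣ seq x m - seq x n ∣ ≤ δ → ∣ E m - E n ∣ ≤ ε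
    close m n n≤m xm≤B xn≤B h₁ h₂ h₃ = lemma (expSum m xm) (expSum n xm) (expSum n xn) (expSum m B) (expSum n B) ∣ xm - xn ∣ ⌜ suc c ⌝
      (subst (λ k → ∣ expSum k xm - expSum n xm ∣ ≤ expSum k B - expSum n B) (ℕ.m∸n+n≡m n≤m) (expSum-tail n (m ℕ.∸ n) xm≤B))
      h₁ (expSum-lipschitz n xm≤B xn≤B) h₃ h₂ (ℚ.0≤∣p∣ (xm - xn)) (0≤⌜⌝ (suc c)) (proj₂ (proj₂ sh))
      where
      xm = seq x m
      xn = seq x n

------------------------------------------------------------------------

PowerSeries : Set
PowerSeries = ℕ → ℤ

infix 5 [x^_]_
infixl 7 _·_
infixr 8 _^ₛ_

[x^_]_ : ℕ → PowerSeries → ℤ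
[x^ m ] f = f m

1ₛ : PowerSeries
1ₛ zero    = 1ℤ
1ₛ (suc _) = 0ℤ

x^ : ℕ → PowerSeries
x^ a m = if m ℕ.≡ᵇ a then 1ℤ else 0ℤ

_-ₛ_ : PowerSeries → PowerSeries → PowerSeries
(f -ₛ g) m = f m ℤ.- g m

_·_ : PowerSeries → PowerSeries → PowerSeries
(f · g) m = ∑ℤ (suc m) (λ k → f k ℤ.* g (m ℕ.∸ k))

_^ₛ_ : PowerSeries → ℕ → PowerSeries
f ^ₛ zero  = 1ₛ
f ^ₛ suc n = f ^ₛ n · f

-- The inverse of a series f with constant term 1: its coefficients g satisfy
-- g n = [n = 0] - (f 1 * g (n - 1) + … + f n * g 0), and
-- inverseCoeffs f n is the vector g (n - 1) ∷ … ∷ g 0 ∷ [].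
dot : (ℕ → ℤ) → ∀ {n} → Vec ℤ n → ℤ
dot f []       = 0ℤ
dot f (c ∷ cs) = f 0 ℤ.* c ℤ.+ dot (f ∘ suc) cs

inverseCoeffs : PowerSeries → ∀ n → Vec ℤ n
inverseCoeffs f zero    = []
inverseCoeffs f (suc n) = (1ₛ n ℤ.- dot (f ∘ suc) (inverseCoeffs f n)) ∷ inverseCoeffs f n

inverse : PowerSeries → PowerSeries
inverse f n = head (inverseCoeffs f (suc n))

∑ℤ-suc : ∀ n f → ∑ℤ (suc n) f ≡ f 0 ℤ.+ ∑ℤ n (f ∘ suc)
∑ℤ-suc zero    f = trans (ℤ.+-identityˡ (f 0)) (sym (ℤ.+-identityʳ (f 0)))
∑ℤ-suc (suc n) f = trans (cong (ℤ._+ f (suc n)) (∑ℤ-suc n f)) (ℤ.+-assoc (f 0) (∑ℤ n (f ∘ suc)) (f (suc n)))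

·-inverse : ∀ f → f 0 ≡ 1ℤ → ∀ m → (f · inverse f) m ≡ 1ₛ m
·-inverse f f0≡1 m = begin
  ∑ℤ (suc m) (λ k → f k ℤ.* inverse f (m ℕ.∸ k))
    ≡⟨ ∑ℤ-suc m (λ k → f k ℤ.* inverse f (m ℕ.∸ k)) ⟩
  f 0 ℤ.* inverse f m ℤ.+ ∑ℤ m (λ k → f (suc k) ℤ.* inverse f (m ℕ.∸ suc k))
    ≡⟨ cong₂ ℤ._+_ (trans (cong (ℤ._* inverse f m) f0≡1) (ℤ.*-identityˡ (inverse f m))) (∑≡dot m (f ∘ suc)) ⟩
  1ₛ m ℤ.- r ℤ.+ r
    ≡⟨ ℤ.+-assoc (1ₛ m) (ℤ.- r) r ⟩
  1ₛ m ℤ.+ (ℤ.- r ℤ.+ r)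
    ≡⟨ cong (λ z → 1ₛ m ℤ.+ z) (ℤ.+-inverseˡ r) ⟩
  1ₛ m ℤ.+ 0ℤ
    ≡⟨ ℤ.+-identityʳ (1ₛ m) ⟩
  1ₛ m ∎
  where
  open ≡-Reasoning
  r = dot (f ∘ suc) (inverseCoeffs f m)
  ∑≡dot : ∀ n g → ∑ℤ n (λ k → g k ℤ.* inverse f (n ℕ.∸ suc k)) ≡ dot g (inverseCoeffs f n)
  ∑≡dot zero    g = refl
  ∑≡dot (suc n) g = trans (∑ℤ-suc n _) (cong (λ z → g 0 ℤ.* inverse f n ℤ.+ z) (∑≡dot n (g ∘ suc)))

partialProduct : (ℕ → PowerSeries) → ℕ → PowerSeries
partialProduct u A = ⨀ _·_ 1ₛ A u

-- Convergence in the x-adic topology: every coefficient of the partial products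
-- is eventually constant.
Multipliable : (ℕ → PowerSeries) → Set
Multipliable u = ∀ m → ∃ λ A → ∀ B → A ℕ.≤ B → [x^ m ] partialProduct u B ≡ [x^ m ] partialProduct u A

∏∞ : (u : ℕ → PowerSeries) → Multipliable u → PowerSeries
∏∞ u conv m = [x^ m ] partialProduct u (proj₁ (conv m))

-- [1-x^ a ]^- d  is  (1 - x^a)^(-d), for a ≥ 1.
[1-x^_]^-_ : ℕ → ℕ → PowerSeries
[1-x^ a ]^- d = inverse (1ₛ -ₛ x^ a) ^ₛ d

-- f ≡ 1 modulo x^a
_≡1-mod-x^_ : PowerSeries → ℕ → Set
f ≡1-mod-x^ a = ∀ m → m ℕ.< a → f m ≡ 1ₛ m

·-≡1-mod : ∀ f {g a} → g ≡1-mod-x^ a → ∀ m → m ℕ.< a → (f · g) m ≡ f m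
·-≡1-mod f {g} {a} g≡1 m m<a = trans
  (cong₂ ℤ._+_ (∑-zero m (λ k → f k ℤ.* g (m ℕ.∸ k)) earlier)
    (trans (cong (λ k → f m ℤ.* g k) (ℕ.n∸n≡0 m))
    (trans (cong (f m ℤ.*_) (g≡1 0 (ℕ.≤-<-trans ℕ.z≤n m<a))) (ℤ.*-identityʳ (f m)))))
  (ℤ.+-identityˡ (f m))
  where
  ∑-zero : ∀ n h → (∀ k → k ℕ.< n → h k ≡ 0ℤ) → ∑ℤ n h ≡ 0ℤ
  ∑-zero zero    h h≡0 = refl
  ∑-zero (suc n) h h≡0 = cong₂ ℤ._+_ (∑-zero n h (λ k k<n → h≡0 k (ℕ.m≤n⇒m≤1+n k<n))) (h≡0 n ℕ.≤-refl)
  1ₛ-pos : ∀ {j} → 0 ℕ.< j → 1ₛ j ≡ 0ℤ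
  1ₛ-pos (ℕ.s≤s _) = refl
  earlier : ∀ k → k ℕ.< m → f k ℤ.* g (m ℕ.∸ k) ≡ 0ℤ
  earlier k k<m = trans (cong (f k ℤ.*_) (trans (g≡1 (m ℕ.∸ k) (ℕ.≤-<-trans (ℕ.m∸n≤m m k) m<a)) (1ₛ-pos (ℕ.m<n⇒0<n∸m k<m))))
                        (ℤ.*-zeroʳ (f k))

inverse-≡1-mod : ∀ {f a} → f ≡1-mod-x^ a → inverse f ≡1-mod-x^ a
inverse-≡1-mod {f} {a} f≡1 m m<a = trans
  (cong (λ z → 1ₛ m ℤ.- z) (dot-zero (f ∘ suc) (inverseCoeffs f m) (λ k k<m → f≡1 (suc k) (ℕ.≤-<-trans k<m m<a))))
  (ℤ.+-identityʳ (1ₛ m))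
  where
  dot-zero : ∀ g {n} (cs : Vec ℤ n) → (∀ k → k ℕ.< n → g k ≡ 0ℤ) → dot g cs ≡ 0ℤ
  dot-zero g []       g≡0 = refl
  dot-zero g (c ∷ cs) g≡0 = cong₂ ℤ._+_ (trans (cong (ℤ._* c) (g≡0 0 (ℕ.s≤s ℕ.z≤n))) (ℤ.*-zeroˡ c))
                                        (dot-zero (g ∘ suc) cs (λ k k<n → g≡0 (suc k) (ℕ.s≤s k<n)))

^ₛ-≡1-mod : ∀ {f a} d → f ≡1-mod-x^ a → (f ^ₛ d) ≡1-mod-x^ a
^ₛ-≡1-mod zero    f≡1 m m<a = refl
^ₛ-≡1-mod {f} (suc d) f≡1 m m<a = trans (·-≡1-mod (f ^ₛ d) f≡1 m m<a) (^ₛ-≡1-mod d f≡1 m m<a)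

1-x^-≡1-mod : ∀ a → (1ₛ -ₛ x^ a) ≡1-mod-x^ a
1-x^-≡1-mod a m m<a with m ℕ.≡ᵇ a | ℕ.≡ᵇ⇒≡ m a
... | false | _  = ℤ.+-identityʳ (1ₛ m)
... | true  | eq = ⊥-elim (ℕ.<-irrefl (eq _) m<a)

eulerFactors : ℕ → ℕ → PowerSeries
eulerFactors d i = [1-x^ suc i ]^- d

eulerFactors-multipliable : ∀ d → Multipliable (eulerFactors d)
eulerFactors-multipliable d m = m , λ B m≤B →
  subst (λ k → P k m ≡ P m m) (ℕ.m∸n+n≡m m≤B) (stable (B ℕ.∸ m))
  where
  P = partialProduct (eulerFactors d)
  stable : ∀ j → P (j ℕ.+ m) m ≡ P m m
  stable zero    = refl
  stable (suc j) = trans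
    (·-≡1-mod (P (j ℕ.+ m)) (^ₛ-≡1-mod d (inverse-≡1-mod (1-x^-≡1-mod (suc (j ℕ.+ m))))) m (ℕ.s≤s (ℕ.m≤n+m m j)))
    (stable j)

-- ∏_{a ≥ 1} (1 - x^a)^(-d)
eulerProduct : ℕ → PowerSeries
eulerProduct d = ∏∞ (eulerFactors d) (eulerFactors-multipliable d)

------------------------------------------------------------------------

record Histogram (d : ℕ) : Set where
  field
    entry   : (a : ℕ) .{{_ : NonZero a}} → Fin d → ℕ
    bound   : ℕ
    support : ∀ a .{{_ : NonZero a}} r → bound ℕ.< a → entry a r ≡ 0

open Histogram public

-- The terms with a > bound H vanish, so this is the sum over all a ≥ 1.
N : ∀ {d} → Histogram d → ℕ
N {d} H = ∑ℕ (bound H) (λ i → ℕSum.sum {d} (λ r → suc i ℕ.* entry H (suc i) r))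

-- Histograms are equal when their entries are; the chosen bound is irrelevant.
ℋ : ℕ → ℕ → Setoid 0ℓ 0ℓ
ℋ d n = record
  { Carrier       = ∃ λ (H : Histogram d) → N H ℕ.≤ n
  ; _≈_           = λ (H , _) (H′ , _) → ∀ a .{{_ : NonZero a}} r → entry H a r ≡ entry H′ a r
  ; isEquivalence = record
    { refl  = λ _ _ → refl
    ; sym   = λ H≈H′ a r → sym (H≈H′ a r)
    ; trans = λ H≈H′ H′≈H″ a r → trans (H≈H′ a r) (H′≈H″ a r)
    }
  }

HasCardinality : Setoid 0ℓ 0ℓ → ℕ → Set
HasCardinality S k = Inverse S (setoid (Fin k))

module Submission where

{-
With x = 1 / (1 + s), s > 0, dropping the weights x^m ≤ 1 gives

  |ℋ_d(n)| ≤ x^(-n) ∏_a (1 - x^a)^(-d) = (1 + s)^n exp (d ∑_j (1/j) ∑_a x^(ja)),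

and by Bernoulli ∑_a x^(ja) ≤ 1 / ((1 + s)^j - 1) ≤ 1 / (j s), so the right-hand
side is at most exp (n s + d ζ(2) / s); s = π √ (d / 6n) minimises the exponent.
The exponential formula for the product is read off from its logarithmic
derivative, modulo x^(n + 1).  Since π is given by Leibniz' series,
ζ(2) ≤ π² / 6 is obtained by squaring the partial sums of that series.  All
estimates are made between rationals, with s taken from the approximations of
the exponent, and errors are removed in the limit.
-}

open import Defs

-- The bridge between counting and analysis is the relation `f = g + x^w f`, that is
-- `f = g / (1 - x^w)`, imposed factor by factor. Summed up to `x^n` it is the recursion for the
-- number of multiplicity vectors of weight at most `n` (the part `w` is absent, or one copy of it
-- is removed); under `x d/dx` it adds `- log (1 - x^w)` to the exponent. Everything is cut at `n`:
-- coefficients up to `x^n` see only the parts `a ≤ n` and the terms `j ≤ n`, and as all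
-- coefficients are non-negative, discarding higher powers only lowers a value at `x ≥ 0`. The
-- factor `(1 + s)^n` is absorbed into the exponential through `(1 + s) e^q ≤ e^(q + s)`, which
-- holds between partial sums at the price of one more term, so that the estimate stays rational.
-- The obstacle in squaring Leibniz' series is its conditional convergence: the double sum cannot be
-- rearranged freely. Instead there is an exact identity for each partial sum,
-- `∑ 1/(2k+1)² = 2 L² + R`, proved by induction, with a remainder `R ≤ 2 H_N / (N + 1)`, where
-- `H_N` is the harmonic sum.

module Counting where

  open import Data.Empty using (⊥-elim)
  open import Data.Fin.Base using (Fin; zero; suc)
  open import Data.Fin.Properties using (+↔⊎; 1↔⊤)
  open import Data.Integer.Base as ℤ using (ℤ; +_; 0ℤ)
  import Data.Integer.Properties as ℤ
  open import Data.List.Base using (List; []; _∷_; _++_; replicate)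
  open import Data.Nat.Base as ℕ using (ℕ; zero; suc; _+_; _*_; _≤_; _<_; z≤n; s≤s; NonZero)
  open import Data.Nat.Induction using (<-wellFounded)
  import Data.Nat.Properties as ℕ
  open import Data.Product.Base using (∃; _×_; _,_; proj₁; proj₂)
  open import Data.Sum.Base using (_⊎_; inj₁; inj₂)
  open import Data.Sum.Function.Propositional using (_⊎-↔_)
  open import Data.Unit.Base using (⊤; tt)
  open import Function.Base using (_∘_)
  open import Function.Bundles using (_↔_; mk↔ₛ′; Inverse)
  open import Function.Construct.Composition using (_↔-∘_) renaming (inverse to _⨾_)
  open import Function.Construct.Symmetry using (↔-sym)
  open import Induction.WellFounded using (Acc; acc)
  open import Relation.Binary.PropositionalEquality
  open import Relation.Nullary.Decidable using (yes; no)
  open import Algebra.Properties.CommutativeSemigroup ℤ.+-commutativeSemigroup using (interchange)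
  import Algebra.Properties.CommutativeMonoid.Sum ℕ.+-0-commutativeMonoid as ℕSum

  -- Integer power series: shifts, products and division by `1 - x^w`.

  -- delay o w f is the coefficient sequence of x^w f, where o is the zero.
  delay : ∀ {A : Set} → A → ℕ → (ℕ → A) → ℕ → A
  delay o zero    f m       = f m
  delay o (suc w) f zero    = o
  delay o (suc w) f (suc m) = delay o w f m

  delay-cong : ∀ {A : Set} {o : A} w {f g : ℕ → A} → (∀ m → f m ≡ g m) → ∀ m → delay o w f m ≡ delay o w g m
  delay-cong zero    f≗g m       = f≗g m
  delay-cong (suc w) f≗g zero    = refl
  delay-cong (suc w) f≗g (suc m) = delay-cong w f≗g m

  ∑ℤ-cong : ∀ n {f g} → (∀ k → k ℕ.< n → f k ≡ g k) → ∑ℤ n f ≡ ∑ℤ n g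
  ∑ℤ-cong zero    f≗g = refl
  ∑ℤ-cong (suc n) f≗g = cong₂ ℤ._+_ (∑ℤ-cong n λ k k<n → f≗g k (ℕ.m<n⇒m<1+n k<n)) (f≗g n ℕ.≤-refl)

  ∑ℤ-+ : ∀ n f g → ∑ℤ n (λ k → f k ℤ.+ g k) ≡ ∑ℤ n f ℤ.+ ∑ℤ n g
  ∑ℤ-+ zero    f g = refl
  ∑ℤ-+ (suc n) f g = trans (cong (ℤ._+ (f n ℤ.+ g n)) (∑ℤ-+ n f g)) (interchange (∑ℤ n f) (∑ℤ n g) (f n) (g n))

  ·-congʳ : ∀ f {g h} → (∀ m → g m ≡ h m) → ∀ m → (f · g) m ≡ (f · h) m
  ·-congʳ f g≗h m = ∑ℤ-cong (suc m) λ k _ → cong (f k ℤ.*_) (g≗h (m ℕ.∸ k))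

  ·-distribˡ : ∀ f g h m → (f · (λ k → g k ℤ.+ h k)) m ≡ (f · g) m ℤ.+ (f · h) m
  ·-distribˡ f g h m = trans
    (∑ℤ-cong (suc m) λ k _ → ℤ.*-distribˡ-+ (f k) (g (m ℕ.∸ k)) (h (m ℕ.∸ k)))
    (∑ℤ-+ (suc m) (λ k → f k ℤ.* g (m ℕ.∸ k)) (λ k → f k ℤ.* h (m ℕ.∸ k)))

  ·-delay : ∀ f w g m → (f · delay 0ℤ w g) m ≡ delay 0ℤ w (f · g) m
  ·-delay f zero    g m       = refl
  ·-delay f (suc w) g zero    = trans (ℤ.+-identityˡ _) (ℤ.*-zeroʳ (f 0))
  ·-delay f (suc w) g (suc m) = trans
    (cong₂ ℤ._+_
      (∑ℤ-cong (suc m) λ k k<1+m → cong (λ j → f k ℤ.* delay 0ℤ (suc w) g j) (ℕ.+-∸-assoc 1 (ℕ.≤-pred k<1+m)))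
      (trans (cong (λ j → f (suc m) ℤ.* delay 0ℤ (suc w) g j) (ℕ.n∸n≡0 m)) (ℤ.*-zeroʳ (f (suc m)))))
    (trans (ℤ.+-identityʳ _) (·-delay f w g m))

  ·-identityʳ : ∀ f m → (f · 1ₛ) m ≡ f m
  ·-identityʳ f m = ·-≡1-mod f {1ₛ} {suc m} (λ _ _ → refl) m ℕ.≤-refl

  ·-identityˡ : ∀ f m → (1ₛ · f) m ≡ f m
  ·-identityˡ f m = trans (∑ℤ-suc m _) (trans (cong₂ ℤ._+_ (ℤ.*-identityˡ (f m)) (vanish m λ k → f (m ℕ.∸ suc k))) (ℤ.+-identityʳ (f m)))
    where
    vanish : ∀ n g → ∑ℤ n (λ k → 0ℤ ℤ.* g k) ≡ 0ℤ
    vanish zero    g = refl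
    vanish (suc n) g = trans (cong₂ ℤ._+_ (vanish n g) (ℤ.*-zeroˡ (g n))) refl

  x^-· : ∀ a f m → ((x^ a) · f) m ≡ delay 0ℤ a f m
  x^-· zero f m = trans (∑ℤ-cong (suc m) (λ { zero _ → refl ; (suc k) _ → refl })) (·-identityˡ f m)
  x^-· (suc a) f zero    = trans (ℤ.+-identityˡ _) (ℤ.*-zeroˡ (f 0))
  x^-· (suc a) f (suc m) = trans (∑ℤ-suc (suc m) _)
    (trans (cong (ℤ._+ ((x^ a) · f) m) (ℤ.*-zeroˡ (f (suc m))))
    (trans (ℤ.+-identityˡ _) (x^-· a f m)))

  -- Quotient w g f says that f = g / (1 - x^w).
  Quotient : ℕ → PowerSeries → PowerSeries → Set
  Quotient w g f = ∀ m → f m ≡ g m ℤ.+ delay 0ℤ w f m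

  ·-quotient : ∀ f {w g h} → Quotient w g h → Quotient w (f · g) (f · h)
  ·-quotient f {w} {g} {h} q m = trans (·-congʳ f q m)
    (trans (·-distribˡ f g (delay 0ℤ w h) m) (cong (λ z → (f · g) m ℤ.+ z) (·-delay f w h m)))

  geometric : ℕ → PowerSeries
  geometric i = inverse (1ₛ -ₛ x^ (suc i))

  -- Read off from `(1 - x^(i+1)) · geometric i = 1`, whose left side is `geometric i` minus its own
  -- shift.
  geometric-quotient : ∀ i → Quotient (suc i) 1ₛ (geometric i)
  geometric-quotient i m = move (geometric i m) (1ₛ m) (delay 0ℤ (suc i) (geometric i) m) (begin
    geometric i m ℤ.- delay 0ℤ (suc i) (geometric i) m
      ≡⟨ cong₂ ℤ._-_ (sym (·-identityˡ (geometric i) m)) (sym (x^-· (suc i) (geometric i) m)) ⟩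
    (1ₛ · geometric i) m ℤ.- ((x^ (suc i)) · geometric i) m
      ≡⟨ cong (λ z → (1ₛ · geometric i) m ℤ.+ z) (neg (suc m) (λ k → x^ (suc i) k ℤ.* geometric i (m ℕ.∸ k))) ⟩
    (1ₛ · geometric i) m ℤ.+ ∑ℤ (suc m) (λ k → ℤ.- (x^ (suc i) k ℤ.* geometric i (m ℕ.∸ k)))
      ≡⟨ sym (∑ℤ-+ (suc m) _ _) ⟩
    ∑ℤ (suc m) (λ k → 1ₛ k ℤ.* geometric i (m ℕ.∸ k) ℤ.- x^ (suc i) k ℤ.* geometric i (m ℕ.∸ k))
      ≡⟨ ∑ℤ-cong (suc m) (λ k _ → distrib (1ₛ k) (x^ (suc i) k) (geometric i (m ℕ.∸ k))) ⟩
    ((1ₛ -ₛ x^ (suc i)) · geometric i) m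
      ≡⟨ ·-inverse (1ₛ -ₛ x^ (suc i)) refl m ⟩
    1ₛ m ∎)
    where
    open ≡-Reasoning
    move : ∀ a b c → a ℤ.- c ≡ b → a ≡ b ℤ.+ c
    move a b c eq = trans (sym (trans (ℤ.+-assoc a (ℤ.- c) c)
      (trans (cong (λ z → a ℤ.+ z) (ℤ.+-inverseˡ c)) (ℤ.+-identityʳ a)))) (cong (ℤ._+ c) eq)
    neg : ∀ n f → ℤ.- ∑ℤ n f ≡ ∑ℤ n (λ k → ℤ.- f k)
    neg zero    f = refl
    neg (suc n) f = trans (ℤ.neg-distrib-+ (∑ℤ n f) (f n)) (cong (ℤ._- f n) (neg n f))
    distrib : ∀ a b c → a ℤ.* c ℤ.- b ℤ.* c ≡ (a ℤ.- b) ℤ.* c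
    distrib a b c = trans (cong (λ z → a ℤ.* c ℤ.+ z) (ℤ.neg-distribˡ-* b c)) (sym (ℤ.*-distribʳ-+ c a (ℤ.- b)))

  -- InverseProduct ws f says that f = ∏_{i ∈ ws} 1 / (1 - x^(i + 1)).
  data InverseProduct : List ℕ → PowerSeries → Set where
    one    : ∀ {f} → (∀ m → f m ≡ 1ₛ m) → InverseProduct [] f
    divide : ∀ {i ws f g} → InverseProduct ws g → Quotient (suc i) g f → InverseProduct (i ∷ ws) f

  InverseProduct-resp : ∀ {ws f g} → (∀ m → g m ≡ f m) → InverseProduct ws f → InverseProduct ws g
  InverseProduct-resp g≗f (one f≗1)       = one λ m → trans (g≗f m) (f≗1 m)
  InverseProduct-resp g≗f (divide {i} {g = h} p q) = divide p λ m →
    trans (g≗f m) (trans (q m) (cong (λ z → h m ℤ.+ z) (delay-cong (suc i) (λ k → sym (g≗f k)) m)))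

  -- The largest part comes first, in agreement with `partialProduct`, where the last factor is
  -- outermost. Each part is repeated `d` times because its factor is a `d`-th power.
  eulerWeights : ℕ → ℕ → List ℕ
  eulerWeights d zero    = []
  eulerWeights d (suc A) = replicate d A ++ eulerWeights d A

  partialProduct-inverseProduct : ∀ d A → InverseProduct (eulerWeights d A) (partialProduct (eulerFactors d) A)
  partialProduct-inverseProduct d zero    = one λ _ → refl
  partialProduct-inverseProduct d (suc A) = power d
    where
    P = partialProduct (eulerFactors d) A
    power : ∀ e → InverseProduct (replicate e A ++ eulerWeights d A) (P · [1-x^ suc A ]^- e)
    power zero    = InverseProduct-resp (·-identityʳ P) (partialProduct-inverseProduct d A)
    power (suc e) = divide (power e) (·-quotient P {suc A} {[1-x^ suc A ]^- e} λ m →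
      trans (·-quotient ([1-x^ suc A ]^- e) {suc A} {1ₛ} (geometric-quotient A) m)
            (cong (ℤ._+ delay 0ℤ (suc A) ([1-x^ suc A ]^- suc e) m) (·-identityʳ ([1-x^ suc A ]^- e) m)))

  eulerProduct≡partialProduct : ∀ d {m n} → m ℕ.≤ n → eulerProduct d m ≡ partialProduct (eulerFactors d) n m
  eulerProduct≡partialProduct d {m} m≤n = sym (proj₂ (eulerFactors-multipliable d m) _ m≤n)

  ∑ℤ-delay-< : ∀ w {n} f → n ≤ w → ∑ℤ n (delay 0ℤ w f) ≡ 0ℤ
  ∑ℤ-delay-< w       f z≤n       = refl
  ∑ℤ-delay-< (suc w) f (s≤s {n} n≤w) = trans (∑ℤ-suc n (delay 0ℤ (suc w) f)) (trans (ℤ.+-identityˡ _) (∑ℤ-delay-< w f n≤w))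

  ∑ℤ-delay : ∀ w k f → ∑ℤ (k + w) (delay 0ℤ w f) ≡ ∑ℤ k f
  ∑ℤ-delay zero    k f = cong (λ j → ∑ℤ j f) (ℕ.+-identityʳ k)
  ∑ℤ-delay (suc w) k f = trans (cong (λ j → ∑ℤ j (delay 0ℤ (suc w) f)) (ℕ.+-suc k w))
    (trans (∑ℤ-suc (k + w) (delay 0ℤ (suc w) f)) (trans (ℤ.+-identityˡ _) (∑ℤ-delay w k f)))

  ∑ℤ-quotient : ∀ w {f g} n → Quotient w g f → ∑ℤ n f ≡ ∑ℤ n g ℤ.+ ∑ℤ n (delay 0ℤ w f)
  ∑ℤ-quotient w {f} {g} n q = trans (∑ℤ-cong n λ k _ → q k) (∑ℤ-+ n g (delay 0ℤ w f))

  -- Multiplicity vectors of bounded weight and their number.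

  -- The entry i of a list of weights stands for the part i + 1.
  Assignment : List ℕ → Set
  Assignment []       = ⊤
  Assignment (_ ∷ ws) = ℕ × Assignment ws

  weight : ∀ ws → Assignment ws → ℕ
  weight []       _       = 0
  weight (i ∷ ws) (e , v) = suc i * e + weight ws v

  Solution : List ℕ → ℕ → Set
  Solution ws n = ∃ λ (v : Assignment ws) → weight ws v ≤ n

  Solution-≡ : ∀ ws {n} {s t : Solution ws n} → proj₁ s ≡ proj₁ t → s ≡ t
  Solution-≡ ws {s = v , p} {t = .v , q} refl = cong (v ,_) (ℕ.≤-irrelevant p q)

  weight-zero : ∀ i ws v → weight (i ∷ ws) (0 , v) ≡ weight ws v
  weight-zero i ws v = cong (_+ weight ws v) (ℕ.*-zeroʳ i)

  weight-suc : ∀ i ws e v → weight (i ∷ ws) (suc e , v) ≡ weight (i ∷ ws) (e , v) + suc i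
  weight-suc i ws e v = trans (cong (_+ weight ws v) (ℕ.*-suc (suc i) e))
    (trans (ℕ.+-assoc (suc i) (suc i * e) (weight ws v)) (ℕ.+-comm (suc i) (suc i * e + weight ws v)))

  Solution-[] : ∀ n → Solution [] n ↔ Fin 1
  Solution-[] n = ↔-sym 1↔⊤ ↔-∘ mk↔ₛ′ (λ _ → tt) (λ _ → tt , z≤n) (λ _ → refl) (λ _ → Solution-≡ [] refl)

  Solution-< : ∀ {i} ws {n} → n < suc i → Solution (i ∷ ws) n ↔ Solution ws n
  Solution-< {i} ws {n} n<w = mk↔ₛ′ to from (λ _ → Solution-≡ ws refl) from∘to
    where
    to : Solution (i ∷ ws) n → Solution ws n
    to ((e , v) , p) = v , ℕ.m+n≤o⇒n≤o (suc i * e) p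
    from : Solution ws n → Solution (i ∷ ws) n
    from (v , p) = (0 , v) , subst (_≤ n) (sym (weight-zero i ws v)) p
    from∘to : ∀ s → from (to s) ≡ s
    from∘to ((zero  , v) , p) = Solution-≡ (i ∷ ws) refl
    from∘to ((suc e , v) , p) = ⊥-elim (ℕ.<⇒≱ n<w
      (ℕ.m+n≤o⇒n≤o (weight (i ∷ ws) (e , v)) (subst (_≤ n) (weight-suc i ws e v) p)))

  -- Either the part `i + 1` has multiplicity zero and can be forgotten, or one copy of it is
  -- removed. This is the combinatorial form of `f = g + x^(i+1) f`.
  Solution-≥ : ∀ i ws k → Solution (i ∷ ws) (k + suc i) ↔ (Solution ws (k + suc i) ⊎ Solution (i ∷ ws) k)
  Solution-≥ i ws k = mk↔ₛ′ to from to∘from from∘to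
    where
    n = k + suc i
    to : Solution (i ∷ ws) n → Solution ws n ⊎ Solution (i ∷ ws) k
    to ((zero  , v) , p) = inj₁ (v , subst (_≤ n) (weight-zero i ws v) p)
    to ((suc e , v) , p) = inj₂ ((e , v) , ℕ.+-cancelʳ-≤ (suc i) _ _ (subst (_≤ n) (weight-suc i ws e v) p))
    from : Solution ws n ⊎ Solution (i ∷ ws) k → Solution (i ∷ ws) n
    from (inj₁ (v , p))       = (0 , v) , subst (_≤ n) (sym (weight-zero i ws v)) p
    from (inj₂ ((e , v) , p)) = (suc e , v) , subst (_≤ n) (sym (weight-suc i ws e v)) (ℕ.+-monoˡ-≤ (suc i) p)
    to∘from : ∀ s → to (from s) ≡ s
    to∘from (inj₁ _) = cong inj₁ (Solution-≡ ws refl)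
    to∘from (inj₂ _) = cong inj₂ (Solution-≡ (i ∷ ws) refl)
    from∘to : ∀ s → from (to s) ≡ s
    from∘to ((zero  , v) , p) = Solution-≡ (i ∷ ws) refl
    from∘to ((suc e , v) , p) = Solution-≡ (i ∷ ws) refl

  ∑ℤ-1ₛ : ∀ n → ∑ℤ (suc n) 1ₛ ≡ + 1
  ∑ℤ-1ₛ zero    = refl
  ∑ℤ-1ₛ (suc n) = trans (ℤ.+-identityʳ _) (∑ℤ-1ₛ n)

  HasSolutionCount : List ℕ → PowerSeries → ℕ → Set
  HasSolutionCount ws f n = ∃ λ k → Solution ws n ↔ Fin k × + k ≡ ∑ℤ (suc n) f

  -- Partial sums of `f = g + x^w f` obey the same recursion as the solutions: for `n < w` the
  -- shifted term contributes nothing, otherwise it contributes the partial sum up to `n - w`.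
  count-divide : ∀ {i ws f g} n → Quotient (suc i) g f → HasSolutionCount ws g n →
                 (∀ {k} → k < n → HasSolutionCount (i ∷ ws) f k) → HasSolutionCount (i ∷ ws) f n
  count-divide {i} {ws} {f} {g} n q (a , bijA , eqA) counts with ℕ.<-≤-connex n (suc i)
  ... | inj₁ n<w = a , bijA ↔-∘ Solution-< ws n<w ,
    sym (trans (∑ℤ-quotient (suc i) (suc n) q)
        (trans (cong (λ z → ∑ℤ (suc n) g ℤ.+ z) (∑ℤ-delay-< (suc i) f n<w)) (trans (ℤ.+-identityʳ _) (sym eqA))))
  -- Writing `n` as `k + suc i` puts it in the form that `Solution-≥` and `∑ℤ-delay` expect; the
  -- upper limit `suc n` of the sum is then `suc k + suc i`.
  ... | inj₂ w≤n with n ℕ.∸ suc i | ℕ.m∸n+n≡m w≤n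
  ...   | k | refl =
    let b , bijB , eqB = counts (ℕ.m<m+n k (s≤s z≤n)) in
    a + b , (↔-sym +↔⊎ ↔-∘ (bijA ⊎-↔ bijB)) ↔-∘ Solution-≥ i ws k ,
    sym (trans (∑ℤ-quotient (suc i) (suc k + suc i) q)
        (cong₂ ℤ._+_ (sym eqA) (trans (∑ℤ-delay (suc i) (suc k) f) (sym eqB))))

  -- A nested induction: either the list of parts shrinks while `n` stays, or `n` decreases while
  -- the list stays.
  count-solutions : ∀ {ws f} → InverseProduct ws f → ∀ n → Acc _<_ n → HasSolutionCount ws f n
  count-solutions (one f≗1) n _ = 1 , Solution-[] n ,
    sym (trans (∑ℤ-cong (suc n) (λ k _ → f≗1 k)) (∑ℤ-1ₛ n))
  count-solutions (divide p q) n (acc rs) =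
    count-divide n q (count-solutions p n (acc rs)) λ k<n → count-solutions (divide p q) _ (rs k<n)

  -- Histograms as multiplicity vectors.

  module _ {d : ℕ} where

    packRow : ∀ i e {ws} → (Fin e → ℕ) → Assignment ws → Assignment (replicate e i ++ ws)
    packRow i zero    row v = v
    packRow i (suc e) row v = row zero , packRow i e (row ∘ suc) v

    row : ∀ i e {ws} → Assignment (replicate e i ++ ws) → Fin e → ℕ
    row i (suc e) (x , v) zero    = x
    row i (suc e) (x , v) (suc r) = row i e v r

    rest : ∀ i e {ws} → Assignment (replicate e i ++ ws) → Assignment ws
    rest i zero    v       = v
    rest i (suc e) (x , v) = rest i e v

    row-packRow : ∀ i e {ws} f (v : Assignment ws) r → row i e (packRow i e f v) r ≡ f r
    row-packRow i (suc e) f v zero    = refl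
    row-packRow i (suc e) f v (suc r) = row-packRow i e (f ∘ suc) v r

    rest-packRow : ∀ i e {ws} f (v : Assignment ws) → rest i e (packRow i e f v) ≡ v
    rest-packRow i zero    f v = refl
    rest-packRow i (suc e) f v = rest-packRow i e (f ∘ suc) v

    packRow-row-rest : ∀ i e {ws} (v : Assignment (replicate e i ++ ws)) → packRow i e (row i e v) (rest i e v) ≡ v
    packRow-row-rest i zero    v       = refl
    packRow-row-rest i (suc e) (x , v) = cong (x ,_) (packRow-row-rest i e v)

    packRow-cong : ∀ i e {ws} {f g : Fin e → ℕ} {v : Assignment ws} → (∀ r → f r ≡ g r) → packRow i e f v ≡ packRow i e g v
    packRow-cong i zero    f≗g = refl
    packRow-cong i (suc e) f≗g = cong₂ _,_ (f≗g zero) (packRow-cong i e (f≗g ∘ suc))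

    weight-packRow : ∀ i e {ws} f (v : Assignment ws) →
                     weight (replicate e i ++ ws) (packRow i e f v) ≡ ℕSum.sum {e} (λ r → suc i * f r) + weight ws v
    weight-packRow i zero    f v = refl
    weight-packRow i (suc e) f v = trans (cong (λ z → suc i * f zero + z) (weight-packRow i e (f ∘ suc) v)) (sym (ℕ.+-assoc (suc i * f zero) _ _))

    Entries : Set
    Entries = (a : ℕ) .{{_ : NonZero a}} → Fin d → ℕ

    pack : ∀ A → Entries → Assignment (eulerWeights d A)
    pack zero    e = tt
    pack (suc A) e = packRow A d (e (suc A)) (pack A e)

    -- Rows that the vector does not hold default to 0, which makes `A` a valid bound for the
    -- resulting histogram.
    unpack : ∀ A → Assignment (eulerWeights d A) → ℕ → Fin d → ℕ
    unpack zero    v a r = 0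
    unpack (suc A) v a r with a ℕ.≟ suc A
    ... | yes _ = row A d v r
    ... | no  _ = unpack A (rest A d v) a r

    weightedSum : ℕ → Entries → ℕ
    weightedSum A e = ∑ℕ A (λ i → ℕSum.sum {d} (λ r → suc i * e (suc i) r))

    weight-pack : ∀ A e → weight (eulerWeights d A) (pack A e) ≡ weightedSum A e
    weight-pack zero    e = refl
    weight-pack (suc A) e = trans (weight-packRow A d (e (suc A)) (pack A e))
      (trans (ℕ.+-comm _ (weight (eulerWeights d A) (pack A e))) (cong (_+ ℕSum.sum {d} (λ r → suc A * e (suc A) r)) (weight-pack A e)))

    pack-cong : ∀ A {e f : Entries} → (∀ i → i < A → ∀ r → e (suc i) r ≡ f (suc i) r) → pack A e ≡ pack A f
    pack-cong zero    e≗f = refl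
    pack-cong (suc A) e≗f = trans (packRow-cong A d (e≗f A ℕ.≤-refl))
      (cong (packRow A d _) (pack-cong A λ i i<A → e≗f i (ℕ.m<n⇒m<1+n i<A)))

    unpack-≤ : ∀ A v {a} r → a ≤ A → unpack (suc A) v a r ≡ unpack A (rest A d v) a r
    unpack-≤ A v {a} r a≤A with a ℕ.≟ suc A
    ... | yes refl = ⊥-elim (ℕ.1+n≰n a≤A)
    ... | no  _    = refl

    unpack-suc : ∀ A v r → unpack (suc A) v (suc A) r ≡ row A d v r
    unpack-suc A v r with suc A ℕ.≟ suc A
    ... | yes _  = refl
    ... | no neq = ⊥-elim (neq refl)

    unpack-> : ∀ A v {a} r → A < a → unpack A v a r ≡ 0
    unpack-> zero    v     r A<a = refl
    unpack-> (suc A) v {a} r A<a with a ℕ.≟ suc A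
    ... | yes refl = ⊥-elim (ℕ.1+n≰n A<a)
    ... | no  _    = unpack-> A (rest A d v) r (ℕ.<-trans (ℕ.n<1+n A) A<a)

    pack-unpack : ∀ A v → pack A (λ a → unpack A v a) ≡ v
    pack-unpack zero    v = refl
    pack-unpack (suc A) v = trans
      (packRow-cong A d (unpack-suc A v))
      (trans (cong (packRow A d (row A d v)) (trans (pack-cong A (λ i i<A r → unpack-≤ A v r i<A)) (pack-unpack A (rest A d v))))
             (packRow-row-rest A d v))

    unpack-pack : ∀ A (e : Entries) a .{{_ : NonZero a}} r → a ≤ A → unpack A (pack A e) a r ≡ e a r
    unpack-pack zero    e (suc a) r ()
    unpack-pack (suc A) e a       r a≤1+A with a ℕ.≟ suc A
    ... | yes refl = row-packRow A d (e (suc A)) (pack A e) r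
    ... | no  neq  = trans (cong (λ v → unpack A v a r) (rest-packRow A d (e (suc A)) (pack A e)))
                           (unpack-pack A e a r (ℕ.≤-pred (ℕ.≤∧≢⇒< a≤1+A neq)))

    weightedSum-mono : ∀ A j e → weightedSum A e ≤ weightedSum (j + A) e
    weightedSum-mono A zero    e = ℕ.≤-refl
    weightedSum-mono A (suc j) e = ℕ.≤-trans (weightedSum-mono A j e) (ℕ.m≤m+n _ _)

    term≤sum : ∀ {e} (f : Fin e → ℕ) r → f r ≤ ℕSum.sum f
    term≤sum f zero    = ℕ.m≤m+n _ _
    term≤sum f (suc r) = ℕ.≤-trans (term≤sum (f ∘ suc) r) (ℕ.m≤n+m _ _)

    entry≤weightedSum : ∀ A (e : Entries) i r → i < A → suc i * e (suc i) r ≤ weightedSum A e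
    entry≤weightedSum A e i r i<A = ℕ.≤-trans (term≤sum (λ r → suc i * e (suc i) r) r)
      (ℕ.≤-trans (ℕ.m≤n+m _ (weightedSum i e))
        (subst (λ k → weightedSum (suc i) e ≤ weightedSum k e) (ℕ.m∸n+n≡m i<A) (weightedSum-mono (suc i) (A ℕ.∸ suc i) e)))

    weightedSum-vanish : ∀ A j e → (∀ i → A ≤ i → ∀ r → e (suc i) r ≡ 0) → weightedSum (j + A) e ≡ weightedSum A e
    weightedSum-vanish A zero    e e≗0 = refl
    weightedSum-vanish A (suc j) e e≗0 = trans (cong₂ _+_ (weightedSum-vanish A j e e≗0)
      (trans (ℕSum.sum-cong-≗ (λ r → trans (cong (suc (j + A) *_) (e≗0 (j + A) (ℕ.m≤n+m A j) r)) (ℕ.*-zeroʳ (j + A))))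
             (ℕSum.sum-replicate-zero d))) (ℕ.+-identityʳ _)

    -- A nonzero entry in row `a` alone contributes at least `a` to `N H`.
    entry-vanish : ∀ {n} (H : Histogram d) → N H ≤ n → ∀ a .{{_ : NonZero a}} r → n < a → entry H a r ≡ 0
    entry-vanish {n} H NH≤n (suc i) r n<a with ℕ.<-≤-connex i (bound H)
    ... | inj₂ bound≤i = support H (suc i) r (s≤s bound≤i)
    ... | inj₁ i<bound with entry H (suc i) r | entry≤weightedSum (bound H) (λ a → entry H a) i r i<bound
    ...   | zero  | _ = refl
    ...   | suc x | h = ⊥-elim (ℕ.<⇒≱ n<a (ℕ.≤-trans (ℕ.m≤m*n (suc i) (suc x)) (ℕ.≤-trans h NH≤n)))

    -- The bound carried by `H` may lie on either side of `n`: stopping early drops non-negative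
    -- rows, going further adds rows of zeros.
    weightedSum≤N : ∀ n (H : Histogram d) → weightedSum n (λ a → entry H a) ≤ N H
    weightedSum≤N n H with ℕ.≤-total n (bound H)
    ... | inj₁ n≤b = subst (λ k → weightedSum n e ≤ weightedSum k e) (ℕ.m∸n+n≡m n≤b) (weightedSum-mono n (bound H ℕ.∸ n) e)
      where e : Entries
            e a = entry H a
    ... | inj₂ b≤n = ℕ.≤-reflexive (subst (λ k → weightedSum k e ≡ weightedSum (bound H) e) (ℕ.m∸n+n≡m b≤n)
                       (weightedSum-vanish (bound H) (n ℕ.∸ bound H) e λ i b≤i r → support H (suc i) r (s≤s b≤i)))
      where e : Entries
            e a = entry H a

    histogram : ∀ A → Assignment (eulerWeights d A) → Histogram d
    histogram A v = record
      { entry   = λ a → unpack A v a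
      ; bound   = A
      ; support = λ a r A<a → unpack-> A v r A<a
      }

    N-histogram : ∀ A v → N (histogram A v) ≡ weight (eulerWeights d A) v
    N-histogram A v = trans (sym (weight-pack A (λ a → unpack A v a))) (cong (weight (eulerWeights d A)) (pack-unpack A v))

    -- Here `n` replaces the individual bounds as a common cut-off. By `entry-vanish` no entry is
    -- lost by cutting at row `n`, and equality in `ℋ d n` compares entries only.
    ℋ↔Solution : ∀ n → Inverse (ℋ d n) (setoid (Solution (eulerWeights d n) n))
    ℋ↔Solution n = record
      { to        = to
      ; from      = from
      ; to-cong   = to-cong
      ; from-cong = λ { refl a r → refl }
      ; inverse   = (λ {s} {H} H≈ → trans (to-cong {H} {from s} H≈) (Solution-≡ (eulerWeights d n) (pack-unpack n (proj₁ s))))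
                  , (λ { {H , p} refl a r → from∘to H p a r })
      }
      where
      to : ∃ (λ (H : Histogram d) → N H ≤ n) → Solution (eulerWeights d n) n
      to (H , p) = pack n (λ a → entry H a) ,
        subst (_≤ n) (sym (weight-pack n (λ a → entry H a))) (ℕ.≤-trans (weightedSum≤N n H) p)
      from : Solution (eulerWeights d n) n → ∃ (λ (H : Histogram d) → N H ≤ n)
      from (v , p) = histogram n v , subst (_≤ n) (sym (N-histogram n v)) p
      to-cong : ∀ {H H′} → (∀ a .{{_ : NonZero a}} r → entry (proj₁ H) a r ≡ entry (proj₁ H′) a r) → to H ≡ to H′
      to-cong H≈H′ = Solution-≡ (eulerWeights d n) (pack-cong n (λ i _ r → H≈H′ (suc i) r))
      from∘to : ∀ H (p : N H ≤ n) a .{{_ : NonZero a}} r → entry (proj₁ (from (to (H , p)))) a r ≡ entry H a r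
      from∘to H p a r with ℕ.<-≤-connex n a
      ... | inj₁ n<a = trans (unpack-> n _ r n<a) (sym (entry-vanish H p a r n<a))
      ... | inj₂ a≤n = unpack-pack n (λ a → entry H a) a r a≤n

  ∃-cardinality : ∀ d n → ∃ λ k → HasCardinality (ℋ d n) k × + k ≡ ∑ℤ (suc n) (eulerProduct d)
  ∃-cardinality d n =
    let k , bij , eq = count-solutions (partialProduct-inverseProduct d n) n (<-wellFounded n) in
    k , (ℋ↔Solution n ⨾ bij) ,
    trans eq (∑ℤ-cong (suc n) λ m m<1+n → sym (eulerProduct≡partialProduct d (ℕ.≤-pred m<1+n)))

module Exponential where

  open Counting
  open import Data.Integer.Base as ℤ using (ℤ; +_; 0ℤ)
  import Data.Integer.Properties as ℤ
  open import Data.List.Base using (List; []; _∷_; _++_; map; replicate)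
  open import Data.List.Relation.Unary.All using (All; []; _∷_)
  open import Data.List.Relation.Unary.All.Properties using (++⁺)
  open import Data.Nat.Base as ℕ using (ℕ; zero; suc; _!; z≤n; s≤s)
  open import Data.Nat.Induction using (<-rec)
  import Data.Nat.Properties as ℕ
  open import Data.Nat.Properties using (_!≢0)
  open import Data.Product.Base using (∃; _×_; _,_)
  open import Data.Rational.Base as ℚ using (ℚ; 0ℚ; 1ℚ; _/_; _≤_; _<_; _+_; _*_; _-_; -_)
  import Data.Rational.Properties as ℚ
  open import Data.Rational.Solver using (module +-*-Solver)
  import Data.Rational.Unnormalised.Base as ℚᵘ
  import Data.Rational.Unnormalised.Properties as ℚᵘ
  open import Relation.Binary.PropositionalEquality
  open import Algebra.Bundles using (CommutativeRing)
  open import Algebra.Definitions.RawSemiring ℚ.+-*-rawSemiring using (_^_)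
  open import Algebra.Properties.Semiring.Exp (CommutativeRing.semiring ℚ.+-*-commutativeRing) using (^-assocʳ)
  open +-*-Solver using (solve; _:=_; _:+_; _:*_; con)

  -- Finite sums of rationals.

  0≤^ : ∀ {x} k → 0ℚ ≤ x → 0ℚ ≤ x ^ k
  0≤^ zero    0≤x = 0≤⌜⌝ 1
  0≤^ (suc k) 0≤x = 0≤* 0≤x (0≤^ k 0≤x)

  ∑ℚ-cong : ∀ n {f g} → (∀ k → k ℕ.< n → f k ≡ g k) → ∑ℚ n f ≡ ∑ℚ n g
  ∑ℚ-cong zero    f≗g = refl
  ∑ℚ-cong (suc n) f≗g = cong₂ _+_ (∑ℚ-cong n λ k k<n → f≗g k (ℕ.m<n⇒m<1+n k<n)) (f≗g n ℕ.≤-refl)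

  ∑ℚ-mono : ∀ n {f g} → (∀ k → k ℕ.< n → f k ≤ g k) → ∑ℚ n f ≤ ∑ℚ n g
  ∑ℚ-mono zero    f≤g = ℚ.≤-refl
  ∑ℚ-mono (suc n) f≤g = ℚ.+-mono-≤ (∑ℚ-mono n λ k k<n → f≤g k (ℕ.m<n⇒m<1+n k<n)) (f≤g n ℕ.≤-refl)

  ∑ℚ-zero : ∀ n → ∑ℚ n (λ _ → 0ℚ) ≡ 0ℚ
  ∑ℚ-zero zero    = refl
  ∑ℚ-zero (suc n) = trans (ℚ.+-identityʳ _) (∑ℚ-zero n)

  0≤∑ℚ : ∀ n {f} → (∀ k → k ℕ.< n → 0ℚ ≤ f k) → 0ℚ ≤ ∑ℚ n f
  0≤∑ℚ n 0≤f = subst (_≤ ∑ℚ n _) (∑ℚ-zero n) (∑ℚ-mono n 0≤f)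

  ∑ℚ-suc : ∀ n f → ∑ℚ (suc n) f ≡ f 0 + ∑ℚ n (λ k → f (suc k))
  ∑ℚ-suc zero    f = ℚ.+-comm 0ℚ (f 0)
  ∑ℚ-suc (suc n) f = trans (cong (_+ f (suc n)) (∑ℚ-suc n f)) (ℚ.+-assoc (f 0) _ _)

  ∑ℚ-+ : ∀ n f g → ∑ℚ n (λ k → f k + g k) ≡ ∑ℚ n f + ∑ℚ n g
  ∑ℚ-+ zero    f g = refl
  ∑ℚ-+ (suc n) f g = trans (cong (_+ (f n + g n)) (∑ℚ-+ n f g))
    (solve 4 (λ a b c d → (a :+ b) :+ (c :+ d) := (a :+ c) :+ (b :+ d)) refl (∑ℚ n f) (∑ℚ n g) (f n) (g n))

  ∑ℚ-*ˡ : ∀ n c f → ∑ℚ n (λ k → c * f k) ≡ c * ∑ℚ n f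
  ∑ℚ-*ˡ zero    c f = sym (ℚ.*-zeroʳ c)
  ∑ℚ-*ˡ (suc n) c f = trans (cong (_+ c * f n) (∑ℚ-*ˡ n c f)) (sym (ℚ.*-distribˡ-+ c (∑ℚ n f) (f n)))

  ⌜suc⌝ : ∀ n → ⌜ suc n ⌝ ≡ 1ℚ + ⌜ n ⌝
  ⌜suc⌝ n = ⌜⌝-+ 1 n

  ⌜suc⌝-cancel : ∀ n {p q} → ⌜ suc n ⌝ * p ≡ ⌜ suc n ⌝ * q → p ≡ q
  ⌜suc⌝-cancel n {p} {q} eq = trans (unit p) (trans (cong (1/1+ n *_) eq) (sym (unit q)))
    where
    unit : ∀ p → p ≡ 1/1+ n * (⌜ suc n ⌝ * p)
    unit p = sym (trans (sym (ℚ.*-assoc (1/1+ n) ⌜ suc n ⌝ p))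
      (trans (cong (_* p) (trans (ℚ.*-comm (1/1+ n) ⌜ suc n ⌝) (⌜⌝*1/ n))) (ℚ.*-identityˡ p)))

  -- Rational coefficient sequences, shifts and the Euler operator.

  Sequence : Set
  Sequence = ℕ → ℚ

  delayℚ : ℕ → Sequence → Sequence
  delayℚ = delay 0ℚ

  𝟙 : Sequence
  𝟙 zero    = 1ℚ
  𝟙 (suc _) = 0ℚ

  -- The Euler operator f ↦ x f′.
  θ : Sequence → Sequence
  θ f m = ⌜ m ⌝ * f m

  delay-+ : ∀ w f g m → delayℚ w (λ k → f k + g k) m ≡ delayℚ w f m + delayℚ w g m
  delay-+ zero    f g m       = refl
  delay-+ (suc w) f g zero    = refl
  delay-+ (suc w) f g (suc m) = delay-+ w f g m

  delay-* : ∀ w c f m → delayℚ w (λ k → c * f k) m ≡ c * delayℚ w f m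
  delay-* zero    c f m       = refl
  delay-* (suc w) c f zero    = sym (ℚ.*-zeroʳ c)
  delay-* (suc w) c f (suc m) = delay-* w c f m

  delay-0 : ∀ w m → delayℚ w (λ _ → 0ℚ) m ≡ 0ℚ
  delay-0 zero    m       = refl
  delay-0 (suc w) zero    = refl
  delay-0 (suc w) (suc m) = delay-0 w m

  delay-delay : ∀ a b f m → delayℚ a (delayℚ b f) m ≡ delayℚ (a ℕ.+ b) f m
  delay-delay zero    b f m       = refl
  delay-delay (suc a) b f zero    = refl
  delay-delay (suc a) b f (suc m) = delay-delay a b f m

  delay-comm : ∀ a b f m → delayℚ a (delayℚ b f) m ≡ delayℚ b (delayℚ a f) m
  delay-comm a b f m = trans (delay-delay a b f m)
    (trans (cong (λ w → delayℚ w f m) (ℕ.+-comm a b)) (sym (delay-delay b a f m)))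

  delay-< : ∀ {w m} f → m ℕ.< w → delayℚ w f m ≡ 0ℚ
  delay-< {suc w} {zero}  f _         = refl
  delay-< {suc w} {suc m} f (s≤s m<w) = delay-< f m<w

  delay-local : ∀ w {f g m} → (∀ k → k ℕ.≤ m → f k ≡ g k) → delayℚ w f m ≡ delayℚ w g m
  delay-local zero    {m = m}     f≗g = f≗g m ℕ.≤-refl
  delay-local (suc w) {m = zero}  f≗g = refl
  delay-local (suc w) {m = suc m} f≗g = delay-local w λ k k≤m → f≗g k (ℕ.m≤n⇒m≤1+n k≤m)

  delay-suc-local : ∀ w {f g m} → (∀ k → k ℕ.< m → f k ≡ g k) → delayℚ (suc w) f m ≡ delayℚ (suc w) g m
  delay-suc-local w {m = zero}  f≗g = refl
  delay-suc-local w {m = suc m} f≗g = delay-local w λ k k≤m → f≗g k (s≤s k≤m)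

  0≤delay : ∀ w {f} → (∀ k → 0ℚ ≤ f k) → ∀ m → 0ℚ ≤ delayℚ w f m
  0≤delay zero    0≤f m       = 0≤f m
  0≤delay (suc w) 0≤f zero    = ℚ.≤-refl
  0≤delay (suc w) 0≤f (suc m) = 0≤delay w 0≤f m

  θ-delay : ∀ w f m → θ (delayℚ w f) m ≡ ⌜ w ⌝ * delayℚ w f m + delayℚ w (θ f) m
  θ-delay zero    f m       = solve 2 (λ a b → a :* b := con 0ℚ :* b :+ a :* b) refl ⌜ m ⌝ (f m)
  θ-delay (suc w) f zero    = trans (ℚ.*-zeroˡ 0ℚ) (sym (trans (ℚ.+-identityʳ _) (ℚ.*-zeroʳ ⌜ suc w ⌝)))
  θ-delay (suc w) f (suc m) = begin
    ⌜ suc m ⌝ * t                            ≡⟨ cong (_* t) (⌜suc⌝ m) ⟩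
    (1ℚ + ⌜ m ⌝) * t                         ≡⟨ expand ⌜ m ⌝ t ⟩
    t + ⌜ m ⌝ * t                            ≡⟨ cong (λ z → t + z) (θ-delay w f m) ⟩
    t + (⌜ w ⌝ * t + delayℚ w (θ f) m)       ≡⟨ regroup t ⌜ w ⌝ (delayℚ w (θ f) m) ⟩
    (1ℚ + ⌜ w ⌝) * t + delayℚ w (θ f) m      ≡⟨ cong (λ z → z * t + delayℚ w (θ f) m) (sym (⌜suc⌝ w)) ⟩
    ⌜ suc w ⌝ * t + delayℚ w (θ f) m         ∎
    where
    open ≡-Reasoning
    t = delayℚ w f m
    expand : ∀ a t → (1ℚ + a) * t ≡ t + a * t
    expand = solve 2 (λ a t → (con 1ℚ :+ a) :* t := t :+ a :* t) refl
    regroup : ∀ t w u → t + (w * t + u) ≡ (1ℚ + w) * t + u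
    regroup = solve 3 (λ t w u → t :+ (w :* t :+ u) := (con 1ℚ :+ w) :* t :+ u) refl

  -- Polynomials as operators on sequences.

  -- A polynomial without constant term; the entry (b , c) stands for c x^(b + 1).
  Polynomial : Set
  Polynomial = List (ℕ × ℚ)

  -- Multiplication of a sequence by the polynomial. A product of polynomials appears as a
  -- composition of such operators, so the rules for `delayℚ` carry over monomial by monomial.
  _⊛_ : Polynomial → Sequence → Sequence
  ([]            ⊛ f) m = 0ℚ
  (((b , c) ∷ U) ⊛ f) m = c * delayℚ (suc b) f m + (U ⊛ f) m

  θₚ : Polynomial → Polynomial
  θₚ = map λ (b , c) → b , ⌜ suc b ⌝ * c

  evaluate : Polynomial → ℚ → ℚ
  evaluate []            x = 0ℚ
  evaluate ((b , c) ∷ U) x = c * x ^ suc b + evaluate U x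

  ⊛-+ : ∀ U f g m → (U ⊛ (λ k → f k + g k)) m ≡ (U ⊛ f) m + (U ⊛ g) m
  ⊛-+ []            f g m = refl
  ⊛-+ ((b , c) ∷ U) f g m = trans
    (cong₂ (λ s t → c * s + t) (delay-+ (suc b) f g m) (⊛-+ U f g m))
    (solve 5 (λ c p q r s → c :* (p :+ q) :+ (r :+ s) := (c :* p :+ r) :+ (c :* q :+ s)) refl
      c (delayℚ (suc b) f m) (delayℚ (suc b) g m) ((U ⊛ f) m) ((U ⊛ g) m))

  ⊛-* : ∀ U a f m → (U ⊛ (λ k → a * f k)) m ≡ a * (U ⊛ f) m
  ⊛-* []            a f m = sym (ℚ.*-zeroʳ a)
  ⊛-* ((b , c) ∷ U) a f m = trans
    (cong₂ (λ s t → c * s + t) (delay-* (suc b) a f m) (⊛-* U a f m))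
    (solve 4 (λ c a p q → c :* (a :* p) :+ a :* q := a :* (c :* p :+ q)) refl c a (delayℚ (suc b) f m) ((U ⊛ f) m))

  ⊛-delay : ∀ U w f m → (U ⊛ delayℚ w f) m ≡ delayℚ w (U ⊛ f) m
  ⊛-delay []            w f m = sym (delay-0 w m)
  ⊛-delay ((b , c) ∷ U) w f m = trans
    (cong₂ (λ s t → c * s + t) (delay-comm (suc b) w f m) (⊛-delay U w f m))
    (sym (trans (delay-+ w (λ k → c * delayℚ (suc b) f k) (U ⊛ f) m)
                (cong (_+ delayℚ w (U ⊛ f) m) (delay-* w c (delayℚ (suc b) f) m))))

  -- Every monomial has positive degree, so coefficient `m` of the product sees only earlier
  -- coefficients of `f`. This is what makes `θ f = θₚ U ⊛ f` a recursion for `f`.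
  ⊛-local : ∀ U {f g m} → (∀ k → k ℕ.< m → f k ≡ g k) → (U ⊛ f) m ≡ (U ⊛ g) m
  ⊛-local []            f≗g = refl
  ⊛-local ((b , c) ∷ U) f≗g = cong₂ (λ s t → c * s + t) (delay-suc-local b f≗g) (⊛-local U f≗g)

  ⊛-cong : ∀ U {f g} → (∀ k → f k ≡ g k) → ∀ m → (U ⊛ f) m ≡ (U ⊛ g) m
  ⊛-cong U f≗g m = ⊛-local U λ k _ → f≗g k

  ⊛-0 : ∀ U m → (U ⊛ (λ _ → 0ℚ)) m ≡ 0ℚ
  ⊛-0 []            m = refl
  ⊛-0 ((b , c) ∷ U) m = trans (cong₂ (λ s t → c * s + t) (delay-0 (suc b) m) (⊛-0 U m))
    (trans (ℚ.+-identityʳ _) (ℚ.*-zeroʳ c))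

  ⊛-comm : ∀ U V f m → (U ⊛ (V ⊛ f)) m ≡ (V ⊛ (U ⊛ f)) m
  ⊛-comm []            V f m = sym (⊛-0 V m)
  ⊛-comm ((b , c) ∷ U) V f m = sym (trans (⊛-+ V (λ k → c * delayℚ (suc b) f k) (U ⊛ f) m)
    (cong₂ _+_ (trans (⊛-* V c (delayℚ (suc b) f) m) (cong (c *_) (⊛-delay V (suc b) f m))) (sym (⊛-comm U V f m))))

  ⊛-++ : ∀ U V f m → ((U ++ V) ⊛ f) m ≡ (U ⊛ f) m + (V ⊛ f) m
  ⊛-++ []            V f m = sym (ℚ.+-identityˡ _)
  ⊛-++ ((b , c) ∷ U) V f m = trans (cong (λ z → c * delayℚ (suc b) f m + z) (⊛-++ U V f m))
    (sym (ℚ.+-assoc (c * delayℚ (suc b) f m) ((U ⊛ f) m) ((V ⊛ f) m)))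

  -- The product rule, monomial by monomial from `θ-delay`.
  θ-⊛ : ∀ U f m → θ (U ⊛ f) m ≡ (θₚ U ⊛ f) m + (U ⊛ θ f) m
  θ-⊛ []            f m = trans (ℚ.*-zeroʳ ⌜ m ⌝) (sym (ℚ.+-identityʳ 0ℚ))
  θ-⊛ ((b , c) ∷ U) f m = lemma ⌜ m ⌝ c (delayℚ (suc b) f m) ((U ⊛ f) m) ⌜ suc b ⌝ (delayℚ (suc b) (θ f) m)
                                ((θₚ U ⊛ f) m) ((U ⊛ θ f) m) (θ-delay (suc b) f m) (θ-⊛ U f m)
    where
    lemma : ∀ m c d u b e v w → m * d ≡ b * d + e → m * u ≡ v + w → m * (c * d + u) ≡ ((b * c) * d + v) + (c * e + w)
    lemma m c d u b e v w h k = trans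
      (solve 4 (λ m c d u → m :* (c :* d :+ u) := c :* (m :* d) :+ m :* u) refl m c d u)
      (trans (cong₂ (λ s t → c * s + t) h k)
        (solve 6 (λ b c d e v w → c :* (b :* d :+ e) :+ (v :+ w) := ((b :* c) :* d :+ v) :+ (c :* e :+ w)) refl b c d e v w))

  NonNegative : Polynomial → Set
  NonNegative = All λ (_ , c) → 0ℚ ≤ c

  0≤⊛ : ∀ {U f} → NonNegative U → (∀ k → 0ℚ ≤ f k) → ∀ m → 0ℚ ≤ (U ⊛ f) m
  0≤⊛ []                   0≤f m = ℚ.≤-refl
  0≤⊛ {(b , _) ∷ _} (0≤c ∷ 0≤U) 0≤f m = 0≤+ (0≤* 0≤c (0≤delay (suc b) 0≤f m)) (0≤⊛ 0≤U 0≤f m)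

  power : Polynomial → ℕ → Sequence
  power U zero    = 𝟙
  power U (suc k) = U ⊛ power U k

  0≤power : ∀ {U} k → NonNegative U → ∀ m → 0ℚ ≤ power U k m
  0≤power zero    0≤U zero    = 0≤⌜⌝ 1
  0≤power zero    0≤U (suc m) = ℚ.≤-refl
  0≤power (suc k) 0≤U m       = 0≤⊛ 0≤U (0≤power k 0≤U) m

  -- Each factor `U` raises the order by at least one.
  power-vanish : ∀ U k m → m ℕ.< k → power U k m ≡ 0ℚ
  power-vanish U (suc k) m (s≤s m≤k) = trans
    (⊛-local U {g = λ _ → 0ℚ} λ j j<m → power-vanish U k j (ℕ.≤-trans j<m m≤k)) (⊛-0 U m)

  θ𝟙 : ∀ m → θ 𝟙 m ≡ 0ℚ
  θ𝟙 zero    = ℚ.*-zeroˡ (𝟙 0)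
  θ𝟙 (suc m) = ℚ.*-zeroʳ ⌜ suc m ⌝

  -- The chain rule `θ (U^(k+1)) = (k+1) U^k θ U`, by induction from the product rule; `⊛-comm`
  -- brings `θ U` to the front.
  θ-power : ∀ U k m → θ (power U (suc k)) m ≡ ⌜ suc k ⌝ * (θₚ U ⊛ power U k) m
  θ-power U zero m = begin
    θ (U ⊛ 𝟙) m                       ≡⟨ θ-⊛ U 𝟙 m ⟩
    (θₚ U ⊛ 𝟙) m + (U ⊛ θ 𝟙) m        ≡⟨ cong (λ z → (θₚ U ⊛ 𝟙) m + z) (trans (⊛-cong U θ𝟙 m) (⊛-0 U m)) ⟩
    (θₚ U ⊛ 𝟙) m + 0ℚ                 ≡⟨ ℚ.+-identityʳ _ ⟩
    (θₚ U ⊛ 𝟙) m                      ≡⟨ sym (ℚ.*-identityˡ _) ⟩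
    ⌜ 1 ⌝ * (θₚ U ⊛ 𝟙) m              ∎
    where open ≡-Reasoning
  θ-power U (suc k) m = begin
    θ (U ⊛ W) m                                                  ≡⟨ θ-⊛ U W m ⟩
    (θₚ U ⊛ W) m + (U ⊛ θ W) m                                   ≡⟨ cong (λ z → t + z) (⊛-cong U (θ-power U k) m) ⟩
    t + (U ⊛ (λ j → ⌜ suc k ⌝ * (θₚ U ⊛ power U k) j)) m         ≡⟨ cong (λ z → t + z) (⊛-* U ⌜ suc k ⌝ (θₚ U ⊛ power U k) m) ⟩
    t + ⌜ suc k ⌝ * (U ⊛ (θₚ U ⊛ power U k)) m                   ≡⟨ cong (λ z → t + ⌜ suc k ⌝ * z) (⊛-comm U (θₚ U) (power U k) m) ⟩
    t + ⌜ suc k ⌝ * t                                            ≡⟨ solve 2 (λ t a → t :+ a :* t := (con 1ℚ :+ a) :* t) refl t ⌜ suc k ⌝ ⟩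
    (1ℚ + ⌜ suc k ⌝) * t                                         ≡⟨ cong (_* t) (sym (⌜suc⌝ (suc k))) ⟩
    ⌜ suc (suc k) ⌝ * t                                          ∎
    where
    open ≡-Reasoning
    W = power U (suc k)
    t = (θₚ U ⊛ W) m

  -- The truncated exponential and its differential equation.

  1/! : ℕ → ℚ
  1/! k = (+ 1 / k !) {{k !≢0}}

  0≤1/! : ∀ k → 0ℚ ≤ 1/! k
  0≤1/! k = ℚ.nonNegative⁻¹ (1/! k) {{ℚ.normalize-nonNeg 1 (k !) {{k !≢0}}}}

  1/!-suc : ∀ k → 1/! (suc k) * ⌜ suc k ⌝ ≡ 1/! k
  1/!-suc k = trans (cong (_* ⌜ suc k ⌝) (1/-* (suc k) (k !) {{_}} {{k !≢0}} {{suc k !≢0}}))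
    (lemma ⌜ suc k ⌝ (1/1+ k) (1/! k) (⌜⌝*1/ k))
    where
    lemma : ∀ s r f → s * r ≡ 1ℚ → (r * f) * s ≡ f
    lemma s r f h = trans (solve 3 (λ s r f → (r :* f) :* s := (s :* r) :* f) refl s r f)
      (trans (cong (_* f) h) (ℚ.*-identityˡ f))

  -- The first K terms of exp U = ∑ U^k / k!.
  expₚ : Polynomial → ℕ → Sequence
  expₚ U K m = ∑ℚ K (λ k → 1/! k * power U k m)

  0≤expₚ : ∀ {U} K → NonNegative U → ∀ m → 0ℚ ≤ expₚ U K m
  0≤expₚ K 0≤U m = 0≤∑ℚ K λ k _ → 0≤* (0≤1/! k) (0≤power k 0≤U m)

  -- Since `(k+1) / (k+1)! = 1 / k!`, differentiation multiplies by `θ U` and loses one term of the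
  -- exponential sum.
  θ-expₚ : ∀ U K m → θ (expₚ U (suc K)) m ≡ (θₚ U ⊛ expₚ U K) m
  θ-expₚ U zero m = begin
    ⌜ m ⌝ * (0ℚ + 1/! 0 * 𝟙 m)   ≡⟨ solve 2 (λ a b → a :* (con 0ℚ :+ con 1ℚ :* b) := a :* b) refl ⌜ m ⌝ (𝟙 m) ⟩
    θ 𝟙 m                        ≡⟨ θ𝟙 m ⟩
    0ℚ                           ≡⟨ sym (⊛-0 (θₚ U) m) ⟩
    (θₚ U ⊛ (λ _ → 0ℚ)) m        ∎
    where open ≡-Reasoning
  θ-expₚ U (suc K) m = begin
    ⌜ m ⌝ * (Y + 1/! (suc K) * W)             ≡⟨ expand ⌜ m ⌝ Y (1/! (suc K)) W ⟩
    ⌜ m ⌝ * Y + 1/! (suc K) * (⌜ m ⌝ * W)     ≡⟨ cong₂ (λ s t → s + 1/! (suc K) * t) (θ-expₚ U K m) (θ-power U K m) ⟩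
    y + 1/! (suc K) * (⌜ suc K ⌝ * w)         ≡⟨ cong (λ z → y + z) (sym (ℚ.*-assoc (1/! (suc K)) ⌜ suc K ⌝ w)) ⟩
    y + 1/! (suc K) * ⌜ suc K ⌝ * w           ≡⟨ cong (λ z → y + z * w) (1/!-suc K) ⟩
    y + 1/! K * w                             ≡⟨ cong (λ z → y + z) (sym (⊛-* (θₚ U) (1/! K) (power U K) m)) ⟩
    y + (θₚ U ⊛ (λ j → 1/! K * power U K j)) m  ≡⟨ sym (⊛-+ (θₚ U) (expₚ U K) (λ j → 1/! K * power U K j) m) ⟩
    (θₚ U ⊛ expₚ U (suc K)) m                 ∎
    where
    open ≡-Reasoning
    Y = expₚ U (suc K) m
    W = power U (suc K) m
    y = (θₚ U ⊛ expₚ U K) m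
    w = (θₚ U ⊛ power U K) m
    expand : ∀ m Y a W → m * (Y + a * W) ≡ m * Y + a * (m * W)
    expand = solve 4 (λ m Y a W → m :* (Y :+ a :* W) := m :* Y :+ a :* (m :* W)) refl

  expₚ-stable : ∀ U K m → m ℕ.< K → expₚ U (suc K) m ≡ expₚ U K m
  expₚ-stable U K m m<K = trans
    (cong (λ z → expₚ U K m + z) (trans (cong (1/! K *_) (power-vanish U K m m<K)) (ℚ.*-zeroʳ (1/! K))))
    (ℚ.+-identityʳ _)

  expₚ-0 : ∀ U K → expₚ U (suc K) 0 ≡ 1ℚ
  expₚ-0 U zero    = refl
  expₚ-0 U (suc K) = trans (expₚ-stable U (suc K) 0 (s≤s z≤n)) (expₚ-0 U K)

  -- f = exp U modulo x^(n + 1), stated through the logarithmic derivative.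
  record Log (n : ℕ) (f : Sequence) (U : Polynomial) : Set where
    constructor mkLog
    field
      initial    : f 0 ≡ 1ℚ
      derivative : ∀ m → m ℕ.≤ n → θ f m ≡ (θₚ U ⊛ f) m

  open Log

  -- Uniqueness for `θ f = (θ U) f` with `f 0 = 1`: coefficient `m > 0`, times `m`, is determined by
  -- the earlier ones. The term lost in `θ-expₚ` is a multiple of `U^n` and so invisible below
  -- `x^n`.
  Log⇒expₚ : ∀ {n f U} → Log n f U → ∀ m → m ℕ.≤ n → f m ≡ expₚ U (suc n) m
  Log⇒expₚ {n} {f} {U} l = <-rec (λ m → m ℕ.≤ n → f m ≡ expₚ U (suc n) m) step
    where
    step : ∀ m → (∀ {k} → k ℕ.< m → k ℕ.≤ n → f k ≡ expₚ U (suc n) k) → m ℕ.≤ n → f m ≡ expₚ U (suc n) m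
    step zero    rec m≤n = trans (initial l) (sym (expₚ-0 U n))
    step (suc m) rec m<n = ⌜suc⌝-cancel m (begin
      θ f (suc m)                         ≡⟨ derivative l (suc m) m<n ⟩
      (θₚ U ⊛ f) (suc m)                  ≡⟨ ⊛-local (θₚ U) (λ k k<m → trans (rec k<m (ℕ.<⇒≤ (ℕ.≤-trans k<m m<n)))
                                                                          (expₚ-stable U n k (ℕ.≤-trans k<m m<n))) ⟩
      (θₚ U ⊛ expₚ U n) (suc m)           ≡⟨ sym (θ-expₚ U n (suc m)) ⟩
      θ (expₚ U (suc n)) (suc m)          ∎)
      where open ≡-Reasoning

  -- The logarithm of the Euler product.

  -- ∑_{j = 1}^{J} x^(j (i + 1)) / j, a partial sum of - log (1 - x^(i + 1)).
  logGeometric : ℕ → ℕ → Polynomial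
  logGeometric i zero    = []
  logGeometric i (suc J) = (i ℕ.+ J ℕ.* suc i , 1/1+ J) ∷ logGeometric i J

  logProduct : List ℕ → ℕ → Polynomial
  logProduct []       J = []
  logProduct (i ∷ ws) J = logGeometric i J ++ logProduct ws J

  0≤logGeometric : ∀ i J → NonNegative (logGeometric i J)
  0≤logGeometric i zero    = []
  0≤logGeometric i (suc J) = 0≤1/1+ J ∷ 0≤logGeometric i J

  0≤logProduct : ∀ ws J → NonNegative (logProduct ws J)
  0≤logProduct []       J = []
  0≤logProduct (i ∷ ws) J = ++⁺ (0≤logGeometric i J) (0≤logProduct ws J)

  θₚ-++ : ∀ U V → θₚ (U ++ V) ≡ θₚ U ++ θₚ V
  θₚ-++ []      V = refl
  θₚ-++ (_ ∷ U) V = cong (_ ∷_) (θₚ-++ U V)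

  -- Applying `θ` cancels the denominators and leaves `L = w ∑ x^(jw)` over `1 ≤ j ≤ J`. Multiplied
  -- by `1 - x^w` this telescopes to `w x^w - w x^((J+1)w)`; the identity is written here without
  -- subtraction.
  θₚ-logGeometric : ∀ i J f m → let L = θₚ (logGeometric i J) ; w = suc i in
    (L ⊛ f) m + ⌜ w ⌝ * delayℚ (suc J ℕ.* w) f m ≡ ⌜ w ⌝ * delayℚ w f m + delayℚ w (L ⊛ f) m
  θₚ-logGeometric i zero f m = trans (ℚ.+-comm 0ℚ (⌜ suc i ⌝ * delayℚ (1 ℕ.* suc i) f m))
    (cong₂ _+_ (cong (λ j → ⌜ suc i ⌝ * delayℚ (suc j) f m) (ℕ.+-identityʳ i)) (sym (delay-0 (suc i) m)))
  θₚ-logGeometric i (suc J) f m = begin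
    (c * u + l) + ⌜ w ⌝ * v                                   ≡⟨ cong (λ z → (z * u + l) + ⌜ w ⌝ * v) c≡w ⟩
    (⌜ w ⌝ * u + l) + ⌜ w ⌝ * v                               ≡⟨ solve 4 (λ w u l v → (w :* u :+ l) :+ w :* v := (l :+ w :* u) :+ w :* v) refl ⌜ w ⌝ u l v ⟩
    (l + ⌜ w ⌝ * u) + ⌜ w ⌝ * v                               ≡⟨ cong (_+ ⌜ w ⌝ * v) (θₚ-logGeometric i J f m) ⟩
    (p + q) + ⌜ w ⌝ * v                                       ≡⟨ cong (λ z → (p + q) + ⌜ w ⌝ * z) (sym (delay-delay w (suc J ℕ.* w) f m)) ⟩
    (p + q) + ⌜ w ⌝ * delayℚ w (delayℚ (suc J ℕ.* w) f) m     ≡⟨ cong (λ z → (p + q) + z) (trans (cong (_* dd) (sym c≡w)) (sym (delay-* w c (delayℚ (suc J ℕ.* w) f) m))) ⟩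
    (p + q) + delayℚ w (λ k → c * delayℚ (suc J ℕ.* w) f k) m ≡⟨ solve 3 (λ p q r → (p :+ q) :+ r := p :+ (r :+ q)) refl p q _ ⟩
    p + (delayℚ w (λ k → c * delayℚ (suc J ℕ.* w) f k) m + q) ≡⟨ cong (λ z → p + z) (sym (delay-+ w _ (θₚ (logGeometric i J) ⊛ f) m)) ⟩
    p + delayℚ w (θₚ (logGeometric i (suc J)) ⊛ f) m          ∎
    where
    open ≡-Reasoning
    w = suc i
    c = ⌜ suc J ℕ.* w ⌝ * 1/1+ J
    u = delayℚ (suc J ℕ.* w) f m
    v = delayℚ (suc (suc J) ℕ.* w) f m
    l = (θₚ (logGeometric i J) ⊛ f) m
    p = ⌜ w ⌝ * delayℚ w f m
    q = delayℚ w (θₚ (logGeometric i J) ⊛ f) m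
    dd = delayℚ w (delayℚ (suc J ℕ.* w) f) m
    c≡w : c ≡ ⌜ w ⌝
    c≡w = trans (cong (_* 1/1+ J) (⌜⌝-* (suc J) w))
      (trans (solve 3 (λ a b c → (a :* b) :* c := (a :* c) :* b) refl ⌜ suc J ⌝ ⌜ w ⌝ (1/1+ J))
      (trans (cong (_* ⌜ w ⌝) (⌜⌝*1/ J)) (ℚ.*-identityˡ ⌜ w ⌝)))

  -- Apply `θ` to `f = g + x^w f`. By induction on the coefficient, `x^w θ f` may be replaced by
  -- `x^w` times `(L + θ U) f`; the parts with `θ U` recombine to `θ U f`, the others to `L f` by
  -- `θₚ-logGeometric`.
  Log-divide : ∀ {n J f g U} i → n ℕ.≤ J → (∀ m → f m ≡ g m + delayℚ (suc i) f m) →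
               Log n g U → Log n f (logGeometric i J ++ U)
  Log-divide {n} {J} {f} {g} {U} i n≤J q l = mkLog
    (trans (q 0) (trans (ℚ.+-identityʳ (g 0)) (initial l)))
    (<-rec (λ m → m ℕ.≤ n → θ f m ≡ (θₚ (logGeometric i J ++ U) ⊛ f) m) step)
    where
    open ≡-Reasoning
    w = suc i
    V = θₚ (logGeometric i J ++ U)
    L = θₚ (logGeometric i J)
    V⊛ : ∀ m → (V ⊛ f) m ≡ (L ⊛ f) m + (θₚ U ⊛ f) m
    V⊛ m = trans (cong (λ X → (X ⊛ f) m) (θₚ-++ (logGeometric i J) U)) (⊛-++ L (θₚ U) f m)
    step : ∀ m → (∀ {k} → k ℕ.< m → k ℕ.≤ n → θ f k ≡ (V ⊛ f) k) → m ℕ.≤ n → θ f m ≡ (V ⊛ f) m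
    step m rec m≤n = begin
      ⌜ m ⌝ * f m                                      ≡⟨ cong (⌜ m ⌝ *_) (q m) ⟩
      ⌜ m ⌝ * (g m + delayℚ w f m)                     ≡⟨ ℚ.*-distribˡ-+ ⌜ m ⌝ (g m) (delayℚ w f m) ⟩
      θ g m + θ (delayℚ w f) m                         ≡⟨ cong₂ _+_ (derivative l m m≤n) (θ-delay w f m) ⟩
      a + (p + delayℚ w (θ f) m)                       ≡⟨ cong (λ z → a + (p + z)) (delay-suc-local i λ k k<m → rec k<m (ℕ.<⇒≤ (ℕ.≤-trans k<m m≤n))) ⟩
      a + (p + delayℚ w (V ⊛ f) m)                     ≡⟨ cong (λ z → a + (p + z)) (trans (delay-cong w V⊛ m) (delay-+ w (L ⊛ f) (θₚ U ⊛ f) m)) ⟩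
      a + (p + (delayℚ w (L ⊛ f) m + b))               ≡⟨ solve 4 (λ a p r b → a :+ (p :+ (r :+ b)) := (p :+ r) :+ (a :+ b)) refl a p _ b ⟩
      (p + delayℚ w (L ⊛ f) m) + (a + b)               ≡⟨ cong₂ _+_ (sym (θₚ-logGeometric i J f m)) a+b ⟩
      -- The end term of the telescoping sum has degree `(J+1) w > n ≥ m`.
      ((L ⊛ f) m + ⌜ w ⌝ * delayℚ (suc J ℕ.* w) f m) + (θₚ U ⊛ f) m
        ≡⟨ cong (λ z → ((L ⊛ f) m + ⌜ w ⌝ * z) + (θₚ U ⊛ f) m) (delay-< f (ℕ.≤-<-trans m≤n (ℕ.<-≤-trans (s≤s n≤J) (ℕ.m≤m*n (suc J) w)))) ⟩
      ((L ⊛ f) m + ⌜ w ⌝ * 0ℚ) + (θₚ U ⊛ f) m          ≡⟨ solve 3 (λ a w b → (a :+ w :* con 0ℚ) :+ b := a :+ b) refl ((L ⊛ f) m) ⌜ w ⌝ ((θₚ U ⊛ f) m) ⟩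
      (L ⊛ f) m + (θₚ U ⊛ f) m                         ≡⟨ sym (V⊛ m) ⟩
      (V ⊛ f) m                                        ∎
      where
      a = (θₚ U ⊛ g) m
      b = delayℚ w (θₚ U ⊛ f) m
      p = ⌜ w ⌝ * delayℚ w f m
      a+b : a + b ≡ (θₚ U ⊛ f) m
      a+b = sym (trans (⊛-cong (θₚ U) q m) (trans (⊛-+ (θₚ U) g (delayℚ w f) m) (cong (λ z → a + z) (⊛-delay (θₚ U) w f m))))

  /1-+ : ∀ i j → (i ℤ.+ j) / 1 ≡ i / 1 + j / 1
  /1-+ i j = ℚ.toℚᵘ-injective
    (ℚᵘ.≃-trans (toℚᵘ-/ (i ℤ.+ j) 0)
    (ℚᵘ.≃-trans (ℚᵘ.*≡* (cong (ℤ._* + 1) (sym (cong₂ ℤ._+_ (ℤ.*-identityʳ i) (ℤ.*-identityʳ j)))))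
    (ℚᵘ.≃-sym (ℚᵘ.≃-trans (ℚ.toℚᵘ-homo-+ (i / 1) (j / 1)) (ℚᵘ.+-cong (toℚᵘ-/ i 0) (toℚᵘ-/ j 0))))))

  coefficient : PowerSeries → Sequence
  coefficient f m = f m / 1

  delay-coefficient : ∀ w f m → delay 0ℤ w f m / 1 ≡ delayℚ w (coefficient f) m
  delay-coefficient zero    f m       = refl
  delay-coefficient (suc w) f zero    = refl
  delay-coefficient (suc w) f (suc m) = delay-coefficient w f m

  1ₛ≡𝟙 : ∀ m → 1ₛ m / 1 ≡ 𝟙 m
  1ₛ≡𝟙 zero    = refl
  1ₛ≡𝟙 (suc m) = refl

  InverseProduct⇒Log : ∀ {ws f n J} → n ℕ.≤ J → InverseProduct ws f → Log n (coefficient f) (logProduct ws J)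
  InverseProduct⇒Log {f = f} n≤J (one f≗1) = mkLog (f≡𝟙 0) (λ m _ → trans (cong (⌜ m ⌝ *_) (f≡𝟙 m)) (θ𝟙 m))
    where
    f≡𝟙 : ∀ m → coefficient f m ≡ 𝟙 m
    f≡𝟙 m = trans (cong (_/ 1) (f≗1 m)) (1ₛ≡𝟙 m)
  InverseProduct⇒Log {i ∷ _} {f} n≤J (divide {g = g} p q) = Log-divide i n≤J
    (λ m → trans (cong (_/ 1) (q m)) (trans (/1-+ (g m) (delay 0ℤ (suc i) f m))
      (cong (λ z → coefficient g m + z) (delay-coefficient (suc i) f m))))
    (InverseProduct⇒Log n≤J p)

  -- Evaluation of truncated series at a non-negative rational.

  module _ (x : ℚ) (0≤x : 0ℚ ≤ x) where

    truncated : ℕ → Sequence → ℚ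
    truncated n f = ∑ℚ n (λ m → f m * x ^ m)

    truncated-+ : ∀ n f g → truncated n (λ m → f m + g m) ≡ truncated n f + truncated n g
    truncated-+ n f g = trans (∑ℚ-cong n λ m _ → ℚ.*-distribʳ-+ (x ^ m) (f m) (g m)) (∑ℚ-+ n _ _)

    truncated-* : ∀ n c f → truncated n (λ m → c * f m) ≡ c * truncated n f
    truncated-* n c f = trans (∑ℚ-cong n λ m _ → ℚ.*-assoc c (f m) (x ^ m)) (∑ℚ-*ˡ n c _)

    -- The shift pushes the top coefficients beyond the cut, and these are non-negative.
    truncated-delay : ∀ w n {f} → (∀ m → 0ℚ ≤ f m) → truncated n (delayℚ w f) ≤ x ^ w * truncated n f
    truncated-delay zero    n       0≤f = ℚ.≤-reflexive (sym (ℚ.*-identityˡ _))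
    truncated-delay (suc w) zero    0≤f = ℚ.≤-reflexive (sym (ℚ.*-zeroʳ (x ^ suc w)))
    truncated-delay (suc w) (suc n) {f} 0≤f = begin
      truncated (suc n) (delayℚ (suc w) f)                   ≡⟨ ∑ℚ-suc n (λ m → delayℚ (suc w) f m * x ^ m) ⟩
      0ℚ * 1ℚ + ∑ℚ n (λ m → delayℚ w f m * (x * x ^ m))      ≡⟨ ℚ.+-identityˡ _ ⟩
      ∑ℚ n (λ m → delayℚ w f m * (x * x ^ m))                ≡⟨ ∑ℚ-cong n (λ m _ → solve 3 (λ a b c → a :* (b :* c) := b :* (a :* c)) refl (delayℚ w f m) x (x ^ m)) ⟩
      ∑ℚ n (λ m → x * (delayℚ w f m * x ^ m))                ≡⟨ ∑ℚ-*ˡ n x _ ⟩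
      x * truncated n (delayℚ w f)                           ≤⟨ ℚ.*-monoˡ-≤-nonNeg x {{ℚ.nonNegative 0≤x}} (truncated-delay w n 0≤f) ⟩
      x * (x ^ w * truncated n f)                            ≡⟨ sym (ℚ.*-assoc x (x ^ w) _) ⟩
      x ^ suc w * truncated n f                              ≤⟨ ℚ.*-monoˡ-≤-nonNeg (x ^ suc w) {{ℚ.nonNegative (0≤^ (suc w) 0≤x)}}
                                                                  (subst (_≤ truncated (suc n) f) (ℚ.+-identityʳ _)
                                                                    (ℚ.+-monoʳ-≤ (truncated n f) (0≤* (0≤f n) (0≤^ n 0≤x)))) ⟩
      x ^ suc w * truncated (suc n) f                        ∎
      where open ℚ.≤-Reasoning

    0≤evaluate : ∀ {U} → NonNegative U → 0ℚ ≤ evaluate U x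
    0≤evaluate []                            = ℚ.≤-refl
    0≤evaluate {(b , _) ∷ _} (0≤c ∷ 0≤U) = 0≤+ (0≤* 0≤c (0≤^ (suc b) 0≤x)) (0≤evaluate 0≤U)

    truncated-⊛ : ∀ n {U f} → NonNegative U → (∀ m → 0ℚ ≤ f m) → truncated n (U ⊛ f) ≤ evaluate U x * truncated n f
    truncated-⊛ n {f = f} [] 0≤f = ℚ.≤-reflexive (trans (∑ℚ-cong n (λ m _ → ℚ.*-zeroˡ (x ^ m))) (trans (∑ℚ-zero n) (sym (ℚ.*-zeroˡ (truncated n f)))))
    truncated-⊛ n {(b , c) ∷ U} {f} (0≤c ∷ 0≤U) 0≤f = begin
      truncated n (((b , c) ∷ U) ⊛ f)
        ≡⟨ truncated-+ n (λ m → c * delayℚ (suc b) f m) (U ⊛ f) ⟩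
      truncated n (λ m → c * delayℚ (suc b) f m) + truncated n (U ⊛ f)
        ≡⟨ cong (_+ truncated n (U ⊛ f)) (truncated-* n c (delayℚ (suc b) f)) ⟩
      c * truncated n (delayℚ (suc b) f) + truncated n (U ⊛ f)
        ≤⟨ ℚ.+-mono-≤ (ℚ.*-monoˡ-≤-nonNeg c {{ℚ.nonNegative 0≤c}} (truncated-delay (suc b) n 0≤f)) (truncated-⊛ n 0≤U 0≤f) ⟩
      c * (x ^ suc b * truncated n f) + evaluate U x * truncated n f
        ≡⟨ solve 4 (λ c p t e → c :* (p :* t) :+ e :* t := (c :* p :+ e) :* t) refl c (x ^ suc b) (truncated n f) (evaluate U x) ⟩
      evaluate ((b , c) ∷ U) x * truncated n f ∎
      where open ℚ.≤-Reasoning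

    truncated-power : ∀ n {U} k → NonNegative U → truncated n (power U k) ≤ evaluate U x ^ k
    truncated-power zero    zero 0≤U = 0≤⌜⌝ 1
    truncated-power (suc n) zero 0≤U = ℚ.≤-reflexive (trans (∑ℚ-suc n (λ m → 𝟙 m * x ^ m))
      (cong (λ z → 1ℚ * 1ℚ + z) (trans (∑ℚ-cong n (λ m _ → ℚ.*-zeroˡ (x ^ suc m))) (∑ℚ-zero n))))
    truncated-power n {U} (suc k) 0≤U = ℚ.≤-trans (truncated-⊛ n 0≤U (0≤power k 0≤U))
      (ℚ.*-monoˡ-≤-nonNeg (evaluate U x) {{ℚ.nonNegative (0≤evaluate 0≤U)}} (truncated-power n k 0≤U))

    truncated-expₚ : ∀ n {U} K → NonNegative U → truncated n (expₚ U K) ≤ expSum K (evaluate U x)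
    truncated-expₚ n zero    0≤U = ℚ.≤-reflexive (trans (∑ℚ-cong n (λ m _ → ℚ.*-zeroˡ (x ^ m))) (∑ℚ-zero n))
    truncated-expₚ n {U} (suc K) 0≤U = begin
      truncated n (λ m → expₚ U K m + 1/! K * power U K m)         ≡⟨ truncated-+ n (expₚ U K) (λ m → 1/! K * power U K m) ⟩
      truncated n (expₚ U K) + truncated n (λ m → 1/! K * power U K m)
        ≡⟨ cong (λ z → truncated n (expₚ U K) + z) (trans (truncated-* n (1/! K) (power U K)) (ℚ.*-comm (1/! K) _)) ⟩
      truncated n (expₚ U K) + truncated n (power U K) * 1/! K
        ≤⟨ ℚ.+-mono-≤ (truncated-expₚ n K 0≤U) (ℚ.*-monoʳ-≤-nonNeg (1/! K) {{ℚ.nonNegative (0≤1/! K)}} (truncated-power n K 0≤U)) ⟩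
      expSum (suc K) (evaluate U x) ∎
      where open ℚ.≤-Reasoning

    truncated-inverseProduct : ∀ {ws f} n → InverseProduct ws f →
      truncated (suc n) (coefficient f) ≤ expSum (suc n) (evaluate (logProduct ws n) x)
    truncated-inverseProduct {ws} n p = ℚ.≤-trans
      (ℚ.≤-reflexive (∑ℚ-cong (suc n) λ m m<1+n →
        cong (_* x ^ m) (Log⇒expₚ (InverseProduct⇒Log ℕ.≤-refl p) m (ℕ.≤-pred m<1+n))))
      (truncated-expₚ (suc n) (suc n) (0≤logProduct ws n))

  -- Positivity is read off from the exponential formula, all of whose ingredients are non-negative,
  -- with the cut placed at the coefficient in question.
  0≤coefficient : ∀ {ws f} → InverseProduct ws f → ∀ m → 0ℚ ≤ coefficient f m
  0≤coefficient {ws} p m = subst (0ℚ ≤_) (sym (Log⇒expₚ (InverseProduct⇒Log ℕ.≤-refl p) m ℕ.≤-refl))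
    (0≤expₚ (suc m) (0≤logProduct ws m) m)

  *-monoʳ : ∀ {p q} r → 0ℚ ≤ r → p ≤ q → r * p ≤ r * q
  *-monoʳ r 0≤r = ℚ.*-monoˡ-≤-nonNeg r {{ℚ.nonNegative 0≤r}}

  *-monoˡ : ∀ {p q} r → 0ℚ ≤ r → p ≤ q → p * r ≤ q * r
  *-monoˡ r 0≤r = ℚ.*-monoʳ-≤-nonNeg r {{ℚ.nonNegative 0≤r}}

  p≤p+q : ∀ {p q} → 0ℚ ≤ q → p ≤ p + q
  p≤p+q {p} {q} 0≤q = subst (_≤ p + q) (ℚ.+-identityʳ p) (ℚ.+-monoʳ-≤ p 0≤q)

  p≤q+p : ∀ {p q} → 0ℚ ≤ q → p ≤ q + p
  p≤q+p {p} {q} 0≤q = subst (p ≤_) (ℚ.+-comm p q) (p≤p+q 0≤q)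

  ⌜suc⌝*≤1⇒≤ : ∀ n {p} → ⌜ suc n ⌝ * p ≤ 1ℚ → p ≤ 1/1+ n
  ⌜suc⌝*≤1⇒≤ n {p} h = subst₂ _≤_
    (trans (sym (ℚ.*-assoc (1/1+ n) ⌜ suc n ⌝ p)) (trans (cong (_* p) (trans (ℚ.*-comm (1/1+ n) ⌜ suc n ⌝) (⌜⌝*1/ n))) (ℚ.*-identityˡ p)))
    (ℚ.*-identityʳ (1/1+ n)) (*-monoʳ (1/1+ n) (0≤1/1+ n) h)

  ∑ℚ-swap : ∀ m n (f : ℕ → ℕ → ℚ) → ∑ℚ m (λ i → ∑ℚ n (f i)) ≡ ∑ℚ n (λ j → ∑ℚ m (λ i → f i j))
  ∑ℚ-swap zero    n f = sym (∑ℚ-zero n)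
  ∑ℚ-swap (suc m) n f = trans (cong (_+ ∑ℚ n (f m)) (∑ℚ-swap m n f)) (sym (∑ℚ-+ n _ (f m)))

  -- Estimates at `x = 1 / (1 + s)`.

  ∑1/² : ℕ → ℚ
  ∑1/² J = ∑ℚ J (λ j → 1/1+ j * 1/1+ j)

  evaluate-++ : ∀ U V x → evaluate (U ++ V) x ≡ evaluate U x + evaluate V x
  evaluate-++ []            V x = sym (ℚ.+-identityˡ _)
  evaluate-++ ((b , c) ∷ U) V x = trans (cong (λ z → c * x ^ suc b + z) (evaluate-++ U V x))
    (sym (ℚ.+-assoc (c * x ^ suc b) (evaluate U x) (evaluate V x)))

  evaluate-logGeometric : ∀ i J x → evaluate (logGeometric i J) x ≡ ∑ℚ J (λ j → 1/1+ j * x ^ (suc j ℕ.* suc i))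
  evaluate-logGeometric i zero    x = refl
  evaluate-logGeometric i (suc J) x = trans (ℚ.+-comm _ (evaluate (logGeometric i J) x))
    (cong (_+ 1/1+ J * x ^ (suc J ℕ.* suc i)) (evaluate-logGeometric i J x))

  evaluate-replicate : ∀ e i ws J x →
    evaluate (logProduct (replicate e i ++ ws) J) x ≡ ⌜ e ⌝ * evaluate (logGeometric i J) x + evaluate (logProduct ws J) x
  evaluate-replicate zero    i ws J x = solve 2 (λ a b → b := con 0ℚ :* a :+ b) refl (evaluate (logGeometric i J) x) _
  evaluate-replicate (suc e) i ws J x = begin
    evaluate (logGeometric i J ++ logProduct (replicate e i ++ ws) J) x  ≡⟨ evaluate-++ (logGeometric i J) _ x ⟩
    g + evaluate (logProduct (replicate e i ++ ws) J) x                  ≡⟨ cong (λ z → g + z) (evaluate-replicate e i ws J x) ⟩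
    g + (⌜ e ⌝ * g + r)                                                  ≡⟨ solve 3 (λ g e r → g :+ (e :* g :+ r) := (con 1ℚ :+ e) :* g :+ r) refl g ⌜ e ⌝ r ⟩
    (1ℚ + ⌜ e ⌝) * g + r                                                 ≡⟨ cong (λ z → z * g + r) (sym (⌜suc⌝ e)) ⟩
    ⌜ suc e ⌝ * g + r                                                    ∎
    where
    open ≡-Reasoning
    g = evaluate (logGeometric i J) x
    r = evaluate (logProduct ws J) x

  evaluate-eulerWeights : ∀ d A J x → evaluate (logProduct (eulerWeights d A) J) x ≡
                          ⌜ d ⌝ * ∑ℚ A (λ i → ∑ℚ J (λ j → 1/1+ j * x ^ (suc j ℕ.* suc i)))
  evaluate-eulerWeights d zero    J x = sym (ℚ.*-zeroʳ ⌜ d ⌝)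
  evaluate-eulerWeights d (suc A) J x = trans (evaluate-replicate d A (eulerWeights d A) J x)
    (trans (cong₂ (λ s t → ⌜ d ⌝ * s + t) (evaluate-logGeometric A J x) (evaluate-eulerWeights d A J x))
    (solve 3 (λ d g r → d :* g :+ d :* r := d :* (r :+ g)) refl ⌜ d ⌝
      (∑ℚ J (λ j → 1/1+ j * x ^ (suc j ℕ.* suc A))) (∑ℚ A (λ i → ∑ℚ J (λ j → 1/1+ j * x ^ (suc j ℕ.* suc i))))))

  -- The geometric sum bounded without division. For `y = 1 / (1 + t)` the left side equals 1 for
  -- every `A`; the summand `y ^ A` is the invariant that lets the induction close.
  ∑-powers : ∀ t y A → 0ℚ ≤ y → y * (1ℚ + t) ≤ 1ℚ → t * ∑ℚ A (λ i → y ^ suc i) + y ^ A ≤ 1ℚ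
  ∑-powers t y zero    0≤y h = ℚ.≤-reflexive (trans (cong (_+ 1ℚ) (ℚ.*-zeroʳ t)) (ℚ.+-identityˡ 1ℚ))
  ∑-powers t y (suc A) 0≤y h = begin
    t * (S + y * y ^ A) + y * y ^ A      ≡⟨ solve 4 (λ t S y p → t :* (S :+ y :* p) :+ y :* p := t :* S :+ p :* (y :* (con 1ℚ :+ t))) refl t S y (y ^ A) ⟩
    t * S + y ^ A * (y * (1ℚ + t))       ≤⟨ ℚ.+-monoʳ-≤ (t * S) (*-monoʳ (y ^ A) (0≤^ A 0≤y) h) ⟩
    t * S + y ^ A * 1ℚ                   ≡⟨ cong (λ z → t * S + z) (ℚ.*-identityʳ (y ^ A)) ⟩
    t * S + y ^ A                        ≤⟨ ∑-powers t y A 0≤y h ⟩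
    1ℚ                                   ∎
    where
    open ℚ.≤-Reasoning
    S = ∑ℚ A (λ i → y ^ suc i)

  module _ (s x : ℚ) (0≤s : 0ℚ ≤ s) (0≤x : 0ℚ ≤ x) (x[1+s]≡1 : x * (1ℚ + s) ≡ 1ℚ) where
    open ℚ.≤-Reasoning

    -- Bernoulli's inequality `1 + k s ≤ (1 + s)^k` multiplied by `x^k`. The term `k s²` added in
    -- the induction completes `(1 + k s)(1 + s)`.
    bernoulli : ∀ k → x ^ k * (1ℚ + ⌜ k ⌝ * s) ≤ 1ℚ
    bernoulli zero    = ℚ.≤-reflexive (solve 1 (λ s → con 1ℚ :* (con 1ℚ :+ con 0ℚ :* s) := con 1ℚ) refl s)
    bernoulli (suc k) = begin
      x * x ^ k * (1ℚ + ⌜ suc k ⌝ * s)               ≡⟨ cong (λ z → x * x ^ k * (1ℚ + z * s)) (⌜suc⌝ k) ⟩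
      x * x ^ k * (1ℚ + (1ℚ + ⌜ k ⌝) * s)            ≤⟨ *-monoʳ (x * x ^ k) (0≤^ (suc k) 0≤x) (p≤p+q (0≤* (0≤* (0≤⌜⌝ k) 0≤s) 0≤s)) ⟩
      x * x ^ k * ((1ℚ + (1ℚ + ⌜ k ⌝) * s) + ⌜ k ⌝ * s * s)
        ≡⟨ solve 4 (λ x p k s → x :* p :* ((con 1ℚ :+ (con 1ℚ :+ k) :* s) :+ k :* s :* s) := (p :* (con 1ℚ :+ k :* s)) :* (x :* (con 1ℚ :+ s))) refl x (x ^ k) ⌜ k ⌝ s ⟩
      x ^ k * (1ℚ + ⌜ k ⌝ * s) * (x * (1ℚ + s))      ≡⟨ trans (cong (x ^ k * (1ℚ + ⌜ k ⌝ * s) *_) x[1+s]≡1) (ℚ.*-identityʳ _) ⟩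
      x ^ k * (1ℚ + ⌜ k ⌝ * s)                       ≤⟨ bernoulli k ⟩
      1ℚ                                             ∎

    -- `∑-powers` for `y = x^(j+1)` and `t = (j+1) s`, an admissible pair by `bernoulli`.
    ∑-powers-≤ : ∀ j A → s * ∑ℚ A (λ i → x ^ (suc j ℕ.* suc i)) ≤ 1/1+ j
    ∑-powers-≤ j A = ⌜suc⌝*≤1⇒≤ j (begin
      ⌜ suc j ⌝ * (s * ∑ℚ A (λ i → x ^ (suc j ℕ.* suc i)))
        ≡⟨ cong (λ z → ⌜ suc j ⌝ * (s * z)) (∑ℚ-cong A λ i _ → sym (^-assocʳ x (suc j) (suc i))) ⟩
      ⌜ suc j ⌝ * (s * S)                ≡⟨ sym (ℚ.*-assoc ⌜ suc j ⌝ s S) ⟩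
      ⌜ suc j ⌝ * s * S                  ≤⟨ p≤p+q (0≤^ A (0≤^ (suc j) 0≤x)) ⟩
      ⌜ suc j ⌝ * s * S + y ^ A          ≤⟨ ∑-powers (⌜ suc j ⌝ * s) y A (0≤^ (suc j) 0≤x) (bernoulli (suc j)) ⟩
      1ℚ                                 ∎)
      where
      y = x ^ suc j
      S = ∑ℚ A (λ i → y ^ suc i)

    -- Exchanging the sums collects, for each `j`, a geometric series worth at most `1/(j s)`;
    -- together with the coefficient `1/j` of the logarithm this gives `1/j²`.
    evaluate-≤ : ∀ d A J → s * evaluate (logProduct (eulerWeights d A) J) x ≤ ⌜ d ⌝ * ∑1/² J
    evaluate-≤ d A J = begin
      s * evaluate (logProduct (eulerWeights d A) J) x
        ≡⟨ cong (s *_) (trans (evaluate-eulerWeights d A J x) (cong (⌜ d ⌝ *_) (∑ℚ-swap A J (λ i j → 1/1+ j * x ^ (suc j ℕ.* suc i))))) ⟩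
      s * (⌜ d ⌝ * ∑ℚ J (λ j → ∑ℚ A (λ i → 1/1+ j * x ^ (suc j ℕ.* suc i))))
        ≡⟨ solve 3 (λ s d t → s :* (d :* t) := d :* (s :* t)) refl s ⌜ d ⌝ _ ⟩
      ⌜ d ⌝ * (s * ∑ℚ J (λ j → ∑ℚ A (λ i → 1/1+ j * x ^ (suc j ℕ.* suc i))))
        ≡⟨ cong (⌜ d ⌝ *_) (sym (∑ℚ-*ˡ J s _)) ⟩
      ⌜ d ⌝ * ∑ℚ J (λ j → s * ∑ℚ A (λ i → 1/1+ j * x ^ (suc j ℕ.* suc i)))
        ≤⟨ *-monoʳ ⌜ d ⌝ (0≤⌜⌝ d) (∑ℚ-mono J λ j _ → term j) ⟩
      ⌜ d ⌝ * ∑1/² J ∎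
      where
      term : ∀ j → s * ∑ℚ A (λ i → 1/1+ j * x ^ (suc j ℕ.* suc i)) ≤ 1/1+ j * 1/1+ j
      term j = begin
        s * ∑ℚ A (λ i → 1/1+ j * x ^ (suc j ℕ.* suc i))   ≡⟨ cong (s *_) (∑ℚ-*ˡ A (1/1+ j) _) ⟩
        s * (1/1+ j * ∑ℚ A (λ i → x ^ (suc j ℕ.* suc i))) ≡⟨ solve 3 (λ s r t → s :* (r :* t) := r :* (s :* t)) refl s (1/1+ j) _ ⟩
        1/1+ j * (s * ∑ℚ A (λ i → x ^ (suc j ℕ.* suc i))) ≤⟨ *-monoʳ (1/1+ j) (0≤1/1+ j) (∑-powers-≤ j A) ⟩
        1/1+ j * 1/1+ j                                   ∎

    1≤[1+s]^ : ∀ n → 1ℚ ≤ (1ℚ + s) ^ n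
    1≤[1+s]^ zero    = ℚ.≤-refl
    1≤[1+s]^ (suc n) = *-mono {1ℚ} {1ℚ + s} {1ℚ} {(1ℚ + s) ^ n} (0≤+ (0≤⌜⌝ 1) 0≤s) (0≤⌜⌝ 1) (p≤p+q 0≤s) (1≤[1+s]^ n)

    1≤[1+s]^*x^ : ∀ {m n} → m ℕ.≤ n → 1ℚ ≤ (1ℚ + s) ^ n * x ^ m
    1≤[1+s]^*x^ {zero}  {n}     z≤n       = subst (1ℚ ≤_) (sym (ℚ.*-identityʳ _)) (1≤[1+s]^ n)
    1≤[1+s]^*x^ {suc m} {suc n} (s≤s m≤n) = subst (1ℚ ≤_)
      (sym (trans (solve 4 (λ s p x q → (s :* p) :* (x :* q) := (x :* s) :* (p :* q)) refl (1ℚ + s) ((1ℚ + s) ^ n) x (x ^ m))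
        (trans (cong (_* ((1ℚ + s) ^ n * x ^ m)) x[1+s]≡1) (ℚ.*-identityˡ _))))
      (1≤[1+s]^*x^ m≤n)

    -- Rankin's trick: `(1 + s)^n x^m = (1 + s)^(n-m) ≥ 1` for every `m ≤ n`.
    ∑≤truncated : ∀ n {f} → (∀ m → 0ℚ ≤ f m) → ∑ℚ (suc n) f ≤ (1ℚ + s) ^ n * truncated x 0≤x (suc n) f
    ∑≤truncated n {f} 0≤f = ℚ.≤-trans (∑ℚ-mono (suc n) λ m m<1+n → begin
      f m                                ≡⟨ sym (ℚ.*-identityʳ (f m)) ⟩
      f m * 1ℚ                           ≤⟨ *-monoʳ (f m) (0≤f m) (1≤[1+s]^*x^ (ℕ.≤-pred m<1+n)) ⟩
      f m * ((1ℚ + s) ^ n * x ^ m)       ≡⟨ solve 3 (λ f p q → f :* (p :* q) := p :* (f :* q)) refl (f m) ((1ℚ + s) ^ n) (x ^ m) ⟩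
      (1ℚ + s) ^ n * (f m * x ^ m)       ∎)
      (ℚ.≤-reflexive (∑ℚ-*ˡ (suc n) ((1ℚ + s) ^ n) _))

  -- Inequalities between partial sums of the exponential series.

  expTerm-mono : ∀ k {p q} → 0ℚ ≤ p → p ≤ q → expTerm k p ≤ expTerm k q
  expTerm-mono zero    0≤p p≤q = ℚ.≤-refl
  expTerm-mono (suc k) {p} {q} 0≤p p≤q = subst₂ _≤_ (sym (expTerm-suc k p)) (sym (expTerm-suc k q))
    (*-monoˡ (1/1+ k) (0≤1/1+ k) (*-mono (ℚ.≤-trans 0≤p p≤q) (0≤expTerm k 0≤p) p≤q (expTerm-mono k 0≤p p≤q)))

  expSum-mono : ∀ n {p q} → 0ℚ ≤ p → p ≤ q → expSum n p ≤ expSum n q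
  expSum-mono n 0≤p p≤q = ∑ℚ-mono n λ k _ → expTerm-mono k 0≤p p≤q

  expSum-more : ∀ {m n q} → 0ℚ ≤ q → m ℕ.≤ n → expSum m q ≤ expSum n q
  expSum-more {m} {n} {q} 0≤q m≤n = subst (λ k → expSum m q ≤ expSum k q) (ℕ.m∸n+n≡m m≤n) (go (n ℕ.∸ m))
    where
    go : ∀ j → expSum m q ≤ expSum (j ℕ.+ m) q
    go zero    = ℚ.≤-refl
    go (suc j) = ℚ.≤-trans (go j) (p≤p+q (0≤expTerm (j ℕ.+ m) 0≤q))

  -- The first two terms of the binomial expansion of `(q + s)^(k+1) / (k+1)!`, the others being
  -- non-negative.
  expTerm-shift : ∀ k {q s} → 0ℚ ≤ q → 0ℚ ≤ s → expTerm (suc k) q + s * expTerm k q ≤ expTerm (suc k) (q + s)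
  expTerm-shift zero {q} {s} 0≤q 0≤s = ℚ.≤-reflexive (trans
    (cong (_+ s * expTerm 0 q) (expTerm-suc 0 q))
    (trans (solve 2 (λ q s → (q :* con 1ℚ) :* con 1ℚ :+ s :* con 1ℚ := ((q :+ s) :* con 1ℚ) :* con 1ℚ) refl q s)
           (sym (expTerm-suc 0 (q + s)))))
  expTerm-shift (suc k) {q} {s} 0≤q 0≤s = begin
    expTerm (suc (suc k)) q + s * u            ≡⟨ cong (_+ s * u) (expTerm-suc (suc k) q) ⟩
    q * u * r + s * u                          ≡⟨ cong (λ z → q * u * r + s * z) (sym (unit u)) ⟩
    q * u * r + s * (c * u * r)                ≡⟨ cong (λ z → q * u * r + s * (z * u * r)) (⌜suc⌝ (suc k)) ⟩
    q * u * r + s * ((1ℚ + ⌜ suc k ⌝) * u * r) ≡⟨ solve 5 (λ q u r s c → q :* u :* r :+ s :* ((con 1ℚ :+ c) :* u :* r) := ((q :+ s) :* u :+ s :* (c :* u)) :* r) refl q u r s ⌜ suc k ⌝ ⟩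
    ((q + s) * u + s * (⌜ suc k ⌝ * u)) * r    ≡⟨ cong (λ z → ((q + s) * u + s * z) * r) (sym (*-expDiff (suc k) q)) ⟩
    -- Adding `s² t` completes the product `(q + s)(u + s t)`.
    ((q + s) * u + s * (q * t)) * r            ≤⟨ *-monoˡ r (0≤1/1+ (suc k)) (p≤p+q {(q + s) * u + s * (q * t)} (0≤* (0≤* 0≤s 0≤s) (0≤expTerm k 0≤q))) ⟩
    ((q + s) * u + s * (q * t) + s * s * t) * r ≡⟨ solve 5 (λ q s u t r → ((q :+ s) :* u :+ s :* (q :* t) :+ s :* s :* t) :* r := ((q :+ s) :* (u :+ s :* t)) :* r) refl q s u t r ⟩
    (q + s) * (u + s * t) * r                  ≤⟨ *-monoˡ r (0≤1/1+ (suc k)) (*-monoʳ (q + s) (0≤+ 0≤q 0≤s) (expTerm-shift k 0≤q 0≤s)) ⟩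
    (q + s) * expTerm (suc k) (q + s) * r      ≡⟨ sym (expTerm-suc (suc k) (q + s)) ⟩
    expTerm (suc (suc k)) (q + s)              ∎
    where
    open ℚ.≤-Reasoning
    u = expTerm (suc k) q
    t = expTerm k q
    r = 1/1+ (suc k)
    c = ⌜ suc (suc k) ⌝
    unit : ∀ u → c * u * r ≡ u
    unit u = trans (solve 3 (λ c u r → c :* u :* r := (c :* r) :* u) refl c u r)
      (trans (cong (_* u) (⌜⌝*1/ (suc k))) (ℚ.*-identityˡ u))

  expSum-shift : ∀ N {q s} → 0ℚ ≤ q → 0ℚ ≤ s → (1ℚ + s) * expSum N q ≤ expSum (suc N) (q + s)
  expSum-shift N {q} {s} 0≤q 0≤s = begin
    (1ℚ + s) * expSum N q              ≡⟨ solve 2 (λ s e → (con 1ℚ :+ s) :* e := e :+ s :* e) refl s (expSum N q) ⟩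
    expSum N q + s * expSum N q        ≤⟨ ℚ.+-monoˡ-≤ (s * expSum N q) (p≤p+q {expSum N q} (0≤expTerm N 0≤q)) ⟩
    expSum (suc N) q + s * expSum N q  ≡⟨ cong₂ _+_ (∑ℚ-suc N (λ k → expTerm k q)) (sym (∑ℚ-*ˡ N s _)) ⟩
    (expTerm 0 q + ∑ℚ N (λ k → expTerm (suc k) q)) + ∑ℚ N (λ k → s * expTerm k q)
      ≡⟨ trans (ℚ.+-assoc (expTerm 0 q) (∑ℚ N (λ k → expTerm (suc k) q)) (∑ℚ N (λ k → s * expTerm k q)))
               (cong (λ z → expTerm 0 q + z) (sym (∑ℚ-+ N (λ k → expTerm (suc k) q) (λ k → s * expTerm k q)))) ⟩
    expTerm 0 q + ∑ℚ N (λ k → expTerm (suc k) q + s * expTerm k q)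
      ≤⟨ ℚ.+-monoʳ-≤ (expTerm 0 q) (∑ℚ-mono N λ k _ → expTerm-shift k 0≤q 0≤s) ⟩
    expTerm 0 q + ∑ℚ N (λ k → expTerm (suc k) (q + s))   ≡⟨ sym (∑ℚ-suc N (λ k → expTerm k (q + s))) ⟩
    expSum (suc N) (q + s)             ∎
    where open ℚ.≤-Reasoning

  expSum-shifts : ∀ n N {q s} → 0ℚ ≤ q → 0ℚ ≤ s → (1ℚ + s) ^ n * expSum N q ≤ expSum (n ℕ.+ N) (q + ⌜ n ⌝ * s)
  expSum-shifts zero    N {q} {s} 0≤q 0≤s = ℚ.≤-reflexive (trans (ℚ.*-identityˡ _)
    (cong (expSum N) (solve 2 (λ q s → q := q :+ con 0ℚ :* s) refl q s)))
  expSum-shifts (suc n) N {q} {s} 0≤q 0≤s = begin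
    (1ℚ + s) * (1ℚ + s) ^ n * expSum N q              ≡⟨ ℚ.*-assoc (1ℚ + s) ((1ℚ + s) ^ n) (expSum N q) ⟩
    (1ℚ + s) * ((1ℚ + s) ^ n * expSum N q)            ≤⟨ *-monoʳ (1ℚ + s) (0≤+ (0≤⌜⌝ 1) 0≤s) (expSum-shifts n N 0≤q 0≤s) ⟩
    (1ℚ + s) * expSum (n ℕ.+ N) (q + ⌜ n ⌝ * s)       ≤⟨ expSum-shift (n ℕ.+ N) (0≤+ 0≤q (0≤* (0≤⌜⌝ n) 0≤s)) 0≤s ⟩
    expSum (suc n ℕ.+ N) (q + ⌜ n ⌝ * s + s)          ≡⟨ cong (expSum (suc n ℕ.+ N)) (solve 3 (λ q n s → q :+ n :* s :+ s := q :+ (con 1ℚ :+ n) :* s) refl q ⌜ n ⌝ s) ⟩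
    expSum (suc n ℕ.+ N) (q + (1ℚ + ⌜ n ⌝) * s)       ≡⟨ cong (λ z → expSum (suc n ℕ.+ N) (q + z * s)) (sym (⌜suc⌝ n)) ⟩
    expSum (suc n ℕ.+ N) (q + ⌜ suc n ⌝ * s)          ∎
    where open ℚ.≤-Reasoning

  reciprocal : ∀ {p} → 0ℚ < p → ∃ λ q → 0ℚ ≤ q × q * p ≡ 1ℚ
  reciprocal {p} 0<p = ℚ.1/ p , ℚ.nonNegative⁻¹ (ℚ.1/ p) {{ℚ.pos⇒nonNeg (ℚ.1/ p) {{ℚ.1/pos⇒pos p}}}} , ℚ.*-inverseˡ p
    where
    instance
      _ = ℚ.positive 0<p
      _ = ℚ.pos⇒nonZero p

  -- Here `q` is any bound for `d ∑ 1/j² / s`, hence for the logarithm of the product at `x`. The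
  -- `n` factors `1 + s` lengthen the exponential sum by `n` terms and move its argument by `n s`.
  ∑coefficients-≤ : ∀ d n {s q} → 0ℚ < s → 0ℚ ≤ q → ⌜ d ⌝ * ∑1/² n ≤ s * q →
    ∑ℚ (suc n) (coefficient (partialProduct (eulerFactors d) n)) ≤ expSum (n ℕ.+ suc n) (q + ⌜ n ⌝ * s)
  ∑coefficients-≤ d n {s} {q} 0<s 0≤q h with reciprocal {1ℚ + s} (ℚ.<-≤-trans (0<1/1+ 0) (p≤p+q {1ℚ} (ℚ.<⇒≤ 0<s)))
  ... | x , 0≤x , x[1+s]≡1 = begin
    ∑ℚ (suc n) (coefficient f)                               ≤⟨ ∑≤truncated s x 0≤s 0≤x x[1+s]≡1 n (0≤coefficient p) ⟩
    (1ℚ + s) ^ n * truncated x 0≤x (suc n) (coefficient f)   ≤⟨ *-monoʳ ((1ℚ + s) ^ n) (0≤^ n (0≤+ (0≤⌜⌝ 1) 0≤s)) (truncated-inverseProduct x 0≤x n p) ⟩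
    (1ℚ + s) ^ n * expSum (suc n) E                          ≤⟨ *-monoʳ ((1ℚ + s) ^ n) (0≤^ n (0≤+ (0≤⌜⌝ 1) 0≤s)) (expSum-mono (suc n) (0≤evaluate x 0≤x (0≤logProduct (eulerWeights d n) n)) E≤q) ⟩
    (1ℚ + s) ^ n * expSum (suc n) q                          ≤⟨ expSum-shifts n (suc n) 0≤q 0≤s ⟩
    expSum (n ℕ.+ suc n) (q + ⌜ n ⌝ * s)                     ∎
    where
    open ℚ.≤-Reasoning
    f = partialProduct (eulerFactors d) n
    p = partialProduct-inverseProduct d n
    0≤s = ℚ.<⇒≤ 0<s
    E = evaluate (logProduct (eulerWeights d n) n) x
    E≤q : E ≤ q
    E≤q = ℚ.*-cancelˡ-≤-pos s {{ℚ.positive 0<s}} (ℚ.≤-trans (evaluate-≤ s x 0≤s 0≤x x[1+s]≡1 d n n) h)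

module Zeta where

  open Exponential
  open import Data.Nat.Base as ℕ using (ℕ; zero; suc; z≤n; s≤s)
  import Data.Nat.Properties as ℕ
  import Data.Nat.Solver as ℕSolver
  open import Data.Product.Base using (∃; _×_; _,_; proj₁; proj₂)
  open import Data.Rational.Base as ℚ using (ℚ; 0ℚ; 1ℚ; ½; ∣_∣; _≤_; _<_; _+_; _*_; _-_; -_)
  import Data.Rational.Properties as ℚ
  open import Data.Rational.Solver using (module +-*-Solver)
  open import Data.Sum.Base using (_⊎_; inj₁; inj₂)
  open import Relation.Binary.PropositionalEquality
  open import Algebra.Bundles using (CommutativeRing)
  open import Algebra.Definitions.RawSemiring ℚ.+-*-rawSemiring using (_^_)
  open import Algebra.Properties.Semiring.Exp (CommutativeRing.semiring ℚ.+-*-commutativeRing) using (^-homo-*)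
  open +-*-Solver using (solve; _:=_; _:+_; _:*_; _:-_; :-_; con)
  module ℕS = ℕSolver.+-*-Solver

  -- Rearranged and alternating sums.

  ∑ℚ-reverse : ∀ n f → ∑ℚ n (λ k → f (n ℕ.∸ suc k)) ≡ ∑ℚ n f
  ∑ℚ-reverse zero    f = refl
  ∑ℚ-reverse (suc n) f = trans (∑ℚ-suc n (λ k → f (n ℕ.∸ k)))
    (trans (cong (λ z → f n + z) (∑ℚ-reverse n f)) (ℚ.+-comm (f n) (∑ℚ n f)))

  ∑ℚ-++ : ∀ m n f → ∑ℚ (m ℕ.+ n) f ≡ ∑ℚ m f + ∑ℚ n (λ k → f (m ℕ.+ k))
  ∑ℚ-++ m zero    f = trans (cong (λ k → ∑ℚ k f) (ℕ.+-identityʳ m)) (sym (ℚ.+-identityʳ _))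
  ∑ℚ-++ m (suc n) f = trans (cong (λ k → ∑ℚ k f) (ℕ.+-suc m n))
    (trans (cong (_+ f (m ℕ.+ n)) (∑ℚ-++ m n f)) (ℚ.+-assoc (∑ℚ m f) _ _))

  ∑ℚ-more : ∀ {m n} f → (∀ k → 0ℚ ≤ f k) → m ℕ.≤ n → ∑ℚ m f ≤ ∑ℚ n f
  ∑ℚ-more {m} {n} f 0≤f m≤n = subst (λ k → ∑ℚ m f ≤ ∑ℚ k f) (ℕ.m+[n∸m]≡n m≤n)
    (subst (∑ℚ m f ≤_) (sym (∑ℚ-++ m (n ℕ.∸ m) f)) (p≤p+q (0≤∑ℚ (n ℕ.∸ m) λ k _ → 0≤f (m ℕ.+ k))))

  Eventually : (ℕ → Set) → Set
  Eventually P = ∃ λ K → ∀ k → K ℕ.≤ k → P k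

  zipWith : ∀ {P Q R : ℕ → Set} → (∀ k → P k → Q k → R k) → Eventually P → Eventually Q → Eventually R
  zipWith f (A , p) (B , q) = A ℕ.⊔ B , λ k A⊔B≤k →
    f k (p k (ℕ.≤-trans (ℕ.m≤m⊔n A B) A⊔B≤k)) (q k (ℕ.≤-trans (ℕ.m≤n⊔m A B) A⊔B≤k))

  from : ∀ n → Eventually (n ℕ.≤_)
  from n = n , λ k n≤k → n≤k

  sgn : ℕ → ℚ
  sgn n = (- 1ℚ) ^ n

  sgn² : ∀ n → sgn n * sgn n ≡ 1ℚ
  sgn² zero    = refl
  sgn² (suc n) = trans (solve 1 (λ s → (con (- 1ℚ) :* s) :* (con (- 1ℚ) :* s) := s :* s) refl (sgn n)) (sgn² n)

  ∣sgn∣ : ∀ n → ∣ sgn n ∣ ≡ 1ℚ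
  ∣sgn∣ zero    = refl
  ∣sgn∣ (suc n) = trans (ℚ.∣p*q∣≡∣p∣*∣q∣ (- 1ℚ) (sgn n)) (trans (ℚ.*-identityˡ ∣ sgn n ∣) (∣sgn∣ n))

  sgn-∸ : ∀ {m n} → n ℕ.≤ m → sgn (m ℕ.∸ n) ≡ sgn m * sgn n
  sgn-∸ {m} {n} n≤m = begin
    sgn (m ℕ.∸ n)                          ≡⟨ sym (ℚ.*-identityʳ _) ⟩
    sgn (m ℕ.∸ n) * 1ℚ                     ≡⟨ cong (sgn (m ℕ.∸ n) *_) (sym (sgn² n)) ⟩
    sgn (m ℕ.∸ n) * (sgn n * sgn n)        ≡⟨ sym (ℚ.*-assoc (sgn (m ℕ.∸ n)) (sgn n) (sgn n)) ⟩
    sgn (m ℕ.∸ n) * sgn n * sgn n          ≡⟨ cong (_* sgn n) (trans (sym (^-homo-* (- 1ℚ) (m ℕ.∸ n) n)) (cong sgn (ℕ.m∸n+n≡m n≤m))) ⟩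
    sgn m * sgn n                          ∎
    where open ≡-Reasoning

  1/1+-anti : ∀ m n → m ℕ.≤ n → 1/1+ n ≤ 1/1+ m
  1/1+-anti m n m≤n = ⌜suc⌝*≤1⇒≤ m (subst (⌜ suc m ⌝ * 1/1+ n ≤_) (⌜⌝*1/ n) (*-monoˡ (1/1+ n) (0≤1/1+ n) (⌜⌝-mono (s≤s m≤n))))

  -- Splitting off the first term leaves `v 0 - S`, with `S` the alternating sum of the shifted
  -- sequence and `0 ≤ S ≤ v 1 ≤ v 0`.
  alternating : ∀ l v → (∀ i → 0ℚ ≤ v i) → (∀ i → v (suc i) ≤ v i) →
                0ℚ ≤ ∑ℚ l (λ i → sgn i * v i) × ∑ℚ l (λ i → sgn i * v i) ≤ v 0
  alternating zero    v 0≤v v↓ = ℚ.≤-refl , 0≤v 0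
  alternating (suc l) v 0≤v v↓ with alternating l (λ i → v (suc i)) (λ i → 0≤v (suc i)) (λ i → v↓ (suc i))
  ... | 0≤S , S≤v1 = subst (λ z → 0ℚ ≤ z × z ≤ v 0) (sym unfold)
    ( subst (_≤ v 0 - S) (ℚ.+-inverseʳ S) (ℚ.+-monoˡ-≤ (- S) (ℚ.≤-trans S≤v1 (v↓ 0)))
    , subst (v 0 - S ≤_) (ℚ.+-identityʳ (v 0)) (ℚ.+-monoʳ-≤ (v 0) (ℚ.neg-antimono-≤ 0≤S)))
    where
    S = ∑ℚ l (λ i → sgn i * v (suc i))
    unfold : ∑ℚ (suc l) (λ i → sgn i * v i) ≡ v 0 - S
    unfold = trans (∑ℚ-suc l (λ i → sgn i * v i)) (cong₂ _+_ (ℚ.*-identityˡ (v 0))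
      (trans (∑ℚ-cong l λ i _ → ℚ.*-assoc (- 1ℚ) (sgn i) (v (suc i)))
      (trans (∑ℚ-*ˡ l (- 1ℚ) _) (solve 1 (λ s → con (- 1ℚ) :* s := :- s) refl S))))

  altTerm : ℕ → ℚ
  altTerm j = sgn (suc j) * 1/1+ j

  altHarmonic : ℕ → ℚ
  altHarmonic n = ∑ℚ n altTerm

  -- The sign of the first term of the tail depends on the parity of `p`, so the bound passes
  -- through the absolute value.
  altHarmonic-tail : ∀ p l → altHarmonic (p ℕ.+ l) - altHarmonic p ≤ 1/1+ p
  altHarmonic-tail p l = begin
    altHarmonic (p ℕ.+ l) - altHarmonic p                  ≡⟨ cong (_- altHarmonic p) (∑ℚ-++ p l altTerm) ⟩
    (altHarmonic p + ∑ℚ l (λ i → altTerm (p ℕ.+ i))) - altHarmonic p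
      ≡⟨ solve 2 (λ a b → (a :+ b) :- a := b) refl (altHarmonic p) (∑ℚ l (λ i → altTerm (p ℕ.+ i))) ⟩
    ∑ℚ l (λ i → altTerm (p ℕ.+ i))                         ≡⟨ ∑ℚ-cong l (λ i _ → trans (cong (_* v i) (^-homo-* (- 1ℚ) (suc p) i)) (ℚ.*-assoc (sgn (suc p)) (sgn i) (v i))) ⟩
    ∑ℚ l (λ i → sgn (suc p) * (sgn i * v i))               ≡⟨ ∑ℚ-*ˡ l (sgn (suc p)) _ ⟩
    sgn (suc p) * S                                        ≤⟨ p≤∣p∣ (sgn (suc p) * S) ⟩
    ∣ sgn (suc p) * S ∣                                    ≡⟨ trans (ℚ.∣p*q∣≡∣p∣*∣q∣ (sgn (suc p)) S) (trans (cong (_* ∣ S ∣) (∣sgn∣ (suc p))) (ℚ.*-identityˡ ∣ S ∣)) ⟩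
    ∣ S ∣                                                  ≡⟨ ℚ.0≤p⇒∣p∣≡p (proj₁ bounds) ⟩
    S                                                      ≤⟨ proj₂ bounds ⟩
    1/1+ (p ℕ.+ 0)                                         ≡⟨ cong 1/1+ (ℕ.+-identityʳ p) ⟩
    1/1+ p                                                 ∎
    where
    open ℚ.≤-Reasoning
    v : ℕ → ℚ
    v i = 1/1+ (p ℕ.+ i)
    S = ∑ℚ l (λ i → sgn i * v i)
    bounds = alternating l v (λ i → 0≤1/1+ (p ℕ.+ i)) (λ i → 1/1+-anti (p ℕ.+ i) (p ℕ.+ suc i) (ℕ.+-monoʳ-≤ p (ℕ.n≤1+n i)))

  -- The square of Leibniz' partial sums.

  ∑odd1/² : ℕ → ℚ
  ∑odd1/² n = ∑ℚ n (λ k → 1/1+ (2 ℕ.* k) * 1/1+ (2 ℕ.* k))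

  -- ∑_{j = N - n}^{N + n} (-1)^j / j, for n < N
  window : ℕ → ℕ → ℚ
  window N n = altHarmonic (N ℕ.+ n) - altHarmonic (N ℕ.∸ suc n)

  -- In the square of the two-sided sum over `k` and `l`, partial fractions turn the off-diagonal
  -- part into `1/(2k+1)` times `∑ (-1)^j / j` over `j = l - k ≠ 0`. There `j` and `-j` cancel,
  -- except on the window `N - n ≤ |j| ≤ N + n` for `k = n` or `k = -1 - n`. The total is `-2` times
  -- this sum.
  remainder : ℕ → ℚ
  remainder N = ∑ℚ N (λ n → window N n * 1/1+ (2 ℕ.* n))

  suc-∸ : ∀ {n N} → n ℕ.< N → suc (N ℕ.∸ suc n) ≡ N ℕ.∸ n
  suc-∸ {n} {N} n<N = sym (ℕ.+-∸-assoc 1 n<N)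

  -- With `B = N - n`, `C = N + n + 1` and `X = 2n + 1` one has `B + C = 2N + 1` and `C = B + X`. So
  -- `(1/B + 1/C)(B + C) = 2 + C/B + B/C = 4 + X/B - X/C`, and dividing by `X` gives the claim.
  partialFraction : ∀ {n N} → n ℕ.< N → let a = 1/1+ (2 ℕ.* n) ; b = 1/1+ (N ℕ.∸ suc n) ; c = 1/1+ (N ℕ.+ n) in
    (b + c) * a ≡ 1/1+ (2 ℕ.* N) * (⌜ 4 ⌝ * a + (b - c))
  partialFraction {n} {N} n<N = lemma ⌜ suc k ⌝ ⌜ suc (N ℕ.+ n) ⌝ ⌜ suc (2 ℕ.* n) ⌝ ⌜ suc (2 ℕ.* N) ⌝ _ _ _ _
    (⌜⌝*1/ k) (⌜⌝*1/ (N ℕ.+ n)) (⌜⌝*1/ (2 ℕ.* n)) (⌜⌝*1/ (2 ℕ.* N))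
    (trans (cong ⌜_⌝ B+C) (⌜⌝-+ (suc k) (suc (N ℕ.+ n))))
    (trans (cong ⌜_⌝ B+X) (⌜⌝-+ (suc k) (suc (2 ℕ.* n))))
    where
    k = N ℕ.∸ suc n
    B+C : suc (2 ℕ.* N) ≡ suc k ℕ.+ suc (N ℕ.+ n)
    B+C = subst (λ M → suc (2 ℕ.* M) ≡ suc k ℕ.+ suc (M ℕ.+ n)) (ℕ.m∸n+n≡m n<N)
      (ℕS.solve 2 (λ k n → ℕS.con 1 ℕS.:+ ℕS.con 2 ℕS.:* (k ℕS.:+ (ℕS.con 1 ℕS.:+ n))
        ℕS.:= ℕS.con 1 ℕS.:+ k ℕS.:+ (ℕS.con 1 ℕS.:+ (k ℕS.:+ (ℕS.con 1 ℕS.:+ n) ℕS.:+ n))) refl k n)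
    B+X : suc (N ℕ.+ n) ≡ suc k ℕ.+ suc (2 ℕ.* n)
    B+X = subst (λ M → suc (M ℕ.+ n) ≡ suc k ℕ.+ suc (2 ℕ.* n)) (ℕ.m∸n+n≡m n<N)
      (ℕS.solve 2 (λ k n → ℕS.con 1 ℕS.:+ (k ℕS.:+ (ℕS.con 1 ℕS.:+ n) ℕS.:+ n)
        ℕS.:= ℕS.con 1 ℕS.:+ k ℕS.:+ (ℕS.con 1 ℕS.:+ ℕS.con 2 ℕS.:* n)) refl k n)
    lemma : ∀ B C X M a b c m → B * b ≡ 1ℚ → C * c ≡ 1ℚ → X * a ≡ 1ℚ → M * m ≡ 1ℚ → M ≡ B + C → C ≡ B + X →
            (b + c) * a ≡ m * (⌜ 4 ⌝ * a + (b - c))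
    lemma B .(B + X) X .(B + (B + X)) a b c m Bb Cc Xa Mm refl refl = begin
      (b + c) * a                                       ≡⟨ sym (ℚ.*-identityˡ _) ⟩
      1ℚ * ((b + c) * a)                                ≡⟨ cong (_* ((b + c) * a)) (sym Mm) ⟩
      (B + (B + X)) * m * ((b + c) * a)
        ≡⟨ solve 6 (λ B X a b c m → (B :+ (B :+ X)) :* m :* ((b :+ c) :* a) :=
                     m :* (((B :* b) :* a :+ (B :* b) :* a) :+ (X :* a) :* b :+ (((B :+ X) :* c) :* a :+ ((B :+ X) :* c) :* a) :- (X :* a) :* c))
                 refl B X a b c m ⟩
      m * (((B * b) * a + (B * b) * a) + (X * a) * b + (((B + X) * c) * a + ((B + X) * c) * a) - (X * a) * c)
        ≡⟨ cong₂ (λ s t → m * ((s * a + s * a) + (X * a) * b + (t * a + t * a) - (X * a) * c)) Bb Cc ⟩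
      m * ((1ℚ * a + 1ℚ * a) + (X * a) * b + (1ℚ * a + 1ℚ * a) - (X * a) * c)
        ≡⟨ cong (λ s → m * ((1ℚ * a + 1ℚ * a) + s * b + (1ℚ * a + 1ℚ * a) - s * c)) Xa ⟩
      m * ((1ℚ * a + 1ℚ * a) + 1ℚ * b + (1ℚ * a + 1ℚ * a) - 1ℚ * c)
        ≡⟨ solve 4 (λ a b c m → m :* ((con 1ℚ :* a :+ con 1ℚ :* a) :+ con 1ℚ :* b :+ (con 1ℚ :* a :+ con 1ℚ :* a) :- con 1ℚ :* c) :=
                     m :* (con ⌜ 4 ⌝ :* a :+ (b :- c))) refl a b c m ⟩
      m * (⌜ 4 ⌝ * a + (b - c))                         ∎
      where open ≡-Reasoning

  -- Passing from `N` to `N + 1`, the window loses the index `N - n` and gains `N + n + 1`. The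
  -- indices have opposite parity, so the change is `-(-1)^(N+n)` times the sum `b + c` of
  -- `partialFraction`.
  window-suc : ∀ {n N} → n ℕ.< N →
    window (suc N) n * 1/1+ (2 ℕ.* n) ≡
    window N n * 1/1+ (2 ℕ.* n) - 1/1+ (2 ℕ.* N) * (⌜ 4 ⌝ * sgn N * (sgn n * 1/1+ (2 ℕ.* n)) + (altTerm (N ℕ.∸ suc n) + altTerm (N ℕ.+ n)))
  window-suc {n} {N} n<N = begin
    (p + altTerm (N ℕ.+ n) - altHarmonic (N ℕ.∸ n)) * a
      ≡⟨ cong (λ j → (p + altTerm (N ℕ.+ n) - altHarmonic j) * a) (sym (suc-∸ n<N)) ⟩
    (p + altTerm (N ℕ.+ n) - (q + altTerm (N ℕ.∸ suc n))) * a
      ≡⟨ cong₂ (λ s t → (p + s - (q + t)) * a) sc tb ⟩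
    (p + - (στ * c) - (q + στ * b)) * a
      ≡⟨ solve 6 (λ p q a b c s → (p :+ :- (s :* c) :- (q :+ s :* b)) :* a := (p :- q) :* a :- s :* ((b :+ c) :* a)) refl p q a b c στ ⟩
    (p - q) * a - στ * ((b + c) * a)
      ≡⟨ cong (λ z → (p - q) * a - στ * z) (partialFraction n<N) ⟩
    (p - q) * a - στ * (m * (⌜ 4 ⌝ * a + (b - c)))
      ≡⟨ solve 7 (λ w a b c m s t → w :- (s :* t) :* (m :* (con ⌜ 4 ⌝ :* a :+ (b :- c))) :=
                   w :- m :* (con ⌜ 4 ⌝ :* s :* (t :* a) :+ ((s :* t) :* b :+ :- ((s :* t) :* c)))) refl ((p - q) * a) a b c m (sgn N) (sgn n) ⟩
    (p - q) * a - m * (⌜ 4 ⌝ * sgn N * (sgn n * a) + (στ * b + - (στ * c)))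
      ≡⟨ cong₂ (λ s t → (p - q) * a - m * (⌜ 4 ⌝ * sgn N * (sgn n * a) + (t + s))) (sym sc) (sym tb) ⟩
    (p - q) * a - m * (⌜ 4 ⌝ * sgn N * (sgn n * a) + (altTerm (N ℕ.∸ suc n) + altTerm (N ℕ.+ n))) ∎
    where
    open ≡-Reasoning
    a = 1/1+ (2 ℕ.* n)
    b = 1/1+ (N ℕ.∸ suc n)
    c = 1/1+ (N ℕ.+ n)
    m = 1/1+ (2 ℕ.* N)
    p = altHarmonic (N ℕ.+ n)
    q = altHarmonic (N ℕ.∸ suc n)
    στ = sgn N * sgn n
    sc : altTerm (N ℕ.+ n) ≡ - (στ * c)
    sc = trans (cong (λ z → - 1ℚ * z * c) (^-homo-* (- 1ℚ) N n))
      (solve 2 (λ s c → con (- 1ℚ) :* s :* c := :- (s :* c)) refl στ c)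
    tb : altTerm (N ℕ.∸ suc n) ≡ στ * b
    tb = cong (_* b) (trans (cong sgn (suc-∸ n<N)) (sgn-∸ (ℕ.<⇒≤ n<N)))

  -- Summed over `n < N`, the terms at `N - n - 1` and `N + n` fill up the alternating sum `A` of
  -- length `2N`. The new summand `n = N` contributes `(A - m) m`, so `A` cancels.
  remainder-suc : ∀ N → let L = leibniz N ; m = 1/1+ (2 ℕ.* N) in
    remainder (suc N) ≡ remainder N - ⌜ 4 ⌝ * (L * (sgn N * m)) - m * m
  remainder-suc N = begin
    ∑ℚ N (λ n → window (suc N) n * 1/1+ (2 ℕ.* n)) + window (suc N) N * m
      ≡⟨ cong₂ _+_ (trans (∑ℚ-cong N (λ n n<N → window-suc n<N)) split) last ⟩
    (remainder N - m * (⌜ 4 ⌝ * sgn N * L + A)) + (A + - m) * m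
      ≡⟨ solve 5 (λ r m s L A → (r :- m :* (con ⌜ 4 ⌝ :* s :* L :+ A)) :+ (A :+ :- m) :* m := r :- con ⌜ 4 ⌝ :* (L :* (s :* m)) :- m :* m) refl (remainder N) m (sgn N) L A ⟩
    remainder N - ⌜ 4 ⌝ * (L * (sgn N * m)) - m * m ∎
    where
    open ≡-Reasoning
    m = 1/1+ (2 ℕ.* N)
    L = leibniz N
    A = altHarmonic (N ℕ.+ N)
    f g : ℕ → ℚ
    f n = ⌜ 4 ⌝ * sgn N * (sgn n * 1/1+ (2 ℕ.* n))
    g n = altTerm (N ℕ.∸ suc n) + altTerm (N ℕ.+ n)
    split : ∑ℚ N (λ n → window N n * 1/1+ (2 ℕ.* n) - m * (f n + g n)) ≡ remainder N - m * (⌜ 4 ⌝ * sgn N * L + A)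
    split = begin
      ∑ℚ N (λ n → window N n * 1/1+ (2 ℕ.* n) - m * (f n + g n))
        ≡⟨ ∑ℚ-cong N (λ n _ → cong (λ z → window N n * 1/1+ (2 ℕ.* n) + z) (ℚ.neg-distribˡ-* m (f n + g n))) ⟩
      ∑ℚ N (λ n → window N n * 1/1+ (2 ℕ.* n) + (- m) * (f n + g n))
        ≡⟨ ∑ℚ-+ N (λ n → window N n * 1/1+ (2 ℕ.* n)) _ ⟩
      remainder N + ∑ℚ N (λ n → (- m) * (f n + g n))
        ≡⟨ cong (λ z → remainder N + z) (trans (∑ℚ-*ˡ N (- m) _) (cong (- m *_) (∑ℚ-+ N f g))) ⟩
      remainder N + (- m) * (∑ℚ N f + ∑ℚ N g)
        ≡⟨ cong₂ (λ s t → remainder N + (- m) * (s + t)) (∑ℚ-*ˡ N (⌜ 4 ⌝ * sgn N) _) ∑g ⟩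
      remainder N + (- m) * (⌜ 4 ⌝ * sgn N * L + A)
        ≡⟨ cong (λ z → remainder N + z) (sym (ℚ.neg-distribˡ-* m _)) ⟩
      remainder N - m * (⌜ 4 ⌝ * sgn N * L + A) ∎
      where
      ∑g : ∑ℚ N g ≡ A
      ∑g = trans (∑ℚ-+ N (λ n → altTerm (N ℕ.∸ suc n)) (λ n → altTerm (N ℕ.+ n)))
        (trans (cong (_+ ∑ℚ N (λ n → altTerm (N ℕ.+ n))) (∑ℚ-reverse N altTerm)) (sym (∑ℚ-++ N N altTerm)))
    last : window (suc N) N * m ≡ (A + - m) * m
    last = cong (_* m) (begin
      (A + altTerm (N ℕ.+ N)) - altHarmonic (N ℕ.∸ N)
        ≡⟨ cong₂ (λ s j → (A + s) - altHarmonic j) evenTerm (ℕ.n∸n≡0 N) ⟩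
      (A + - m) - 0ℚ
        ≡⟨ ℚ.+-identityʳ _ ⟩
      A + - m ∎)
      where
      evenTerm : altTerm (N ℕ.+ N) ≡ - m
      evenTerm = trans
        (cong₂ (λ s t → - 1ℚ * s * t) (trans (^-homo-* (- 1ℚ) N N) (sgn² N)) (cong (λ j → 1/1+ (N ℕ.+ j)) (sym (ℕ.+-identityʳ N))))
        (solve 1 (λ m → con (- 1ℚ) :* con 1ℚ :* m := :- m) refl m)

  -- Squaring the two-sided series ∑_{k = -N}^{N - 1} (-1)^k / (2k + 1) = 2 leibniz N,
  -- the off-diagonal terms add up to the remainder.
  ∑odd1/²≡ : ∀ N → ∑odd1/² N ≡ leibniz N * leibniz N + leibniz N * leibniz N + remainder N
  ∑odd1/²≡ zero    = refl
  ∑odd1/²≡ (suc N) = begin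
    ∑odd1/² N + m * m                                  ≡⟨ cong (_+ m * m) (∑odd1/²≡ N) ⟩
    (L * L + L * L + r) + m * m                        ≡⟨ lemma L r m s (sgn² N) ⟩
    (L + s * m) * (L + s * m) + (L + s * m) * (L + s * m) + (r - ⌜ 4 ⌝ * (L * (s * m)) - m * m)
      ≡⟨ cong (λ z → (L + s * m) * (L + s * m) + (L + s * m) * (L + s * m) + z) (sym (remainder-suc N)) ⟩
    (L + s * m) * (L + s * m) + (L + s * m) * (L + s * m) + remainder (suc N) ∎
    where
    open ≡-Reasoning
    L = leibniz N
    m = 1/1+ (2 ℕ.* N)
    r = remainder N
    s = sgn N
    lemma : ∀ L r m s → s * s ≡ 1ℚ → (L * L + L * L + r) + m * m ≡
            (L + s * m) * (L + s * m) + (L + s * m) * (L + s * m) + (r - ⌜ 4 ⌝ * (L * (s * m)) - m * m)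
    lemma L r m s ss = trans
      (solve 3 (λ L r m → (L :* L :+ L :* L :+ r) :+ m :* m := (L :* L :+ L :* L :+ r) :+ ((con 1ℚ :+ con 1ℚ) :* (m :* m) :- m :* m)) refl L r m)
      (trans (cong (λ z → (L * L + L * L + r) + ((z + z) * (m * m) - m * m)) (sym ss))
        (solve 4 (λ L r m s → (L :* L :+ L :* L :+ r) :+ ((s :* s :+ s :* s) :* (m :* m) :- m :* m) :=
          (L :+ s :* m) :* (L :+ s :* m) :+ (L :+ s :* m) :* (L :+ s :* m) :+ (r :- con ⌜ 4 ⌝ :* (L :* (s :* m)) :- m :* m)) refl L r m s))

  -- Decay of the remainder.

  harmonic : ℕ → ℚ
  harmonic n = ∑ℚ n 1/1+

  -- The first `k` terms are at most 1, the others at most `1/(k+1)`. With `k` free this yields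
  -- `H_n / n → 0` by rational means.
  harmonic-≤ : ∀ k n → harmonic n ≤ ⌜ k ⌝ + ⌜ n ⌝ * 1/1+ k
  harmonic-≤ k zero    = 0≤+ (0≤⌜⌝ k) (0≤* (0≤⌜⌝ 0) (0≤1/1+ k))
  harmonic-≤ k (suc n) with ℕ.≤-total k n
  ... | inj₁ k≤n = begin
    harmonic n + 1/1+ n                           ≤⟨ ℚ.+-mono-≤ (harmonic-≤ k n) (1/1+-anti k n k≤n) ⟩
    (⌜ k ⌝ + ⌜ n ⌝ * 1/1+ k) + 1/1+ k             ≡⟨ solve 3 (λ k n r → (k :+ n :* r) :+ r := k :+ (con 1ℚ :+ n) :* r) refl ⌜ k ⌝ ⌜ n ⌝ (1/1+ k) ⟩
    ⌜ k ⌝ + (1ℚ + ⌜ n ⌝) * 1/1+ k                 ≡⟨ cong (λ z → ⌜ k ⌝ + z * 1/1+ k) (sym (⌜suc⌝ n)) ⟩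
    ⌜ k ⌝ + ⌜ suc n ⌝ * 1/1+ k                    ∎
    where open ℚ.≤-Reasoning
  ... | inj₂ n≤k = begin
    harmonic n + 1/1+ n                           ≤⟨ ℚ.+-mono-≤ (≤n n) (1/1+-anti 0 n z≤n) ⟩
    ⌜ n ⌝ + 1ℚ                                    ≤⟨ main (ℕ.m≤n⇒m<n∨m≡n n≤k) ⟩
    ⌜ k ⌝ + ⌜ suc n ⌝ * 1/1+ k                    ∎
    where
    open ℚ.≤-Reasoning
    ≤n : ∀ n → harmonic n ≤ ⌜ n ⌝
    ≤n zero    = ℚ.≤-refl
    ≤n (suc n) = subst (harmonic (suc n) ≤_) (trans (ℚ.+-comm ⌜ n ⌝ 1ℚ) (sym (⌜suc⌝ n))) (ℚ.+-mono-≤ (≤n n) (1/1+-anti 0 n z≤n))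
    main : (n ℕ.< k) ⊎ (n ≡ k) → ⌜ n ⌝ + 1ℚ ≤ ⌜ k ⌝ + ⌜ suc n ⌝ * 1/1+ k
    main (inj₁ n<k) = ℚ.≤-trans (ℚ.≤-reflexive (trans (ℚ.+-comm ⌜ n ⌝ 1ℚ) (sym (⌜suc⌝ n))))
      (ℚ.≤-trans (⌜⌝-mono n<k) (p≤p+q (0≤* (0≤⌜⌝ (suc n)) (0≤1/1+ k))))
    main (inj₂ refl) = ℚ.≤-reflexive (cong (λ z → ⌜ n ⌝ + z) (sym (⌜⌝*1/ n)))

  -- Partial fractions: the denominators `N - n` and `n + 1` add up to `N + 1`.
  1/1+-*-1/1+ : ∀ {n N} → n ℕ.< N → 1/1+ (N ℕ.∸ suc n) * 1/1+ n ≡ 1/1+ N * (1/1+ (N ℕ.∸ suc n) + 1/1+ n)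
  1/1+-*-1/1+ {n} {N} n<N = lemma ⌜ suc (N ℕ.∸ suc n) ⌝ ⌜ suc n ⌝ ⌜ suc N ⌝ _ _ _ (⌜⌝*1/ (N ℕ.∸ suc n)) (⌜⌝*1/ n) (⌜⌝*1/ N)
    (trans (cong ⌜_⌝ (cong suc (sym (ℕ.m∸n+n≡m n<N)))) (⌜⌝-+ (suc (N ℕ.∸ suc n)) (suc n)))
    where
    open ≡-Reasoning
    lemma : ∀ B E M b e m → B * b ≡ 1ℚ → E * e ≡ 1ℚ → M * m ≡ 1ℚ → M ≡ B + E → b * e ≡ m * (b + e)
    lemma B E .(B + E) b e m Bb Ee Mm refl = begin
      b * e                              ≡⟨ sym (ℚ.*-identityˡ _) ⟩
      1ℚ * (b * e)                       ≡⟨ cong (_* (b * e)) (sym Mm) ⟩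
      (B + E) * m * (b * e)              ≡⟨ solve 5 (λ B E b e m → (B :+ E) :* m :* (b :* e) := m :* ((E :* e) :* b :+ (B :* b) :* e)) refl B E b e m ⟩
      m * ((E * e) * b + (B * b) * e)    ≡⟨ cong₂ (λ s t → m * (s * b + t * e)) Ee Bb ⟩
      m * (1ℚ * b + 1ℚ * e)              ≡⟨ cong₂ (λ s t → m * (s + t)) (ℚ.*-identityˡ b) (ℚ.*-identityˡ e) ⟩
      m * (b + e)                        ∎

  -- The window is at most its first denominator's reciprocal `1/(N-n)`. Weakening `2n + 1` to
  -- `n + 1` makes the denominators complementary, so that each half of the split sum is a harmonic
  -- sum.
  remainder-≤ : ∀ N → remainder N ≤ 1/1+ N * (harmonic N + harmonic N)
  remainder-≤ N = begin
    remainder N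
      ≤⟨ ∑ℚ-mono N (λ n n<N → ℚ.≤-trans
           (*-monoˡ (1/1+ (2 ℕ.* n)) (0≤1/1+ (2 ℕ.* n)) (window-≤ n n<N))
           (*-monoʳ (1/1+ (N ℕ.∸ suc n)) (0≤1/1+ (N ℕ.∸ suc n)) (1/1+-anti n (2 ℕ.* n) (ℕ.m≤m+n n (n ℕ.+ 0))))) ⟩
    ∑ℚ N (λ n → 1/1+ (N ℕ.∸ suc n) * 1/1+ n)
      ≡⟨ ∑ℚ-cong N (λ n n<N → 1/1+-*-1/1+ n<N) ⟩
    ∑ℚ N (λ n → 1/1+ N * (1/1+ (N ℕ.∸ suc n) + 1/1+ n))
      ≡⟨ trans (∑ℚ-*ˡ N (1/1+ N) _) (cong (1/1+ N *_) (∑ℚ-+ N (λ n → 1/1+ (N ℕ.∸ suc n)) 1/1+)) ⟩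
    1/1+ N * (∑ℚ N (λ n → 1/1+ (N ℕ.∸ suc n)) + harmonic N)
      ≡⟨ cong (λ z → 1/1+ N * (z + harmonic N)) (∑ℚ-reverse N 1/1+) ⟩
    1/1+ N * (harmonic N + harmonic N) ∎
    where
    open ℚ.≤-Reasoning
    window-≤ : ∀ n → n ℕ.< N → window N n ≤ 1/1+ (N ℕ.∸ suc n)
    window-≤ n n<N = subst (λ j → altHarmonic j - altHarmonic p ≤ 1/1+ p) p+l (altHarmonic-tail p (suc (n ℕ.+ n)))
      where
      p = N ℕ.∸ suc n
      p+l : p ℕ.+ suc (n ℕ.+ n) ≡ N ℕ.+ n
      p+l = trans (sym (ℕ.+-assoc p (suc n) n)) (cong (ℕ._+ n) (ℕ.m∸n+n≡m n<N))

  -- First `k` is chosen with `1/(k+1) ≤ ε/4`, then `N` large compared with `k`: the two halves of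
  -- `ε` pay for `2/(k+1)` and `2k/(N+1)`.
  remainder-small : ∀ ε → 0ℚ < ε → Eventually λ N → remainder N ≤ ε
  remainder-small ε 0<ε = K , λ N K≤N → begin
    remainder N                                        ≤⟨ remainder-≤ N ⟩
    1/1+ N * (harmonic N + harmonic N)                 ≤⟨ *-monoʳ (1/1+ N) (0≤1/1+ N) (ℚ.+-mono-≤ (harmonic-≤ k N) (harmonic-≤ k N)) ⟩
    1/1+ N * ((⌜ k ⌝ + ⌜ N ⌝ * r) + (⌜ k ⌝ + ⌜ N ⌝ * r))
      ≡⟨ solve 4 (λ m k n r → m :* ((k :+ n :* r) :+ (k :+ n :* r)) := (k :+ k) :* m :+ (n :* m) :* (r :+ r)) refl (1/1+ N) ⌜ k ⌝ ⌜ N ⌝ r ⟩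
    (⌜ k ⌝ + ⌜ k ⌝) * 1/1+ N + (⌜ N ⌝ * 1/1+ N) * (r + r)
      ≤⟨ ℚ.+-mono-≤ (*-mono (0≤⌜⌝ (suc (k ℕ.+ k))) (0≤1/1+ N) k+k≤ (proj₂ small₂ N K≤N))
                    (*-monoˡ (r + r) (0≤+ (0≤1/1+ k) (0≤1/1+ k)) (subst (⌜ N ⌝ * 1/1+ N ≤_) (⌜⌝*1/ N) (*-monoˡ (1/1+ N) (0≤1/1+ N) (⌜⌝-mono (ℕ.n≤1+n N))))) ⟩
    ⌜ suc (k ℕ.+ k) ⌝ * δ + 1ℚ * (r + r)               ≡⟨ cong₂ _+_ (proj₂ (proj₂ sh₂)) (ℚ.*-identityˡ (r + r)) ⟩
    ε * ½ + (r + r)                                    ≤⟨ ℚ.+-monoʳ-≤ (ε * ½) (ℚ.+-mono-≤ r≤η r≤η) ⟩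
    ε * ½ + (η + η)                                    ≡⟨ cong (λ z → ε * ½ + z) (½+½ (ε * ½)) ⟩
    ε * ½ + ε * ½                                      ≡⟨ ½+½ ε ⟩
    ε                                                  ∎
    where
    open ℚ.≤-Reasoning
    η = ε * ½ * ½
    0<ε½ = 0<* 0<ε 0<½
    small₁ = 1/1+-small (0<* 0<ε½ 0<½)
    k = proj₁ small₁
    r = 1/1+ k
    r≤η : r ≤ η
    r≤η = proj₂ small₁ k ℕ.≤-refl
    sh₂ = shrink (k ℕ.+ k) (ε * ½) 0<ε½
    δ = proj₁ sh₂
    small₂ = 1/1+-small (proj₁ (proj₂ sh₂))
    K = proj₁ small₂
    k+k≤ : ⌜ k ⌝ + ⌜ k ⌝ ≤ ⌜ suc (k ℕ.+ k) ⌝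
    k+k≤ = subst (_≤ ⌜ suc (k ℕ.+ k) ⌝) (⌜⌝-+ k k) (⌜⌝-mono (ℕ.n≤1+n (k ℕ.+ k)))

  -- From odd squares to all squares.

  1/1+-odd : ∀ k → 1/1+ (suc (k ℕ.+ k)) ≡ ½ * 1/1+ k
  1/1+-odd k = trans (cong 1/1+ (cong suc (cong (k ℕ.+_) (sym (ℕ.+-identityʳ k)))) ) (trans (cong 1/1+ (sym (ℕ.+-suc k (k ℕ.+ 0)))) (1/-* 2 (suc k)))

  ∑1/²-double : ∀ K → ∑1/² (K ℕ.+ K) ≡ ∑odd1/² K + ½ * ½ * ∑1/² K
  ∑1/²-double zero    = refl
  ∑1/²-double (suc K) = begin
    ∑1/² (suc K ℕ.+ suc K)                                     ≡⟨ cong (λ j → ∑1/² (suc j)) (ℕ.+-suc K K) ⟩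
    ∑1/² (K ℕ.+ K) + u * u + v * v                             ≡⟨ cong₂ (λ s t → s + t * t + v * v) (∑1/²-double K) (cong (λ j → 1/1+ (K ℕ.+ j)) (sym (ℕ.+-identityʳ K))) ⟩
    (O + ½ * ½ * Z) + w * w + v * v                            ≡⟨ cong (λ t → (O + ½ * ½ * Z) + w * w + t * t) (1/1+-odd K) ⟩
    (O + ½ * ½ * Z) + w * w + ½ * r * (½ * r)                  ≡⟨ solve 4 (λ O Z w r → (O :+ con ½ :* con ½ :* Z) :+ w :* w :+ con ½ :* r :* (con ½ :* r) :=
                                                                    (O :+ w :* w) :+ con ½ :* con ½ :* (Z :+ r :* r)) refl O Z w r ⟩
    (O + w * w) + ½ * ½ * (Z + r * r)                          ∎
    where
    open ≡-Reasoning
    O = ∑odd1/² K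
    Z = ∑1/² K
    u = 1/1+ (K ℕ.+ K)
    v = 1/1+ (suc (K ℕ.+ K))
    w = 1/1+ (2 ℕ.* K)
    r = 1/1+ K

  -- With `Z` for all and `O` for the odd denominators, `Z n ≤ Z (2n) = O n + Z n / 4`.
  3∑1/²≤4∑odd1/² : ∀ n → ⌜ 3 ⌝ * ∑1/² n ≤ ⌜ 4 ⌝ * ∑odd1/² n
  3∑1/²≤4∑odd1/² n = begin
    ⌜ 3 ⌝ * Z                        ≡⟨ solve 1 (λ Z → con ⌜ 3 ⌝ :* Z := con ⌜ 4 ⌝ :* Z :- Z) refl Z ⟩
    ⌜ 4 ⌝ * Z - Z                    ≤⟨ ℚ.+-monoˡ-≤ (- Z) (*-monoʳ ⌜ 4 ⌝ (0≤⌜⌝ 4) (∑ℚ-more (λ k → 1/1+ k * 1/1+ k) (λ k → 0≤* (0≤1/1+ k) (0≤1/1+ k)) (ℕ.m≤m+n n n))) ⟩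
    ⌜ 4 ⌝ * ∑1/² (n ℕ.+ n) - Z       ≡⟨ cong (λ z → ⌜ 4 ⌝ * z - Z) (∑1/²-double n) ⟩
    ⌜ 4 ⌝ * (O + ½ * ½ * Z) - Z      ≡⟨ solve 2 (λ O Z → con ⌜ 4 ⌝ :* (O :+ con ½ :* con ½ :* Z) :- Z := con ⌜ 4 ⌝ :* O) refl O Z ⟩
    ⌜ 4 ⌝ * O                        ∎
    where
    open ℚ.≤-Reasoning
    Z = ∑1/² n
    O = ∑odd1/² n

  -- In the limit, ∑ 1/j² ≤ (8/3) (π/4)² = π²/6.
  ∑1/²-leibniz : ∀ n ε → 0ℚ < ε → Eventually λ k → ⌜ 3 ⌝ * ∑1/² n ≤ ⌜ 8 ⌝ * (leibniz k * leibniz k) + ⌜ 4 ⌝ * ε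
  ∑1/²-leibniz n ε 0<ε = zipWith estimate (from n) (remainder-small ε 0<ε)
    where
    estimate : ∀ k → n ℕ.≤ k → remainder k ≤ ε → ⌜ 3 ⌝ * ∑1/² n ≤ ⌜ 8 ⌝ * (leibniz k * leibniz k) + ⌜ 4 ⌝ * ε
    estimate k n≤k r≤ε = begin
      ⌜ 3 ⌝ * ∑1/² n                                                        ≤⟨ 3∑1/²≤4∑odd1/² n ⟩
      ⌜ 4 ⌝ * ∑odd1/² n                                                     ≤⟨ *-monoʳ ⌜ 4 ⌝ (0≤⌜⌝ 4) (∑ℚ-more (λ j → 1/1+ (2 ℕ.* j) * 1/1+ (2 ℕ.* j)) (λ j → 0≤* (0≤1/1+ (2 ℕ.* j)) (0≤1/1+ (2 ℕ.* j))) n≤k) ⟩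
      ⌜ 4 ⌝ * ∑odd1/² k                                                     ≡⟨ cong (⌜ 4 ⌝ *_) (∑odd1/²≡ k) ⟩
      ⌜ 4 ⌝ * (leibniz k * leibniz k + leibniz k * leibniz k + remainder k) ≤⟨ *-monoʳ ⌜ 4 ⌝ (0≤⌜⌝ 4) (ℚ.+-monoʳ-≤ (leibniz k * leibniz k + leibniz k * leibniz k) r≤ε) ⟩
      ⌜ 4 ⌝ * (leibniz k * leibniz k + leibniz k * leibniz k + ε)           ≡⟨ solve 2 (λ l e → con ⌜ 4 ⌝ :* (l :+ l :+ e) := con ⌜ 8 ⌝ :* l :+ con ⌜ 4 ⌝ :* e) refl (leibniz k * leibniz k) ε ⟩
      ⌜ 8 ⌝ * (leibniz k * leibniz k) + ⌜ 4 ⌝ * ε                           ∎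
      where open ℚ.≤-Reasoning

module UpperBound where

  open Counting
  open Exponential
  open Zeta
  open import Data.Integer.Base as ℤ using (+_)
  open import Data.Nat.Base as ℕ using (ℕ; zero; suc; z≤n; s≤s; NonZero)
  import Data.Nat.Properties as ℕ
  open import Data.Product.Base using (∃; _×_; _,_)
  open import Data.Rational.Base as ℚ using (ℚ; 0ℚ; 1ℚ; ½; ∣_∣; _/_; _≤_; _<_; _+_; _*_; _-_)
  import Data.Rational.Properties as ℚ
  open import Data.Rational.Solver using (module +-*-Solver)
  open import Data.Sum.Base using (_⊎_; inj₁; inj₂)
  open import Relation.Binary.PropositionalEquality
  open import Relation.Nullary.Decidable using (from-no; from-yes)
  open import Relation.Nullary.Negation using (¬_; contradiction)
  open +-*-Solver using (solve; _:=_; _:+_; _:*_; _:-_; con)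
  open ℚ.≤-Reasoning

  -- Crude bounds for the approximations of `π / 4` and of the square root.

  ∣leibniz∣≤1 : ∀ k → ∣ leibniz k ∣ ≤ 1ℚ
  ∣leibniz∣≤1 k = lemma (leibniz k) (leibniz 0) (1/1+ 0) refl refl (leibniz-bound k 0)
    where
    lemma : ∀ p q r → q ≡ 0ℚ → r ≡ 1ℚ → ∣ p - q ∣ ≤ r → ∣ p ∣ ≤ 1ℚ
    lemma p .0ℚ .1ℚ refl refl = subst (λ z → ∣ z ∣ ≤ 1ℚ) (ℚ.+-identityʳ p)

  -- After the first term 1 the remainder is at most `1/3`.
  ½≤leibniz : ∀ k → ½ ≤ leibniz (suc k)
  ½≤leibniz k = lemma (leibniz (suc k)) (leibniz 1) (1/1+ 2) (from-yes (½ + 1/1+ 2 ℚ.≤? leibniz 1)) (leibniz-bound k 1)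
    where
    lemma : ∀ p q r → ½ + r ≤ q → ∣ p - q ∣ ≤ r → ½ ≤ p
    lemma p q r ½+r≤q h = subst (_≤ p) (solve 1 (λ r → (con ½ :+ r) :- r := con ½) refl r)
      (≤+⇒-≤ {½ + r} {r} {p} (ℚ.≤-trans ½+r≤q (subst (q ≤_) (ℚ.+-comm p r)
        (-≤⇒≤+ {q} {p} {r} (ℚ.≤-trans (p≤∣p∣ (q - p)) (subst (_≤ r) (∣p-q∣≡∣q-p∣ p q) h))))))

  leibniz²≤1 : ∀ k → leibniz k * leibniz k ≤ 1ℚ
  leibniz²≤1 k = begin
    L * L               ≤⟨ p≤∣p∣ (L * L) ⟩
    ∣ L * L ∣           ≡⟨ ℚ.∣p*q∣≡∣p∣*∣q∣ L L ⟩
    ∣ L ∣ * ∣ L ∣       ≤⟨ *-mono {∣ L ∣} {1ℚ} {∣ L ∣} {1ℚ} (0≤⌜⌝ 1) (ℚ.0≤∣p∣ L) (∣leibniz∣≤1 k) (∣leibniz∣≤1 k) ⟩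
    1ℚ                  ∎
    where L = leibniz k

  -- For `k ≥ 3` the grid width is at most `1/4`, so `r ≤ ½` would force `Q ≤ (3/4)² = 9/16`, below
  -- `2/3`.
  ½≤√-approx : ∀ Q k → ⌜ 2 ⌝ ≤ ⌜ 3 ⌝ * Q → 3 ℕ.≤ k → ½ ≤ √-approx Q k
  ½≤√-approx Q k 2≤3Q 3≤k = lemma (√-approx Q k) (1/1+ k) (0≤grid (√-grid Q k) k) (0≤1/1+ k)
    (1/1+-anti 3 k 3≤k) (ℚ.<⇒≤ (√-approx-upper Q k))
    where
    absurd : ¬ (⌜ 2 ⌝ ≤ ⌜ 3 ⌝ * (½ + 1/1+ 3) ²)
    absurd = from-no (⌜ 2 ⌝ ℚ.≤? ⌜ 3 ⌝ * (½ + 1/1+ 3) ²)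
    lemma : ∀ r h → 0ℚ ≤ r → 0ℚ ≤ h → h ≤ 1/1+ 3 → Q ≤ (r + h) ² → ½ ≤ r
    lemma r h 0≤r 0≤h h≤ Q≤ with ℚ.≤-total ½ r
    ... | inj₁ ½≤r = ½≤r
    ... | inj₂ r≤½ = contradiction
      (ℚ.≤-trans 2≤3Q (*-monoʳ ⌜ 3 ⌝ (0≤⌜⌝ 3) (ℚ.≤-trans Q≤ (²-mono {r + h} {½ + 1/1+ 3} (0≤+ 0≤r 0≤h) (ℚ.+-mono-≤ r≤½ h≤)))))
      absurd

  √-approx≤ : ∀ Q k → 0ℚ ≤ Q → √-approx Q k ≤ Q + 1ℚ
  √-approx≤ Q k 0≤Q = lemma (√-approx Q k) (0≤grid (√-grid Q k) k) (√-approx-lower Q k)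
    where
    lemma : ∀ r → 0ℚ ≤ r → (r ² ≤ Q) ⊎ (r ≡ 0ℚ) → r ≤ Q + 1ℚ
    lemma r 0≤r (inj₂ r≡0)  = ℚ.≤-trans (ℚ.≤-reflexive r≡0) (0≤+ 0≤Q (0≤⌜⌝ 1))
    lemma r 0≤r (inj₁ r²≤Q) with ℚ.≤-total r 1ℚ
    ... | inj₁ r≤1 = ℚ.≤-trans r≤1 (p≤q+p 0≤Q)
    ... | inj₂ 1≤r = begin
      r               ≡⟨ sym (ℚ.*-identityʳ r) ⟩
      r * 1ℚ          ≤⟨ *-monoʳ r 0≤r 1≤r ⟩
      r * r           ≤⟨ r²≤Q ⟩
      Q               ≤⟨ p≤p+q (0≤⌜⌝ 1) ⟩
      Q + 1ℚ          ∎

  shrink-below : ∀ p δ → 0ℚ < δ → ∃ λ η → 0ℚ < η × p * η ≤ δ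
  shrink-below p δ 0<δ = below ℤ.∣ ℚ.↥ p ∣ (≤⌜∣↥∣⌝ p)
    where
    below : ∀ M → p ≤ ⌜ M ⌝ → ∃ λ η → 0ℚ < η × p * η ≤ δ
    below M p≤M =
      let η , 0<η , eq = shrink M δ 0<δ in
      η , 0<η , ℚ.≤-trans
        (*-monoˡ {p} {⌜ suc M ⌝} η (ℚ.<⇒≤ 0<η) (ℚ.≤-trans p≤M (⌜⌝-mono {M} {suc M} (ℕ.n≤1+n M))))
        (ℚ.≤-reflexive eq)

  -- The optimal exponent up to errors.

  -- Rounding the root to a grid of width `h` costs `16 L² h (2r + h)`, where `L² ≤ 1`, `r ≤ Q + 1`
  -- and `h ≤ 1`. The constant also dominates `8 Q`, the factor of `η` in `bound-by-Q`.
  errorConstant : ℚ → ℚ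
  errorConstant Q = ⌜ 16 ⌝ * (⌜ 2 ⌝ * (Q + 1ℚ) + 1ℚ)

  8Q≤errorConstant : ∀ {Q} → 0ℚ ≤ Q → ⌜ 8 ⌝ * Q ≤ errorConstant Q
  8Q≤errorConstant {Q} 0≤Q = subst (⌜ 8 ⌝ * Q ≤_)
    (solve 1 (λ Q → con ⌜ 8 ⌝ :* Q :+ (con ⌜ 24 ⌝ :* Q :+ con ⌜ 48 ⌝) := con ⌜ 16 ⌝ :* (con ⌜ 2 ⌝ :* (Q :+ con 1ℚ) :+ con 1ℚ)) refl Q)
    (p≤p+q {⌜ 8 ⌝ * Q} (0≤+ (0≤* (0≤⌜⌝ 24) 0≤Q) (0≤⌜⌝ 48)))

  module _ (d n Z Q L r h δ η : ℚ)
    (3Q≡2dn : ⌜ 3 ⌝ * Q ≡ ⌜ 2 ⌝ * d * n) (0≤Q : 0ℚ ≤ Q)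
    (3Z≤ : ⌜ 3 ⌝ * Z ≤ ⌜ 8 ⌝ * (L * L) + ⌜ 4 ⌝ * η) (Q≤ : Q ≤ (r + h) ²) (L²≤1 : L * L ≤ 1ℚ) (0≤L² : 0ℚ ≤ L * L)
    (0≤r : 0ℚ ≤ r) (r≤ : r ≤ Q + 1ℚ) (0≤h : 0ℚ ≤ h) (h≤1 : h ≤ 1ℚ) (h≤η : h ≤ η)
    (0≤δ : 0ℚ ≤ δ) (error≤ : errorConstant Q * η ≤ δ) where

    private
      x = ⌜ 4 ⌝ * L * r
      0≤η = ℚ.≤-trans 0≤h h≤η

    -- Since `3 Q = 2 d n`, the bound `(8/3) L²` for `Z` becomes `16 Q L²`, the square of `4 L`
    -- times the root of `Q`.
    bound-by-Q : ⌜ 4 ⌝ * n * d * Z ≤ ⌜ 16 ⌝ * (Q * (L * L)) + ⌜ 8 ⌝ * Q * η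
    bound-by-Q = ℚ.*-cancelˡ-≤-pos ⌜ 3 ⌝ (begin
      ⌜ 3 ⌝ * (⌜ 4 ⌝ * n * d * Z)
        ≡⟨ solve 3 (λ d n Z → con ⌜ 3 ⌝ :* (con ⌜ 4 ⌝ :* n :* d :* Z) := (con ⌜ 2 ⌝ :* d :* n) :* (con ⌜ 2 ⌝ :* (con ⌜ 3 ⌝ :* Z))) refl d n Z ⟩
      (⌜ 2 ⌝ * d * n) * (⌜ 2 ⌝ * (⌜ 3 ⌝ * Z))
        ≤⟨ *-monoʳ (⌜ 2 ⌝ * d * n) (subst (0ℚ ≤_) 3Q≡2dn (0≤* (0≤⌜⌝ 3) 0≤Q)) (*-monoʳ ⌜ 2 ⌝ (0≤⌜⌝ 2) 3Z≤) ⟩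
      (⌜ 2 ⌝ * d * n) * (⌜ 2 ⌝ * (⌜ 8 ⌝ * (L * L) + ⌜ 4 ⌝ * η))
        ≡⟨ cong (_* (⌜ 2 ⌝ * (⌜ 8 ⌝ * (L * L) + ⌜ 4 ⌝ * η))) (sym 3Q≡2dn) ⟩
      (⌜ 3 ⌝ * Q) * (⌜ 2 ⌝ * (⌜ 8 ⌝ * (L * L) + ⌜ 4 ⌝ * η))
        ≡⟨ solve 3 (λ Q l η → (con ⌜ 3 ⌝ :* Q) :* (con ⌜ 2 ⌝ :* (con ⌜ 8 ⌝ :* l :+ con ⌜ 4 ⌝ :* η)) :=
                     con ⌜ 3 ⌝ :* (con ⌜ 16 ⌝ :* (Q :* l) :+ con ⌜ 8 ⌝ :* Q :* η)) refl Q (L * L) η ⟩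
      ⌜ 3 ⌝ * (⌜ 16 ⌝ * (Q * (L * L)) + ⌜ 8 ⌝ * Q * η) ∎)

    -- The rounding error of `r` and the error in `Z` are at most `δ` each. Then `1 ≤ x` turns `2 δ`
    -- into `2 δ x`, the form in which a slack `δ` in the exponent enters.
    square-bound : 1ℚ ≤ x → ⌜ 4 ⌝ * n * d * Z ≤ x * x + ⌜ 2 ⌝ * δ * x
    square-bound 1≤x = begin
      ⌜ 4 ⌝ * n * d * Z
        ≤⟨ bound-by-Q ⟩
      ⌜ 16 ⌝ * (Q * (L * L)) + ⌜ 8 ⌝ * Q * η
        ≤⟨ ℚ.+-mono-≤ (*-monoʳ ⌜ 16 ⌝ (0≤⌜⌝ 16) (*-monoˡ (L * L) 0≤L² Q≤)) (ℚ.≤-trans (*-monoˡ η 0≤η (8Q≤errorConstant 0≤Q)) error≤) ⟩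
      ⌜ 16 ⌝ * ((r + h) * (r + h) * (L * L)) + δ
        ≡⟨ cong (_+ δ) (solve 3 (λ r h L → con ⌜ 16 ⌝ :* ((r :+ h) :* (r :+ h) :* (L :* L)) :=
             (con ⌜ 4 ⌝ :* L :* r) :* (con ⌜ 4 ⌝ :* L :* r) :+ con ⌜ 16 ⌝ :* ((L :* L) :* (h :* (con ⌜ 2 ⌝ :* r :+ h)))) refl r h L) ⟩
      x * x + ⌜ 16 ⌝ * ((L * L) * (h * (⌜ 2 ⌝ * r + h))) + δ
        ≤⟨ ℚ.+-monoˡ-≤ δ (ℚ.+-monoʳ-≤ (x * x) (*-monoʳ ⌜ 16 ⌝ (0≤⌜⌝ 16)
             (*-mono {L * L} {1ℚ} {h * (⌜ 2 ⌝ * r + h)} {η * (⌜ 2 ⌝ * (Q + 1ℚ) + 1ℚ)} (0≤⌜⌝ 1) (0≤* 0≤h (0≤+ (0≤* (0≤⌜⌝ 2) 0≤r) 0≤h)) L²≤1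
               (*-mono {h} {η} {⌜ 2 ⌝ * r + h} {⌜ 2 ⌝ * (Q + 1ℚ) + 1ℚ} 0≤η (0≤+ (0≤* (0≤⌜⌝ 2) 0≤r) 0≤h) h≤η (ℚ.+-mono-≤ (*-monoʳ ⌜ 2 ⌝ (0≤⌜⌝ 2) r≤) h≤1))))) ⟩
      x * x + ⌜ 16 ⌝ * (1ℚ * (η * (⌜ 2 ⌝ * (Q + 1ℚ) + 1ℚ))) + δ
        ≡⟨ cong (λ z → x * x + z + δ) (solve 2 (λ η t → con ⌜ 16 ⌝ :* (con 1ℚ :* (η :* t)) := (con ⌜ 16 ⌝ :* t) :* η) refl η (⌜ 2 ⌝ * (Q + 1ℚ) + 1ℚ)) ⟩
      x * x + errorConstant Q * η + δ
        ≤⟨ ℚ.+-monoˡ-≤ δ (ℚ.+-monoʳ-≤ (x * x) error≤) ⟩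
      x * x + δ + δ
        ≡⟨ solve 2 (λ X δ → X :+ δ :+ δ := X :+ con ⌜ 2 ⌝ :* δ :* con 1ℚ) refl (x * x) δ ⟩
      x * x + ⌜ 2 ⌝ * δ * 1ℚ
        ≤⟨ ℚ.+-monoʳ-≤ (x * x) (*-monoʳ (⌜ 2 ⌝ * δ) (0≤* (0≤⌜⌝ 2) 0≤δ) 1≤x) ⟩
      x * x + ⌜ 2 ⌝ * δ * x ∎

  ∑ℤ/1 : ∀ n f → ∑ℤ n f / 1 ≡ ∑ℚ n (coefficient f)
  ∑ℤ/1 zero    f = refl
  ∑ℤ/1 (suc n) f = trans (/1-+ (∑ℤ n f) (f n)) (cong (_+ f n / 1) (∑ℤ/1 n f))


  -- s = x / 2n minimises n s + d Z / s, up to the error terms.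
  ∑coefficients-≤-expSum : ∀ d n′ {x δ} → let n = suc n′ in 1ℚ ≤ x → 0ℚ ≤ δ →
    ⌜ 4 ⌝ * ⌜ n ⌝ * ⌜ d ⌝ * ∑1/² n ≤ x * x + ⌜ 2 ⌝ * δ * x →
    ∑ℚ (suc n) (coefficient (partialProduct (eulerFactors d) n)) ≤ expSum (n ℕ.+ suc n) (x + δ)
  ∑coefficients-≤-expSum d n′ {x} {δ} 1≤x 0≤δ h = subst (∑ℚ (suc n) (coefficient (partialProduct (eulerFactors d) n)) ≤_)
    (cong (expSum (n ℕ.+ suc n)) (trans (cong (λ z → q + z) ns) (solve 2 (λ x δ → (x :* con ½ :+ δ) :+ x :* con ½ := x :+ δ) refl x δ)))
    (∑coefficients-≤ d n 0<s (0≤+ (0≤* 0≤x (ℚ.<⇒≤ 0<½)) 0≤δ) (ℚ.*-cancelˡ-≤-pos (⌜ 4 ⌝ * ⌜ n ⌝) {{ℚ.positive 0<4n}} (begin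
      ⌜ 4 ⌝ * ⌜ n ⌝ * (⌜ d ⌝ * ∑1/² n)      ≡⟨ sym (ℚ.*-assoc (⌜ 4 ⌝ * ⌜ n ⌝) ⌜ d ⌝ (∑1/² n)) ⟩
      ⌜ 4 ⌝ * ⌜ n ⌝ * ⌜ d ⌝ * ∑1/² n        ≤⟨ h ⟩
      x * x + ⌜ 2 ⌝ * δ * x                 ≡⟨ solve 2 (λ x δ → x :* x :+ con ⌜ 2 ⌝ :* δ :* x := con ⌜ 4 ⌝ :* (x :* con ½) :* (x :* con ½ :+ δ)) refl x δ ⟩
      ⌜ 4 ⌝ * (x * ½) * q                   ≡⟨ cong (λ z → ⌜ 4 ⌝ * z * q) (sym ns) ⟩
      ⌜ 4 ⌝ * (⌜ n ⌝ * s) * q               ≡⟨ solve 4 (λ c n s q → c :* (n :* s) :* q := c :* n :* (s :* q)) refl ⌜ 4 ⌝ ⌜ n ⌝ s q ⟩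
      ⌜ 4 ⌝ * ⌜ n ⌝ * (s * q)               ∎)))
    where
    n = suc n′
    s = x * (½ * 1/1+ n′)
    -- Both `n s` and the bound for `d Z / s` are `x / 2` at the optimum; the slack goes into `q`,
    -- so that `4 n s q = x² + 2 δ x`.
    q = x * ½ + δ
    0<x = ℚ.<-≤-trans (0<1/1+ 0) 1≤x
    0≤x = ℚ.<⇒≤ 0<x
    0<s : 0ℚ < s
    0<s = 0<* 0<x (0<* 0<½ (0<1/1+ n′))
    0<4n : 0ℚ < ⌜ 4 ⌝ * ⌜ n ⌝
    0<4n = 0<* (ℚ.<-≤-trans (0<1/1+ 0) (⌜⌝-mono {1} {4} (s≤s z≤n))) (ℚ.<-≤-trans (0<1/1+ 0) (⌜⌝-mono {1} {n} (s≤s z≤n)))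
    ns : ⌜ n ⌝ * s ≡ x * ½
    ns = trans (solve 3 (λ n x r → n :* (x :* (con ½ :* r)) := (n :* r) :* (x :* con ½)) refl ⌜ n ⌝ x (1/1+ n′))
      (trans (cong (_* (x * ½)) (⌜⌝*1/ n′)) (ℚ.*-identityˡ (x * ½)))

  module _ (d n′ : ℕ) (Q : ℚ) (0≤Q : 0ℚ ≤ Q) (2≤3Q : ⌜ 2 ⌝ ≤ ⌜ 3 ⌝ * Q) (3Q≡2dn : ⌜ 3 ⌝ * Q ≡ ⌜ 2 ⌝ * ⌜ d ⌝ * ⌜ suc n′ ⌝) where
    private
      n = suc n′

      x : ℕ → ℚ
      x k = ⌜ 4 ⌝ * leibniz k * √-approx Q k

      ½≤leibniz-tail : ∀ k → 3 ℕ.≤ k → ½ ≤ leibniz k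
      ½≤leibniz-tail (suc k) _ = ½≤leibniz k

      -- From `4 · ½ · ½ = 1`.
      1≤x : ∀ k → 3 ℕ.≤ k → 1ℚ ≤ x k
      1≤x k 3≤k = *-mono {⌜ 4 ⌝ * ½} {⌜ 4 ⌝ * leibniz k} {½} {√-approx Q k}
        (0≤* {⌜ 4 ⌝} {leibniz k} (0≤⌜⌝ 4) (ℚ.≤-trans (ℚ.<⇒≤ 0<½) (½≤leibniz-tail k 3≤k))) (ℚ.<⇒≤ 0<½)
        (*-monoʳ ⌜ 4 ⌝ (0≤⌜⌝ 4) (½≤leibniz-tail k 3≤k)) (½≤√-approx Q k 2≤3Q 3≤k)

    ∑coefficients-≤-expSum-π√ : ∀ δ → 0ℚ < δ → Eventually λ k →
      ∑ℚ (suc n) (coefficient (partialProduct (eulerFactors d) n)) ≤ expSum k (x k + δ)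
    ∑coefficients-≤-expSum-π√ δ 0<δ = eventually (shrink-below (errorConstant Q) δ 0<δ)
      where
      estimate : ∀ η → errorConstant Q * η ≤ δ → ∀ k → 3 ℕ.≤ k × n ℕ.+ suc n ℕ.≤ k →
        (⌜ 3 ⌝ * ∑1/² n ≤ ⌜ 8 ⌝ * (leibniz k * leibniz k) + ⌜ 4 ⌝ * η) × 1/1+ k ≤ η →
        ∑ℚ (suc n) (coefficient (partialProduct (eulerFactors d) n)) ≤ expSum k (x k + δ)
      estimate η error≤ k (3≤k , 2n≤k) (3Z≤ , h≤η) = ℚ.≤-trans
        (∑coefficients-≤-expSum d n′ {x k} {δ} (1≤x k 3≤k) (ℚ.<⇒≤ 0<δ)
          (square-bound ⌜ d ⌝ ⌜ n ⌝ (∑1/² n) Q (leibniz k) (√-approx Q k) (1/1+ k) δ η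
            3Q≡2dn 0≤Q 3Z≤ (ℚ.<⇒≤ (√-approx-upper Q k))
            (leibniz²≤1 k) (0≤* {leibniz k} {leibniz k} 0≤L 0≤L)
            (0≤grid (√-grid Q k) k) (√-approx≤ Q k 0≤Q) (0≤1/1+ k) (1/1+-anti 0 k z≤n) h≤η
            (ℚ.<⇒≤ 0<δ) error≤ (1≤x k 3≤k)))
        (expSum-more {q = x k + δ} (0≤+ {x k} {δ} (ℚ.≤-trans (0≤⌜⌝ 1) (1≤x k 3≤k)) (ℚ.<⇒≤ 0<δ)) 2n≤k)
        where
        0≤L = ℚ.≤-trans (ℚ.<⇒≤ 0<½) (½≤leibniz-tail k 3≤k)

      eventually : (∃ λ η → 0ℚ < η × errorConstant Q * η ≤ δ) → Eventually λ k →
        ∑ℚ (suc n) (coefficient (partialProduct (eulerFactors d) n)) ≤ expSum k (x k + δ)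
      eventually (η , 0<η , error≤) = zipWith (estimate η error≤)
        (zipWith (λ _ → _,_) (from 3) (from (n ℕ.+ suc n)))
        (zipWith (λ _ → _,_) (∑1/²-leibniz n η 0<η) (1/1+-small 0<η))

  -- Removing the errors in the limit.

  module _ (X : ℝ) (P : ℚ) (P≤ : ∀ δ → 0ℚ < δ → Eventually λ k → P ≤ expSum k (seq X k + δ)) where

    -- On `[-B, B]` the `k`-th partial sum is Lipschitz with constant `expSum k B`, eventually at
    -- most `c + 1`, so `δ = ε / (c + 1)` costs at most `ε`. As `B` is fixed before `δ`, the
    -- restriction `ε ≤ 1` serves to keep `δ ≤ 1`.
    ≤exp-small : ∀ ε → 0ℚ < ε → ε ≤ 1ℚ → Eventually λ k → P ≤ expSum k (seq X k) + ε
    ≤exp-small ε 0<ε ε≤1 = bounded (cauchy⇒bounded (cauchy X))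
      where
      lipschitz : ∀ b c δ → 0ℚ ≤ δ → ⌜ suc c ⌝ * δ ≡ ε → ∀ k →
        ∣ seq X k ∣ ≤ ⌜ suc b ⌝ × P ≤ expSum k (seq X k + δ) → expSum k ⌜ suc (suc b) ⌝ ≤ ⌜ suc c ⌝ →
        P ≤ expSum k (seq X k) + ε
      lipschitz b c δ 0≤δ eq k (x≤b , P≤k) E≤c = begin
        P                                        ≤⟨ P≤k ⟩
        expSum k (x + δ)                         ≤⟨ -≤⇒≤+ {expSum k (x + δ)} {expSum k x} (ℚ.≤-trans (p≤∣p∣ (expSum k (x + δ) - expSum k x)) (expSum-lipschitz {x + δ} {x} {B} k x+δ≤B x≤B)) ⟩
        expSum k x + ∣ x + δ - x ∣ * expSum k B  ≡⟨ cong (λ z → expSum k x + z * expSum k B) (trans (cong ∣_∣ (solve 2 (λ x δ → x :+ δ :- x := δ) refl x δ)) (ℚ.0≤p⇒∣p∣≡p 0≤δ)) ⟩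
        expSum k x + δ * expSum k B              ≤⟨ ℚ.+-monoʳ-≤ (expSum k x) (*-monoʳ δ 0≤δ E≤c) ⟩
        expSum k x + δ * ⌜ suc c ⌝               ≡⟨ cong (λ z → expSum k x + z) (trans (ℚ.*-comm δ ⌜ suc c ⌝) eq) ⟩
        expSum k x + ε                           ∎
        where
        x = seq X k
        -- One more than the bound for `X`, to make room for `δ ≤ 1`.
        B = ⌜ suc (suc b) ⌝
        δ≤1 : δ ≤ 1ℚ
        δ≤1 = begin
          δ                  ≡⟨ sym (ℚ.*-identityˡ δ) ⟩
          1ℚ * δ             ≤⟨ *-monoˡ δ 0≤δ (⌜⌝-mono {1} {suc c} (s≤s z≤n)) ⟩
          ⌜ suc c ⌝ * δ      ≡⟨ eq ⟩
          ε                  ≤⟨ ε≤1 ⟩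
          1ℚ                 ∎
        x≤B : ∣ x ∣ ≤ B
        x≤B = ℚ.≤-trans x≤b (⌜⌝-mono (ℕ.n≤1+n (suc b)))
        x+δ≤B : ∣ x + δ ∣ ≤ B
        x+δ≤B = begin
          ∣ x + δ ∣            ≤⟨ ℚ.∣p+q∣≤∣p∣+∣q∣ x δ ⟩
          ∣ x ∣ + ∣ δ ∣        ≤⟨ ℚ.+-mono-≤ x≤b (ℚ.≤-trans (ℚ.≤-reflexive (ℚ.0≤p⇒∣p∣≡p 0≤δ)) δ≤1) ⟩
          ⌜ suc b ⌝ + 1ℚ       ≡⟨ trans (ℚ.+-comm ⌜ suc b ⌝ 1ℚ) (sym (⌜suc⌝ (suc b))) ⟩
          B                    ∎

      shrunk : ∀ b c → Eventually (λ k → ∣ seq X k ∣ ≤ ⌜ suc b ⌝) → Eventually (λ k → expSum k ⌜ suc (suc b) ⌝ ≤ ⌜ suc c ⌝) →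
        (∃ λ δ → 0ℚ < δ × ⌜ suc c ⌝ * δ ≡ ε) → Eventually λ k → P ≤ expSum k (seq X k) + ε
      shrunk b c X≤b E≤c (δ , 0<δ , eq) = zipWith (lipschitz b c δ (ℚ.<⇒≤ 0<δ) eq) (zipWith (λ _ → _,_) X≤b (P≤ δ 0<δ)) E≤c

      at : ∀ b → Eventually (λ k → ∣ seq X k ∣ ≤ ⌜ suc b ⌝) →
        (∃ λ c → Eventually λ k → expSum k ⌜ suc (suc b) ⌝ ≤ ⌜ suc c ⌝) → Eventually λ k → P ≤ expSum k (seq X k) + ε
      at b X≤b (c , E≤c) = shrunk b c X≤b E≤c (shrink c ε 0<ε)

      bounded : EventuallyBounded (seq X) → Eventually λ k → P ≤ expSum k (seq X k) + ε
      bounded (b , X≤b) = at b X≤b (expSum-bounded (suc b))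

    ≤exp : fromℚ P ≤ᴿ exp X
    ≤exp ε 0<ε with ℚ.≤-total ε 1ℚ
    ... | inj₁ ε≤1 = ≤exp-small ε 0<ε ε≤1
    ... | inj₂ 1≤ε = weaken (≤exp-small 1ℚ (0<1/1+ 0) ℚ.≤-refl)
      where
      weaken : Eventually (λ k → P ≤ expSum k (seq X k) + 1ℚ) → Eventually (λ k → P ≤ expSum k (seq X k) + ε)
      weaken (K , estimate) = K , λ k K≤k → ℚ.≤-trans (estimate k K≤k) (ℚ.+-monoʳ-≤ (expSum k (seq X k)) 1≤ε)

  -- Specialisation to `Q = 2dn / 3`.

  ∑eulerProduct : ∀ d n → ∑ℤ (suc n) (eulerProduct d) / 1 ≡ ∑ℚ (suc n) (coefficient (partialProduct (eulerFactors d) n))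
  ∑eulerProduct d n = trans
    (cong (_/ 1) (∑ℤ-cong (suc n) λ m m<1+n → eulerProduct≡partialProduct d (ℕ.≤-pred m<1+n)))
    (∑ℤ/1 (suc n) (partialProduct (eulerFactors d) n))

  seq-π√ : ∀ Q k → seq (π *ᴿ √ (fromℚ Q)) k ≡ ⌜ 4 ⌝ * leibniz k * √-approx Q k
  seq-π√ Q k = refl

  3*/3 : ∀ m → ⌜ 3 ⌝ * (+ m / 3) ≡ ⌜ m ⌝
  3*/3 m = trans (cong (⌜ 3 ⌝ *_) (/-split (+ m) 2)) (lemma ⌜ m ⌝)
    where
    lemma : ∀ p → ⌜ 3 ⌝ * (p * 1/1+ 2) ≡ p
    lemma p = solve 1 (λ p → con ⌜ 3 ⌝ :* (p :* con (1/1+ 2)) := p) refl p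

  ∑eulerProduct-≤-exp-π√ : ∀ d n′ Q → 0ℚ ≤ Q → ⌜ 2 ⌝ ≤ ⌜ 3 ⌝ * Q → ⌜ 3 ⌝ * Q ≡ ⌜ 2 ⌝ * ⌜ d ⌝ * ⌜ suc n′ ⌝ →
    fromℚ (∑ℤ (suc (suc n′)) (eulerProduct d) / 1) ≤ᴿ exp (π *ᴿ √ (fromℚ Q))
  ∑eulerProduct-≤-exp-π√ d n′ Q 0≤Q 2≤3Q 3Q≡2dn = ≤exp (π *ᴿ √ (fromℚ Q)) _ λ δ 0<δ →
    transfer δ (∑coefficients-≤-expSum-π√ d n′ Q 0≤Q 2≤3Q 3Q≡2dn δ 0<δ)
    where
    transfer : ∀ δ →
      Eventually (λ k → ∑ℚ (suc (suc n′)) (coefficient (partialProduct (eulerFactors d) (suc n′))) ≤ expSum k (⌜ 4 ⌝ * leibniz k * √-approx Q k + δ)) →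
      Eventually (λ k → ∑ℤ (suc (suc n′)) (eulerProduct d) / 1 ≤ expSum k (seq (π *ᴿ √ (fromℚ Q)) k + δ))
    transfer δ (K , estimate) = K , λ k K≤k →
      subst₂ (λ p x → p ≤ expSum k (x + δ)) (sym (∑eulerProduct d (suc n′))) (sym (seq-π√ Q k)) (estimate k K≤k)

  ⌜2dn⌝ : ∀ d n → ⌜ 2 ℕ.* d ℕ.* n ⌝ ≡ ⌜ 2 ⌝ * ⌜ d ⌝ * ⌜ n ⌝
  ⌜2dn⌝ d n = trans (⌜⌝-* (2 ℕ.* d) n) (cong (_* ⌜ n ⌝) (⌜⌝-* 2 d))

  ∑eulerProduct-≤-exp-m/3 : ∀ d n′ m → 2 ℕ.≤ m → ⌜ m ⌝ ≡ ⌜ 2 ⌝ * ⌜ d ⌝ * ⌜ suc n′ ⌝ →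
    fromℚ (∑ℤ (suc (suc n′)) (eulerProduct d) / 1) ≤ᴿ exp (π *ᴿ √ (fromℚ (+ m / 3)))
  ∑eulerProduct-≤-exp-m/3 d n′ m 2≤m m≡2dn = ∑eulerProduct-≤-exp-π√ d n′ (+ m / 3)
    (0≤grid m 2) (subst (⌜ 2 ⌝ ≤_) (sym (3*/3 m)) (⌜⌝-mono {2} {m} 2≤m)) (trans (3*/3 m) m≡2dn)

  ∑eulerProduct-≤-exp : ∀ d .{{_ : NonZero d}} n .{{_ : NonZero n}} →
    fromℚ (∑ℤ (suc n) (eulerProduct d) / 1) ≤ᴿ exp (π *ᴿ √ (fromℚ (+ (2 ℕ.* d ℕ.* n) / 3)))
  ∑eulerProduct-≤-exp d (suc n′) = ∑eulerProduct-≤-exp-m/3 d n′ (2 ℕ.* d ℕ.* suc n′)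
    (ℕ.≤-trans (ℕ.m≤m*n 2 d) (ℕ.m≤m*n (2 ℕ.* d) (suc n′))) (⌜2dn⌝ d (suc n′))

open import Data.Nat using (ℕ; suc; NonZero; _*_)
open import Data.Integer using (+_)
open import Data.Product using (∃; _×_; _,_)
open import Data.Rational using (_/_)
open import Relation.Binary.PropositionalEquality using (_≡_)

proposition5p1 : (d : ℕ) .{{_ : NonZero d}} (n : ℕ) .{{_ : NonZero n}} →
    (∃ λ k → HasCardinality (ℋ d n) k
           × + k ≡ ∑ℤ (suc n) (λ m → [x^ m ] eulerProduct d))
    × fromℚ (∑ℤ (suc n) (λ m → [x^ m ] eulerProduct d) / 1)
        ≤ᴿ exp (π *ᴿ √ (fromℚ (+ (2 * d * n) / 3)))
proposition5p1 d n = Counting.∃-cardinality d n , UpperBound.∑eulerProduct-≤-exp d n
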